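{- **1.** Let $G$ be a graph with nodes $1,\dots,n$ and stability number $\alpha(G)$, and let $r\ge 1$ be an integer. A minimum-degree Nullstellensatz certificate for the non-existence of a stable set of size $\alpha(G)+r$, i.e. a minimum-degree certificate $$1=A\Big(-(\alpha(G)+r)+\sum_{i=1}^n x_i\Big)+\sum_{i\in V(G)}Q_i\,(x_i^2-x_i)+\sum_{\{i,j\}\in E(G)}Q_{ij}\,x_ix_j,\qquad A,Q_i,Q_{ij}\in\mathbb{C}[x_1,\dots,x_n],$$ has degree equal to $\alpha(G)$ and contains at least one term per stable set in $G$ (that is, the total number of monomials occurring with non-zero coefficient in the coefficient polynomials $A,Q_i,Q_{ij}$ is at least the number of stable sets of $G$). **2.** Every Nullstellensatz certificate for non-3-colorability of a (non-3-colorable) graph has degree at least four. Moreover, if a graph contains an odd-wheel or a clique $K_n$ with $n\ge 4$ as a subgraph, then a minimum-degree Nullstellensatz certificate for its non-3-colorability has degree exactly four.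
   Context: Graphs are finite, undirected and simple. A stable set is a set of pairwise non-adjacent vertices; $\alpha(G)$ is the maximum size of a stable set. The degree of a certificate in Part 1 is $\max\{\deg A,\deg Q_i,\deg Q_{ij}\}$ over all coefficient polynomials; minimum-degree means of least degree among all certificates for the given system. A Nullstellensatz certificate for non-3-colorability of a graph $G$ with nodes $1,\dots,n$ is an identity $$1=\sum_{i\in V(G)}P_{\{i\}}\,(x_i^3-1)+\sum_{\{i,j\}\in E(G)}P_{\{ij\}}\,(x_i^2+x_ix_j+x_j^2),\qquad P_{\{i\}},P_{\{ij\}}\in\mathbb{C}[x_1,\dots,x_n];$$ its degree is the maximum of the degrees of the coefficient polynomials $P_{\{i\}},P_{\{ij\}}$. (The system $x_i^3-1=0$, $x_i^2+x_ix_j+x_j^2=0$ has a complex solution iff $G$ is 3-colorable.) An odd-wheel is a graph consisting of an odd cycle (the rim, of odd length at least 3) together with a center vertex adjacent to all rim vertices. -}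

module Defs where

open import Algebra.Bundles using (CommutativeMonoid)
open import Algebra.Properties.AbelianGroup using (xyx⁻¹≈y)
open import Algebra.Properties.CommutativeSemigroup using (interchange)
open import Data.Fin.Base as Fin using (Fin; toℕ)
import Data.Fin.Properties as Fin
open import Data.Fin.Subset using (Subset; _∈_; ∣_∣; inside; outside)
open import Data.Fin.Subset.Properties using (_∈?_)
open import Data.Integer.Base using (+_)
open import Data.List.Base
  using (List; []; _∷_; _++_; map; concatMap; foldr; filter; length; lookup; allFin; cartesianProduct)
open import Data.List.Relation.Unary.All using (All)
open import Data.List.Relation.Unary.Unique.Propositional using (Unique)
open import Data.Nat.Base as ℕ using (ℕ; zero; suc; _⊔_)
import Data.Nat.Properties as ℕ
open import Data.Product.Base using (∃; _×_; _,_; proj₁; proj₂)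
open import Data.Rational.Base as ℚ using (ℚ; 0ℚ; 1ℚ; 1/_)
import Data.Rational.Properties as ℚ
open import Data.Sum.Base as Sum using (_⊎_; inj₁; inj₂)
open import Data.Vec.Base as Vec using (Vec; []; _∷_)
import Data.Vec.Functional as Vector
import Data.Vec.Properties as Vec
open import Function.Definitions using (Injective)
open import Level using (0ℓ)
open import Relation.Binary.Core using (Rel)
open import Relation.Binary.Definitions using (Decidable; Symmetric; Irreflexive)
open import Relation.Binary.PropositionalEquality
open import Relation.Nullary.Decidable using (Dec; yes; no; ¬?; _×-dec_; _⊎-dec_; _→-dec_)
open import Relation.Nullary.Negation using (¬_)

------------------------------------------------------------------------
-- Real numbers: Cauchy sequences of rationals, up to _≈ᴿ_.

EventuallyAlways : (ℕ → Set) → Set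
EventuallyAlways P = ∃ λ N → ∀ n → N ℕ.≤ n → P n

IsCauchy : (ℕ → ℚ) → Set
IsCauchy x = ∀ ε → 0ℚ ℚ.< ε →
  ∃ λ N → ∀ m n → N ℕ.≤ m → N ℕ.≤ n → ℚ.∣ x m ℚ.- x n ∣ ℚ.< ε

abstract
  split : ∀ a b c d → (a ℚ.+ b) ℚ.- (c ℚ.+ d) ≡ (a ℚ.- c) ℚ.+ (b ℚ.- d)
  split a b c d = trans (cong ((a ℚ.+ b) ℚ.+_) (ℚ.neg-distrib-+ c d))
                        (interchange (CommutativeMonoid.commutativeSemigroup ℚ.+-0-commutativeMonoid)
                                     a b (ℚ.- c) (ℚ.- d))

  split-neg : ∀ a b → (ℚ.- a) ℚ.- (ℚ.- b) ≡ ℚ.- (a ℚ.- b)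
  split-neg a b = sym (ℚ.neg-distrib-+ a (ℚ.- b))

  recover : ∀ a b → a ≡ b ℚ.+ (a ℚ.- b)
  recover a b = sym (trans (sym (ℚ.+-assoc b a (ℚ.- b))) (xyx⁻¹≈y ℚ.+-0-abelianGroup b a))

  *-distribˡ-- : ∀ a b c → a ℚ.* (b ℚ.- c) ≡ a ℚ.* b ℚ.- a ℚ.* c
  *-distribˡ-- a b c = trans (ℚ.*-distribˡ-+ a b (ℚ.- c))
                             (cong (a ℚ.* b ℚ.+_) (sym (ℚ.neg-distribʳ-* a c)))

  split-* : ∀ a b c d → (a ℚ.* b) ℚ.- (c ℚ.* d) ≡ a ℚ.* (b ℚ.- d) ℚ.+ d ℚ.* (a ℚ.- c)
  split-* a b c d = begin
    a ℚ.* b ℚ.- c ℚ.* d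
      ≡⟨ cong (ℚ._- c ℚ.* d) (recover (a ℚ.* b) (a ℚ.* d)) ⟩
    (a ℚ.* d ℚ.+ (a ℚ.* b ℚ.- a ℚ.* d)) ℚ.- c ℚ.* d
      ≡⟨ cong (ℚ._- c ℚ.* d) (ℚ.+-comm (a ℚ.* d) _) ⟩
    ((a ℚ.* b ℚ.- a ℚ.* d) ℚ.+ a ℚ.* d) ℚ.- c ℚ.* d
      ≡⟨ ℚ.+-assoc (a ℚ.* b ℚ.- a ℚ.* d) (a ℚ.* d) _ ⟩
    (a ℚ.* b ℚ.- a ℚ.* d) ℚ.+ (a ℚ.* d ℚ.- c ℚ.* d)
      ≡⟨ cong₂ (λ u v → (a ℚ.* b ℚ.- a ℚ.* d) ℚ.+ (u ℚ.- v)) (ℚ.*-comm a d) (ℚ.*-comm c d) ⟩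
    (a ℚ.* b ℚ.- a ℚ.* d) ℚ.+ (d ℚ.* a ℚ.- d ℚ.* c)
      ≡⟨ cong₂ ℚ._+_ (*-distribˡ-- a b d) (*-distribˡ-- d a c) ⟨
    a ℚ.* (b ℚ.- d) ℚ.+ d ℚ.* (a ℚ.- c) ∎
    where open ≡-Reasoning

  -- For 0 < B, a δ > 0 with B δ ≡ ε.
  quotient : ∀ ε B → 0ℚ ℚ.< ε → 0ℚ ℚ.< B → ∃ λ δ → 0ℚ ℚ.< δ × B ℚ.* δ ≡ ε
  quotient ε B 0<ε 0<B = δ , 0<δ , B*δ≡ε
    where
    instance
      posB : ℚ.Positive B
      posB = ℚ.positive 0<B
      posε : ℚ.Positive ε
      posε = ℚ.positive 0<ε
      nzB : ℚ.NonZero B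
      nzB = ℚ.pos⇒nonZero B
      pos1/B : ℚ.Positive (1/ B)
      pos1/B = ℚ.1/pos⇒pos B
    δ : ℚ
    δ = 1/ B ℚ.* ε
    0<δ : 0ℚ ℚ.< δ
    0<δ = ℚ.positive⁻¹ δ {{ℚ.pos*pos⇒pos (1/ B) ε}}
    B*δ≡ε : B ℚ.* δ ≡ ε
    B*δ≡ε = trans (sym (ℚ.*-assoc B (1/ B) ε))
                  (trans (cong (ℚ._* ε) (ℚ.*-inverseʳ B)) (ℚ.*-identityˡ ε))

  0<1 : 0ℚ ℚ.< 1ℚ
  0<1 = ℚ.positive⁻¹ 1ℚ

  bounded : ∀ x → IsCauchy x → ∃ λ B → 0ℚ ℚ.< B × EventuallyAlways λ n → ℚ.∣ x n ∣ ℚ.≤ B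
  bounded x cx = let (N , h) = cx 1ℚ 0<1 in
    ℚ.∣ x N ∣ ℚ.+ 1ℚ ,
    ℚ.+-mono-≤-< (ℚ.0≤∣p∣ (x N)) 0<1 ,
    N , λ n N≤n → begin
      ℚ.∣ x n ∣
        ≡⟨ cong ℚ.∣_∣ (recover (x n) (x N)) ⟩
      ℚ.∣ x N ℚ.+ (x n ℚ.- x N) ∣
        ≤⟨ ℚ.∣p+q∣≤∣p∣+∣q∣ (x N) _ ⟩
      ℚ.∣ x N ∣ ℚ.+ ℚ.∣ x n ℚ.- x N ∣
        ≤⟨ ℚ.+-monoʳ-≤ ℚ.∣ x N ∣ (ℚ.<⇒≤ (h n N N≤n ℕ.≤-refl)) ⟩
      ℚ.∣ x N ∣ ℚ.+ 1ℚ ∎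
    where open ℚ.≤-Reasoning

  const-isCauchy : ∀ q → IsCauchy (λ _ → q)
  const-isCauchy q ε 0<ε = 0 , λ _ _ _ _ →
    subst (ℚ._< ε) (sym (cong ℚ.∣_∣ (ℚ.+-inverseʳ q))) 0<ε

  +-isCauchy : ∀ x y → IsCauchy x → IsCauchy y → IsCauchy (λ n → x n ℚ.+ y n)
  +-isCauchy x y cx cy ε 0<ε =
    let (δ , 0<δ , 2δ≡ε) = quotient ε (1ℚ ℚ.+ 1ℚ) 0<ε (ℚ.positive⁻¹ (1ℚ ℚ.+ 1ℚ))
        (M , hx) = cx δ 0<δ
        (N , hy) = cy δ 0<δ
    in M ⊔ N , λ m n ≤m ≤n → begin-strict
      ℚ.∣ (x m ℚ.+ y m) ℚ.- (x n ℚ.+ y n) ∣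
        ≡⟨ cong ℚ.∣_∣ (split (x m) (y m) (x n) (y n)) ⟩
      ℚ.∣ (x m ℚ.- x n) ℚ.+ (y m ℚ.- y n) ∣
        ≤⟨ ℚ.∣p+q∣≤∣p∣+∣q∣ (x m ℚ.- x n) _ ⟩
      ℚ.∣ x m ℚ.- x n ∣ ℚ.+ ℚ.∣ y m ℚ.- y n ∣
        <⟨ ℚ.+-mono-< (hx m n (ℕ.m⊔n≤o⇒m≤o M N ≤m) (ℕ.m⊔n≤o⇒m≤o M N ≤n))
                      (hy m n (ℕ.m⊔n≤o⇒n≤o M N ≤m) (ℕ.m⊔n≤o⇒n≤o M N ≤n)) ⟩
      δ ℚ.+ δ
        ≡⟨ cong₂ ℚ._+_ (ℚ.*-identityˡ δ) (ℚ.*-identityˡ δ) ⟨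
      1ℚ ℚ.* δ ℚ.+ 1ℚ ℚ.* δ
        ≡⟨ ℚ.*-distribʳ-+ δ 1ℚ 1ℚ ⟨
      (1ℚ ℚ.+ 1ℚ) ℚ.* δ
        ≡⟨ 2δ≡ε ⟩
      ε ∎
    where open ℚ.≤-Reasoning

  neg-isCauchy : ∀ x → IsCauchy x → IsCauchy (λ n → ℚ.- x n)
  neg-isCauchy x cx ε 0<ε =
    let (N , h) = cx ε 0<ε in
    N , λ m n ≤m ≤n → subst (ℚ._< ε)
      (sym (trans (cong ℚ.∣_∣ (split-neg (x m) (x n)))
                  (ℚ.∣-p∣≡∣p∣ (x m ℚ.- x n))))
      (h m n ≤m ≤n)

  *-isCauchy : ∀ x y → IsCauchy x → IsCauchy y → IsCauchy (λ n → x n ℚ.* y n)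
  *-isCauchy x y cx cy ε 0<ε =
    let (B , 0<B , M₁ , hB) = bounded x cx
        (C , 0<C , M₂ , hC) = bounded y cy
        0<B+C = ℚ.+-mono-< 0<B 0<C
        (δ , 0<δ , [B+C]δ≡ε) = quotient ε (B ℚ.+ C) 0<ε 0<B+C
        (N₁ , hx) = cx δ 0<δ
        (N₂ , hy) = cy δ 0<δ
        M = M₁ ⊔ M₂
        N = N₁ ⊔ N₂
    in M ⊔ N , λ m n ≤m ≤n →
      let M≤m  = ℕ.m⊔n≤o⇒m≤o M N ≤m
          N≤m  = ℕ.m⊔n≤o⇒n≤o M N ≤m
          M≤n  = ℕ.m⊔n≤o⇒m≤o M N ≤n
          N≤n  = ℕ.m⊔n≤o⇒n≤o M N ≤n
          dx   = x m ℚ.- x n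
          dy   = y m ℚ.- y n
          dx<δ = hx m n (ℕ.m⊔n≤o⇒m≤o N₁ N₂ N≤m) (ℕ.m⊔n≤o⇒m≤o N₁ N₂ N≤n)
          dy<δ = hy m n (ℕ.m⊔n≤o⇒n≤o N₁ N₂ N≤m) (ℕ.m⊔n≤o⇒n≤o N₁ N₂ N≤n)
      in begin-strict
      ℚ.∣ x m ℚ.* y m ℚ.- x n ℚ.* y n ∣
        ≡⟨ cong ℚ.∣_∣ (split-* (x m) (y m) (x n) (y n)) ⟩
      ℚ.∣ x m ℚ.* dy ℚ.+ y n ℚ.* dx ∣
        ≤⟨ ℚ.∣p+q∣≤∣p∣+∣q∣ (x m ℚ.* dy) _ ⟩
      ℚ.∣ x m ℚ.* dy ∣ ℚ.+ ℚ.∣ y n ℚ.* dx ∣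
        <⟨ ℚ.+-mono-< (product (x m) dy 0<B (hB m (ℕ.m⊔n≤o⇒m≤o M₁ M₂ M≤m)) dy<δ)
                      (product (y n) dx 0<C (hC n (ℕ.m⊔n≤o⇒n≤o M₁ M₂ M≤n)) dx<δ) ⟩
      B ℚ.* δ ℚ.+ C ℚ.* δ
        ≡⟨ ℚ.*-distribʳ-+ δ B C ⟨
      (B ℚ.+ C) ℚ.* δ
        ≡⟨ [B+C]δ≡ε ⟩
      ε ∎
    where
    open ℚ.≤-Reasoning
    product : ∀ p q {B δ} → 0ℚ ℚ.< B → ℚ.∣ p ∣ ℚ.≤ B → ℚ.∣ q ∣ ℚ.< δ → ℚ.∣ p ℚ.* q ∣ ℚ.< B ℚ.* δ
    product p q {B} {δ} 0<B p≤B q<δ = begin-strict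
      ℚ.∣ p ℚ.* q ∣           ≡⟨ ℚ.∣p*q∣≡∣p∣*∣q∣ p q ⟩
      ℚ.∣ p ∣ ℚ.* ℚ.∣ q ∣     ≤⟨ ℚ.*-monoʳ-≤-nonNeg ℚ.∣ q ∣ {{ℚ.∣-∣-nonNeg q}} p≤B ⟩
      B ℚ.* ℚ.∣ q ∣           <⟨ ℚ.*-monoʳ-<-pos B {{ℚ.positive 0<B}} q<δ ⟩
      B ℚ.* δ                 ∎

record ℝ : Set where
  constructor mkℝ
  field
    seq    : ℕ → ℚ
    cauchy : IsCauchy seq
open ℝ public

infix 4 _≈ᴿ_ _#ᴿ_

_≈ᴿ_ : Rel ℝ 0ℓ
x ≈ᴿ y = ∀ ε → 0ℚ ℚ.< ε → EventuallyAlways λ n → ℚ.∣ seq x n ℚ.- seq y n ∣ ℚ.< ε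

-- Apartness, the positive form of ¬ (x ≈ᴿ y); classically the two agree.
_#ᴿ_ : Rel ℝ 0ℓ
x #ᴿ y = ∃ λ ε → 0ℚ ℚ.< ε × EventuallyAlways λ n → ε ℚ.≤ ℚ.∣ seq x n ℚ.- seq y n ∣

fromℚ : ℚ → ℝ
fromℚ q = mkℝ (λ _ → q) (const-isCauchy q)

infixl 6 _+ᴿ_
infixl 7 _*ᴿ_
infix  8 -ᴿ_

_+ᴿ_ : ℝ → ℝ → ℝ
mkℝ x cx +ᴿ mkℝ y cy = mkℝ (λ n → x n ℚ.+ y n) (+-isCauchy x y cx cy)

-ᴿ_ : ℝ → ℝ
-ᴿ mkℝ x cx = mkℝ (λ n → ℚ.- x n) (neg-isCauchy x cx)

_*ᴿ_ : ℝ → ℝ → ℝ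
mkℝ x cx *ᴿ mkℝ y cy = mkℝ (λ n → x n ℚ.* y n) (*-isCauchy x y cx cy)

------------------------------------------------------------------------
-- Complex numbers

record ℂ : Set where
  constructor _+i_
  field
    re im : ℝ
open ℂ public

infix 4 _≈ᶜ_ _#ᶜ_

_≈ᶜ_ : Rel ℂ 0ℓ
z ≈ᶜ w = (re z ≈ᴿ re w) × (im z ≈ᴿ im w)

_#ᶜ_ : Rel ℂ 0ℓ
z #ᶜ w = (re z #ᴿ re w) ⊎ (im z #ᴿ im w)

infixl 6 _+ᶜ_
infixl 7 _*ᶜ_
infix  8 -ᶜ_

_+ᶜ_ : ℂ → ℂ → ℂ
(a +i b) +ᶜ (c +i d) = (a +ᴿ c) +i (b +ᴿ d)

-ᶜ_ : ℂ → ℂ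
-ᶜ (a +i b) = (-ᴿ a) +i (-ᴿ b)

_*ᶜ_ : ℂ → ℂ → ℂ
(a +i b) *ᶜ (c +i d) = ((a *ᴿ c) +ᴿ (-ᴿ (b *ᴿ d))) +i ((a *ᴿ d) +ᴿ (b *ᴿ c))

fromℕ : ℕ → ℂ
fromℕ k = fromℚ (+ k ℚ./ 1) +i fromℚ 0ℚ

0ᶜ 1ᶜ : ℂ
0ᶜ = fromℕ 0
1ᶜ = fromℕ 1

------------------------------------------------------------------------
-- Polynomials over ℂ in x₀, …, xₙ₋₁

Monomial : ℕ → Set
Monomial n = Vec ℕ n

∣_∣ᵐ : ∀ {n} → Monomial n → ℕ
∣ m ∣ᵐ = Vec.sum m

-- A finite formal sum of terms c·xᵐ. Monomials may repeat and coefficients may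
-- vanish, so only coeff is meaningful, never the list itself.
Poly : ℕ → Set
Poly n = List (ℂ × Monomial n)

coeff : ∀ {n} → Poly n → Monomial n → ℂ
coeff []            m = 0ᶜ
coeff ((c , m′) ∷ p) m with Vec.≡-dec ℕ._≟_ m′ m
... | yes _ = c +ᶜ coeff p m
... | no  _ = coeff p m

infix 4 _≈ᴾ_

_≈ᴾ_ : ∀ {n} → Rel (Poly n) 0ℓ
p ≈ᴾ q = ∀ m → coeff p m ≈ᶜ coeff q m

infixl 6 _+ᴾ_ _-ᴾ_
infixl 7 _*ᴾ_
infixr 8 _^ᴾ_

const : ∀ {n} → ℂ → Poly n
const c = (c , Vec.replicate _ 0) ∷ []

1ᴾ : ∀ {n} → Poly n
1ᴾ = const 1ᶜ

var : ∀ {n} → Fin n → Poly n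
var i = (1ᶜ , Vec.replicate _ 0 Vec.[ i ]≔ 1) ∷ []

_+ᴾ_ : ∀ {n} → Poly n → Poly n → Poly n
p +ᴾ q = p ++ q

_-ᴾ_ : ∀ {n} → Poly n → Poly n → Poly n
p -ᴾ q = p ++ map (λ (c , m) → -ᶜ c , m) q

_*ᴾ_ : ∀ {n} → Poly n → Poly n → Poly n
p *ᴾ q = concatMap (λ (c , m) → map (λ (d , m′) → c *ᶜ d , Vec.zipWith ℕ._+_ m m′) q) p

_^ᴾ_ : ∀ {n} → Poly n → ℕ → Poly n
p ^ᴾ zero  = 1ᴾ
p ^ᴾ suc k = p *ᴾ p ^ᴾ k

sumᴾ : ∀ {n s} → (Fin s → Poly n) → Poly n
sumᴾ = Vector.foldr _+ᴾ_ []

------------------------------------------------------------------------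
-- Nullstellensatz certificates for the infeasibility of fs = 0

record Certificate {n} (fs : List (Poly n)) : Set where
  field
    coefficient : Fin (length fs) → Poly n
    identity    : 1ᴾ ≈ᴾ sumᴾ (λ i → coefficient i *ᴾ lookup fs i)
open Certificate public

module _ {n} {fs : List (Poly n)} where

  Occurs : Certificate fs → Fin (length fs) × Monomial n → Set
  Occurs c (i , m) = coeff (coefficient c i) m #ᶜ 0ᶜ

  DegreeAtMost : Certificate fs → ℕ → Set
  DegreeAtMost c d = ∀ i m → d ℕ.< ∣ m ∣ᵐ → coeff (coefficient c i) m ≈ᶜ 0ᶜ

  DegreeAtLeast : Certificate fs → ℕ → Set
  DegreeAtLeast c d = ∃ λ t → Occurs c t × d ℕ.≤ ∣ proj₂ t ∣ᵐ

  HasDegree : Certificate fs → ℕ → Set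
  HasDegree c d = DegreeAtMost c d × DegreeAtLeast c d

  IsMinimumDegree : Certificate fs → Set
  IsMinimumDegree c = ∃ λ d → HasDegree c d × (∀ c′ → DegreeAtLeast c′ d)

  -- The coefficient polynomials have in total at least k monomials; a monomial
  -- occurring in several of them counts once for each.
  AtLeastTerms : Certificate fs → ℕ → Set
  AtLeastTerms c k = ∃ λ ts → Unique ts × All (Occurs c) ts × k ℕ.≤ length ts

------------------------------------------------------------------------
-- Graphs

record Graph (n : ℕ) : Set₁ where
  infix 4 _~_ _~?_
  field
    _~_      : Rel (Fin n) 0ℓ
    ~-sym    : Symmetric _~_
    ~-irrefl : Irreflexive _≡_ _~_
    _~?_     : Decidable _~_

module _ {n} (G : Graph n) where
  open Graph G

  -- Each edge {i, j} is listed once, as the pair with i < j.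
  edges : List (Fin n × Fin n)
  edges = filter (λ (i , j) → (i Fin.<? j) ×-dec (i ~? j))
                 (cartesianProduct (allFin n) (allFin n))

  Stable : Subset n → Set
  Stable S = ∀ i j → i ∈ S → j ∈ S → ¬ (i ~ j)

  stable? : ∀ S → Dec (Stable S)
  stable? S = Fin.all? λ i → Fin.all? λ j →
    (i ∈? S) →-dec ((j ∈? S) →-dec ¬? (i ~? j))

  Colorable : ℕ → Set
  Colorable k = ∃ λ (f : Fin n → Fin k) → ∀ i j → i ~ j → f i ≢ f j

subsets : ∀ n → List (Subset n)
subsets zero    = [] ∷ []
subsets (suc n) = map (outside ∷_) (subsets n) ++ map (inside ∷_) (subsets n)

stableSets : ∀ {n} → Graph n → List (Subset n)
stableSets G = filter (stable? G) (subsets _)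

α : ∀ {n} → Graph n → ℕ
α G = foldr _⊔_ 0 (map ∣_∣ (stableSets G))

_ContainsSubgraph_ : ∀ {n k} → Graph n → Graph k → Set
G ContainsSubgraph H = ∃ λ f → Injective _≡_ _≡_ f × (∀ {i j} → i H.~ j → f i G.~ f j)
  where
  module G = Graph G
  module H = Graph H

complete : ∀ k → Graph k
complete k = record
  { _~_      = _≢_
  ; ~-sym    = ≢-sym
  ; ~-irrefl = λ i≡j i≢j → i≢j i≡j
  ; _~?_     = λ i j → ¬? (i Fin.≟ j)
  }

module _ (ℓ : ℕ) where

  Next : Rel (Fin ℓ) 0ℓ
  Next i j = (toℕ j ≡ suc (toℕ i)) ⊎ (suc (toℕ i) ≡ ℓ × toℕ j ≡ 0)

  next? : Decidable Next
  next? i j = (toℕ j ℕ.≟ suc (toℕ i)) ⊎-dec ((suc (toℕ i) ℕ.≟ ℓ) ×-dec (toℕ j ℕ.≟ 0))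

-- The vertex zero is the center; the vertices suc i are the rim, a cycle of
-- length 3 + 2k.
data OddWheelAdj (k : ℕ) : Rel (Fin (suc (3 ℕ.+ 2 ℕ.* k))) 0ℓ where
  spokeˡ : ∀ i → OddWheelAdj k Fin.zero (Fin.suc i)
  spokeʳ : ∀ i → OddWheelAdj k (Fin.suc i) Fin.zero
  rim    : ∀ {i j} → Next _ i j ⊎ Next _ j i → OddWheelAdj k (Fin.suc i) (Fin.suc j)

oddWheel : ∀ k → Graph (suc (3 ℕ.+ 2 ℕ.* k))
oddWheel k = record
  { _~_      = OddWheelAdj k
  ; ~-sym    = symmetric
  ; ~-irrefl = λ where refl (rim a) → Sum.[ next-irrefl , next-irrefl ] a
  ; _~?_     = dec
  }
  where
  next-irrefl : ∀ {i} → ¬ Next (3 ℕ.+ 2 ℕ.* k) i i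
  next-irrefl (inj₁ i≡1+i)         = ℕ.1+n≢n (sym i≡1+i)
  next-irrefl (inj₂ (1+i≡ℓ , i≡0)) with trans (cong suc (sym i≡0)) 1+i≡ℓ
  ... | ()

  symmetric : Symmetric (OddWheelAdj k)
  symmetric (spokeˡ i) = spokeʳ i
  symmetric (spokeʳ i) = spokeˡ i
  symmetric (rim a)    = rim (Sum.swap a)

  dec : Decidable (OddWheelAdj k)
  dec Fin.zero    Fin.zero    = no λ ()
  dec Fin.zero    (Fin.suc j) = yes (spokeˡ j)
  dec (Fin.suc i) Fin.zero    = yes (spokeʳ i)
  dec (Fin.suc i) (Fin.suc j) with next? _ i j ⊎-dec next? _ j i
  ... | yes a = yes (rim a)
  ... | no ¬a = no λ where (rim a) → ¬a a

------------------------------------------------------------------------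
-- Polynomial systems of a graph

-- Has a common zero iff G has a stable set of size k.
stableSetSystem : ∀ {n} → Graph n → ℕ → List (Poly n)
stableSetSystem {n} G k =
  (sumᴾ var -ᴾ const (fromℕ k))
  ∷ map (λ i → var i ^ᴾ 2 -ᴾ var i) (allFin n)
  ++ map (λ (i , j) → var i *ᴾ var j) (edges G)

-- Has a common zero iff G is 3-colorable.
coloringSystem : ∀ {n} → Graph n → List (Poly n)
coloringSystem {n} G =
  map (λ i → var i ^ᴾ 3 -ᴾ 1ᴾ) (allFin n)
  ++ map (λ (i , j) → var i ^ᴾ 2 +ᴾ var i *ᴾ var j +ᴾ var j ^ᴾ 2) (edges G)

{-# OPTIONS --safe #-}
-- Lower bounds come from dual functionals. Applying a linear functional L with L 1 ≠ 0
-- to a certificate 1 = Σ pᵢ fᵢ shows that some coefficient polynomial pᵢ contains a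
-- monomial xᵐ with L (xᵐ fᵢ) ≠ 0; working with apartness, the monomial is found.
--
-- For stable sets: modulo the xᵢ² - xᵢ and the edge monomials, the ring has basis x^S for
-- S stable. For every stable S there is an L that kills xᵐ (xᵢ² - xᵢ) and xᵐ xᵢ xⱼ, and
-- kills xᵐ (Σ xᵢ - N) unless supp m = S. Hence A has a monomial with support S for every
-- stable S. Conversely 1 is obtained by downward induction on |S|: modulo the system,
-- (N - |S|) x^S is the sum of the x^(S ∪ {i}) with S ∪ {i} stable.
--
-- For colourings: reducing exponents mod 3 and sending xᵢ³, xᵢ² xⱼ, xᵢ xⱼ xₖ to 1, -½, 1
-- gives an L that kills the multiples of xᵢ³ - 1 and the products of an edge polynomial
-- with a monomial of degree at most 3. For the upper bound, triangles cus and cut force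
-- 3 c y (s - t) into the degree 4 part of the ideal for every variable y; going around an
-- odd rim this identifies two adjacent rim vertices, and from this 9 c³ is derived.

module Submission where

import Algebra.Properties.CommutativeSemigroup
import Algebra.Properties.Ring
import Algebra.Properties.Semiring.Sum
import Algebra.Solver.Ring
import Algebra.Solver.Ring.NaturalCoefficients.Default
open import Algebra.Bundles using (CommutativeRing)
open import Algebra.Solver.Ring.AlmostCommutativeRing
  using (fromCommutativeRing; _-Raw-AlmostCommutative⟶_)
open import Data.Bool.Base using (Bool; true; false)
import Data.Bool.Properties as Bool
open import Data.Fin.Base as Fin using (Fin; toℕ; fromℕ<)
open import Data.Fin.Patterns using (0F; 1F; 2F; 3F)
import Data.Fin.Properties as Fin
open import Data.Fin.Subset as Subset using (Subset; ∣_∣; inside; outside)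
open import Data.Integer.Base as ℤ using (+_)
import Data.Integer.Properties as ℤ
open import Data.List.Base as List
  using (List; []; _∷_; _++_; map; concatMap; foldr; length; allFin; cartesianProduct; deduplicate)
open import Data.List.Membership.Propositional using (_∈_)
open import Data.List.Membership.Propositional.Properties
import Data.List.Properties as List
open import Data.List.Relation.Unary.All as All using (All; []; _∷_)
import Data.List.Relation.Unary.All.Properties as All
import Data.List.Relation.Unary.AllPairs as AllPairs
import Data.List.Relation.Unary.AllPairs.Properties as AllPairs
open import Data.List.Relation.Unary.Any as Any using (here; there)
import Data.List.Relation.Unary.Any.Properties as Any
open import Data.List.Relation.Unary.Unique.DecPropositional.Properties using (deduplicate-!)
open import Data.List.Relation.Unary.Unique.Propositional using (Unique; []; _∷_)
import Data.List.Relation.Unary.Unique.Propositional.Properties as Unique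
import Data.Maybe.Base as Maybe
open import Data.Nat.Base as ℕ using (ℕ; zero; suc; z≤n; s≤s)
import Data.Nat.Properties as ℕ
import Data.Nat.Solver as ℕ
open import Data.Product.Base using (∃; ∃₂; _×_; _,_; proj₁; proj₂)
open import Data.Rational.Base as ℚ using (ℚ; 0ℚ; 1ℚ; ½; 1/_)
import Data.Rational.Properties as ℚ
import Data.Rational.Solver as ℚ
import Data.Rational.Unnormalised.Base as ℚᵘ
import Data.Rational.Unnormalised.Properties as ℚᵘ
open import Data.Sum.Base as Sum using (_⊎_; inj₁; inj₂; [_,_]′)
open import Data.Vec.Base as Vec using (Vec; []; _∷_; lookup; _[_]≔_; replicate)
import Data.Vec.Functional as Vector
import Data.Vec.Properties as Vec
open import Function.Base using (_∘_; _$_; id)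
import Level
open import Level using (0ℓ)
open import Relation.Binary.Definitions using (DecidableEquality; Tri; tri<; tri≈; tri>)
open import Relation.Binary.PropositionalEquality as ≡ using (_≡_; _≢_; cong; cong₂)
import Relation.Binary.Reasoning.Setoid as ≈-Reasoning
open import Relation.Binary.Structures using (IsEquivalence)
open import Relation.Nullary.Decidable
  using (yes; no; from-yes; decidable-stable; dec⇒maybe; _×-dec_; _→-dec_)
open import Relation.Nullary.Negation using (¬_; contradiction)
open import Defs using (Monomial; ∣_∣ᵐ; Graph; Stable; stable?; _ContainsSubgraph_; complete; oddWheel; spokeˡ; rim)

-- Equality of Cauchy reals is undecidable, so a polynomial cannot be stripped of its zero terms and
-- a least degree cannot be found by search. A lower bound has to exhibit a coefficient apart from
-- 0, an upper bound has to limit the monomials written down in an explicit certificate, and a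
-- minimum-degree certificate is obtained because the two bounds meet. The algebra is done over any
-- commutative ring receiving a homomorphism from ℚ, so that numerical checks take place in ℚ.
--
-- For colourings the values in degree 3 are forced: with cubes at 1, xᵢ times an edge polynomial
-- gives 1 + L(xᵢ² xⱼ) + L(xᵢ xⱼ²), so a symmetric L has -½ there, and xₖ times an edge polynomial
-- then forces L(xᵢ xⱼ xₖ) = 1. L vanishes in degrees not divisible by 3, so after degree 1 the
-- multipliers of degree 4 are the next with anything left to cancel.
--
-- For stable sets L sees a monomial with support inside S only through the number of missing
-- elements. Asking that Σ xᵢ - N be turned into the indicator of support S is then a one-step
-- recurrence, solvable because N > |S|.

infixl 7 _⊕_

-- Exponent vectors

_⊕_ : ∀ {n} → Monomial n → Monomial n → Monomial n
_⊕_ = Vec.zipWith ℕ._+_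

⊕-comm : ∀ {n} (u v : Monomial n) → u ⊕ v ≡ v ⊕ u
⊕-comm = Vec.zipWith-comm ℕ.+-comm

⊕-assoc : ∀ {n} (u v w : Monomial n) → (u ⊕ v) ⊕ w ≡ u ⊕ (v ⊕ w)
⊕-assoc = Vec.zipWith-assoc ℕ.+-assoc

⊕-identityˡ : ∀ {n} (m : Monomial n) → Vec.replicate n 0 ⊕ m ≡ m
⊕-identityˡ = Vec.zipWith-identityˡ ℕ.+-identityˡ

⊕-identityʳ : ∀ {n} (m : Monomial n) → m ⊕ Vec.replicate n 0 ≡ m
⊕-identityʳ = Vec.zipWith-identityʳ ℕ.+-identityʳ

e : ∀ {n} → Fin n → Monomial n
e i = replicate _ 0 [ i ]≔ 1

lookup-⊕ : ∀ {n} k (u v : Monomial n) → lookup (u ⊕ v) k ≡ lookup u k ℕ.+ lookup v k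
lookup-⊕ = Vec.lookup-zipWith ℕ._+_

lookup-e-≡ : ∀ {n} (i : Fin n) → lookup (e i) i ≡ 1
lookup-e-≡ i = Vec.lookup∘update i (replicate _ 0) 1

lookup-e-≢ : ∀ {n} {k i : Fin n} → k ≢ i → lookup (e i) k ≡ 0
lookup-e-≢ {k = k} k≢i = ≡.trans (Vec.lookup∘update′ k≢i (replicate _ 0) 1) (Vec.lookup-replicate k 0)

lookup-injective : ∀ {A : Set} {n} {u v : Vec A n} → (∀ k → lookup u k ≡ lookup v k) → u ≡ v
lookup-injective {u = u} {v} eq =
  ≡.trans (≡.sym (Vec.tabulate∘lookup u)) (≡.trans (Vec.tabulate-cong eq) (Vec.tabulate∘lookup v))

-- With `κ` this gives the residue code of a monomial, with `id` its degree; the same splitting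
-- lemmas serve both.
σ : (ℕ → ℕ) → ∀ {n} → Monomial n → ℕ
σ f []      = 0
σ f (a ∷ m) = f a ℕ.+ σ f m

σ-id : ∀ {n} (m : Monomial n) → σ id m ≡ ∣ m ∣ᵐ
σ-id []      = ≡.refl
σ-id (a ∷ m) = cong (a ℕ.+_) (σ-id m)

σ-split : ∀ f → f 0 ≡ 0 → ∀ {n} (m : Monomial n) i → σ f m ≡ f (lookup m i) ℕ.+ σ f (m [ i ]≔ 0)
σ-split f f0≡0 (a ∷ m) Fin.zero    = cong (λ z → f a ℕ.+ (z ℕ.+ σ f m)) (≡.sym f0≡0)
σ-split f f0≡0 (a ∷ m) (Fin.suc i) =
  ≡.trans (cong (f a ℕ.+_) (σ-split f f0≡0 m i))
          (solve 3 (λ x y z → x :+ (y :+ z) := y :+ (x :+ z)) ≡.refl (f a) (f (lookup m i)) _)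
  where open ℕ.+-*-Solver

clear : ∀ {n} → Fin n → Fin n → Monomial n → Monomial n
clear i j m = m [ i ]≔ 0 [ j ]≔ 0

σ-split₂ : ∀ f → f 0 ≡ 0 → ∀ {n} (m : Monomial n) {i j} → i ≢ j →
  σ f m ≡ f (lookup m i) ℕ.+ (f (lookup m j) ℕ.+ σ f (clear i j m))
σ-split₂ f f0≡0 m {i} {j} i≢j = ≡.trans (σ-split f f0≡0 m i) (cong (f (lookup m i) ℕ.+_)
  (≡.trans (σ-split f f0≡0 (m [ i ]≔ 0) j)
           (cong (λ z → f z ℕ.+ σ f (clear i j m)) (Vec.lookup∘update′ (≡.≢-sym i≢j) m 0))))

clear-cong : ∀ {n} {i j} (u v : Monomial n) → (∀ k → k ≢ i → k ≢ j → lookup u k ≡ lookup v k) →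
  clear i j u ≡ clear i j v
clear-cong {i = i} {j} u v eq = lookup-injective go
  where
  go : ∀ k → lookup (clear i j u) k ≡ lookup (clear i j v) k
  go k with k Fin.≟ j
  ... | yes ≡.refl = ≡.trans (Vec.lookup∘update j (u [ i ]≔ 0) 0) (≡.sym (Vec.lookup∘update j (v [ i ]≔ 0) 0))
  ... | no k≢j with k Fin.≟ i
  ...   | yes ≡.refl = ≡.trans (lookup-cleared u) (≡.sym (lookup-cleared v))
    where
    lookup-cleared : ∀ w → lookup (clear i j w) i ≡ 0
    lookup-cleared w = ≡.trans (Vec.lookup∘update′ k≢j (w [ i ]≔ 0) 0) (Vec.lookup∘update i w 0)
  ...   | no k≢i = ≡.trans (untouched u) (≡.trans (eq k k≢i k≢j) (≡.sym (untouched v)))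
    where
    untouched : ∀ w → lookup (clear i j w) k ≡ lookup w k
    untouched w = ≡.trans (Vec.lookup∘update′ k≢j (w [ i ]≔ 0) 0) (Vec.lookup∘update′ k≢i w 0)

∣⊕∣ : ∀ {n} (u v : Monomial n) → ∣ u ⊕ v ∣ᵐ ≡ ∣ u ∣ᵐ ℕ.+ ∣ v ∣ᵐ
∣⊕∣ []      []      = ≡.refl
∣⊕∣ (a ∷ u) (b ∷ v) = ≡.trans (cong (a ℕ.+ b ℕ.+_) (∣⊕∣ u v))
  (solve 4 (λ a b u v → a :+ b :+ (u :+ v) := a :+ u :+ (b :+ v)) ≡.refl a b ∣ u ∣ᵐ ∣ v ∣ᵐ)
  where open ℕ.+-*-Solver

∣0∣ : ∀ n → ∣ replicate n 0 ∣ᵐ ≡ 0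
∣0∣ zero    = ≡.refl
∣0∣ (suc n) = ∣0∣ n

∣e∣ : ∀ {n} (i : Fin n) → ∣ e i ∣ᵐ ≡ 1
∣e∣ {suc n} Fin.zero    = cong suc (∣0∣ n)
∣e∣         (Fin.suc i) = ∣e∣ i

-- Polynomials over a commutative ring, tested by linear functionals

module Polynomials {a ℓ} (R : CommutativeRing a ℓ) where

  open CommutativeRing R
  open Algebra.Solver.Ring.NaturalCoefficients.Default commutativeSemiring using (solve; _:=_; _:+_; _:*_)
  open Algebra.Properties.Ring ring using (-0#≈0#; -‿distribˡ-*; -‿+-comm)
  open ≈-Reasoning setoid

  Poly : ℕ → Set a
  Poly n = List (Carrier × Monomial n)

  infixl 6 _+ᴾ_ _-ᴾ_
  infixl 7 _*ᴾ_
  infix  8 -ᴾ_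
  infixr 8 _^ᴾ_

  const : ∀ {n} → Carrier → Poly n
  const c = (c , Vec.replicate _ 0) ∷ []

  1ᴾ : ∀ {n} → Poly n
  1ᴾ = const 1#

  monomial : ∀ {n} → Monomial n → Poly n
  monomial m = (1# , m) ∷ []

  var : ∀ {n} → Fin n → Poly n
  var i = monomial (Vec.replicate _ 0 Vec.[ i ]≔ 1)

  _+ᴾ_ : ∀ {n} → Poly n → Poly n → Poly n
  p +ᴾ q = p ++ q

  -ᴾ_ : ∀ {n} → Poly n → Poly n
  -ᴾ_ = map (λ (c , m) → - c , m)

  _-ᴾ_ : ∀ {n} → Poly n → Poly n → Poly n
  p -ᴾ q = p +ᴾ -ᴾ q

  _*ᴾ_ : ∀ {n} → Poly n → Poly n → Poly n
  p *ᴾ q = concatMap (λ (c , m) → map (λ (d , m′) → c * d , m ⊕ m′) q) p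

  _^ᴾ_ : ∀ {n} → Poly n → ℕ → Poly n
  p ^ᴾ zero  = 1ᴾ
  p ^ᴾ suc k = p *ᴾ p ^ᴾ k

  sumᴾ : ∀ {n s} → (Fin s → Poly n) → Poly n
  sumᴾ = Vector.foldr _+ᴾ_ []

  Functional : ℕ → Set a
  Functional n = Monomial n → Carrier

  eval : ∀ {n} → Functional n → Poly n → Carrier
  eval L []            = 0#
  eval L ((c , m) ∷ p) = c * L m + eval L p

  module _ {n : ℕ} where

    eval-cong : ∀ {L K : Functional n} → (∀ m → L m ≈ K m) → ∀ p → eval L p ≈ eval K p
    eval-cong L≈K []            = refl
    eval-cong L≈K ((c , m) ∷ p) = +-cong (*-congˡ (L≈K m)) (eval-cong L≈K p)

    eval-++ : ∀ (L : Functional n) p q → eval L (p ++ q) ≈ eval L p + eval L q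
    eval-++ L []            q = sym (+-identityˡ _)
    eval-++ L ((c , m) ∷ p) q = trans (+-congˡ (eval-++ L p q)) (sym (+-assoc _ _ _))

    eval-neg : ∀ (L : Functional n) p → eval L (-ᴾ p) ≈ - eval L p
    eval-neg L []            = sym -0#≈0#
    eval-neg L ((c , m) ∷ p) = begin
      - c * L m + eval L (-ᴾ p)    ≈⟨ +-cong (sym (-‿distribˡ-* c (L m))) (eval-neg L p) ⟩
      - (c * L m) + - eval L p     ≈⟨ -‿+-comm _ _ ⟩
      - (c * L m + eval L p)       ∎

    eval-shift : ∀ (L : Functional n) c m p →
      eval L (map (λ (d , m′) → c * d , m ⊕ m′) p) ≈ c * eval (λ m′ → L (m ⊕ m′)) p
    eval-shift L c m []             = sym (zeroʳ c)
    eval-shift L c m ((d , m′) ∷ p) = trans (+-congˡ (eval-shift L c m p))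
      (solve 4 (λ c d x y → c :* d :* x :+ c :* y := c :* (d :* x :+ y)) refl c d _ _)

    -- Currying the functional over `⊕` turns a product into nested evaluations, so associativity
    -- and commutativity of the product reduce to those of `⊕` and to `eval-swap`.
    eval-* : ∀ (L : Functional n) p q →
      eval L (p *ᴾ q) ≈ eval (λ m → eval (λ m′ → L (m ⊕ m′)) q) p
    eval-* L []            q = refl
    eval-* L ((c , m) ∷ p) q =
      trans (eval-++ L (map _ q) (p *ᴾ q)) (+-cong (eval-shift L c m q) (eval-* L p q))

    eval-zero : ∀ (p : Poly n) → eval (λ _ → 0#) p ≈ 0#
    eval-zero []            = refl
    eval-zero ((c , m) ∷ p) = trans (+-cong (zeroʳ c) (eval-zero p)) (+-identityˡ 0#)

    eval-+ : ∀ (L K : Functional n) p → eval (λ m → L m + K m) p ≈ eval L p + eval K p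
    eval-+ L K []            = sym (+-identityˡ 0#)
    eval-+ L K ((c , m) ∷ p) = trans (+-congˡ (eval-+ L K p))
      (solve 5 (λ c x y z w → c :* (x :+ y) :+ (z :+ w) := c :* x :+ z :+ (c :* y :+ w)) refl
        c (L m) (K m) _ _)

    eval-scale : ∀ c (L : Functional n) p → eval (λ m → c * L m) p ≈ c * eval L p
    eval-scale c L []            = sym (zeroʳ c)
    eval-scale c L ((d , m) ∷ p) = trans (+-congˡ (eval-scale c L p))
      (solve 4 (λ c d x y → d :* (c :* x) :+ c :* y := c :* (d :* x :+ y)) refl c d _ _)

    eval-swap : ∀ (K : Monomial n → Functional n) p q →
      eval (λ m → eval (K m) q) p ≈ eval (λ m′ → eval (λ m → K m m′) p) q
    eval-swap K []            q = sym (eval-zero q)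
    eval-swap K ((c , m) ∷ p) q = begin
      c * eval (K m) q + eval (λ m → eval (K m) q) p
        ≈⟨ +-cong (sym (eval-scale c (K m) q)) (eval-swap K p q) ⟩
      eval (λ m′ → c * K m m′) q + eval (λ m′ → eval (λ m → K m m′) p) q
        ≈⟨ eval-+ _ _ q ⟨
      eval (λ m′ → c * K m m′ + eval (λ m → K m m′) p) q ∎

  infix 4 _≋_

  -- Testing against all functionals makes the ring laws for unnormalised lists consequences of the
  -- linearity of `eval`. The record keeps `p` and `q` inferable, which a bare equation between
  -- values of `eval` does not.
  record _≋_ {n} (p q : Poly n) : Set (a Level.⊔ ℓ) where
    constructor functionally
    field eval-≈ : ∀ L → eval L p ≈ eval L q
  open _≋_ public

  module _ {n : ℕ} where

    ≋-refl : {p : Poly n} → p ≋ p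
    ≋-refl = functionally λ _ → refl

    +ᴾ-cong : ∀ {p q r s : Poly n} → p ≋ q → r ≋ s → (p +ᴾ r) ≋ (q +ᴾ s)
    +ᴾ-cong {p} {q} {r} {s} p≋q r≋s = functionally λ L →
      trans (eval-++ L p r) (trans (+-cong (eval-≈ p≋q L) (eval-≈ r≋s L)) (sym (eval-++ L q s)))

    -ᴾ-cong : ∀ {p q : Poly n} → p ≋ q → (-ᴾ p) ≋ (-ᴾ q)
    -ᴾ-cong {p} {q} p≋q = functionally λ L →
      trans (eval-neg L p) (trans (-‿cong (eval-≈ p≋q L)) (sym (eval-neg L q)))

    *ᴾ-cong : ∀ {p q r s : Poly n} → p ≋ q → r ≋ s → (p *ᴾ r) ≋ (q *ᴾ s)
    *ᴾ-cong {p} {q} {r} {s} p≋q r≋s = functionally λ L → begin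
      eval L (p *ᴾ r)                                ≈⟨ eval-* L p r ⟩
      eval (λ m → eval (λ m′ → L (m ⊕ m′)) r) p      ≈⟨ eval-cong (λ m → eval-≈ r≋s _) p ⟩
      eval (λ m → eval (λ m′ → L (m ⊕ m′)) s) p      ≈⟨ eval-≈ p≋q _ ⟩
      eval (λ m → eval (λ m′ → L (m ⊕ m′)) s) q      ≈⟨ eval-* L q s ⟨
      eval L (q *ᴾ s)                                ∎

    *ᴾ-assoc : ∀ (p q r : Poly n) → ((p *ᴾ q) *ᴾ r) ≋ (p *ᴾ (q *ᴾ r))
    *ᴾ-assoc p q r = functionally λ L → begin
      eval L ((p *ᴾ q) *ᴾ r)
        ≈⟨ eval-* L (p *ᴾ q) r ⟩
      eval (λ w → eval (λ m″ → L (w ⊕ m″)) r) (p *ᴾ q)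
        ≈⟨ eval-* _ p q ⟩
      eval (λ m → eval (λ m′ → eval (λ m″ → L ((m ⊕ m′) ⊕ m″)) r) q) p
        ≈⟨ eval-cong (λ m → eval-cong (λ m′ → eval-cong (λ m″ →
             reflexive (cong L (⊕-assoc m m′ m″))) r) q) p ⟩
      eval (λ m → eval (λ m′ → eval (λ m″ → L (m ⊕ (m′ ⊕ m″))) r) q) p
        ≈⟨ eval-cong (λ m → eval-* (λ w → L (m ⊕ w)) q r) p ⟨
      eval (λ m → eval (λ w → L (m ⊕ w)) (q *ᴾ r)) p
        ≈⟨ eval-* L p (q *ᴾ r) ⟨
      eval L (p *ᴾ (q *ᴾ r)) ∎

    *ᴾ-comm : ∀ (p q : Poly n) → (p *ᴾ q) ≋ (q *ᴾ p)
    *ᴾ-comm p q = functionally λ L → begin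
      eval L (p *ᴾ q)                                ≈⟨ eval-* L p q ⟩
      eval (λ m → eval (λ m′ → L (m ⊕ m′)) q) p      ≈⟨ eval-swap (λ m m′ → L (m ⊕ m′)) p q ⟩
      eval (λ m′ → eval (λ m → L (m ⊕ m′)) p) q
        ≈⟨ eval-cong (λ m′ → eval-cong (λ m → reflexive (cong L (⊕-comm m m′))) p) q ⟩
      eval (λ m′ → eval (λ m → L (m′ ⊕ m)) p) q      ≈⟨ eval-* L q p ⟨
      eval L (q *ᴾ p)                                ∎

    *ᴾ-identityˡ : ∀ (p : Poly n) → (1ᴾ *ᴾ p) ≋ p
    *ᴾ-identityˡ p = functionally λ L → begin
      eval L (1ᴾ *ᴾ p)                                       ≈⟨ eval-* L 1ᴾ p ⟩
      1# * eval (λ m → L (Vec.replicate n 0 ⊕ m)) p + 0#     ≈⟨ +-identityʳ _ ⟩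
      1# * eval (λ m → L (Vec.replicate n 0 ⊕ m)) p          ≈⟨ *-identityˡ _ ⟩
      eval (λ m → L (Vec.replicate n 0 ⊕ m)) p
        ≈⟨ eval-cong (λ m → reflexive (cong L (⊕-identityˡ m))) p ⟩
      eval L p                                               ∎

    *ᴾ-distribʳ : ∀ (p q r : Poly n) → ((q +ᴾ r) *ᴾ p) ≋ (q *ᴾ p +ᴾ r *ᴾ p)
    *ᴾ-distribʳ p q r = functionally λ L → begin
      eval L ((q +ᴾ r) *ᴾ p)                   ≈⟨ eval-* L (q +ᴾ r) p ⟩
      eval _ (q +ᴾ r)                          ≈⟨ eval-++ _ q r ⟩
      eval _ q + eval _ r                      ≈⟨ +-cong (eval-* L q p) (eval-* L r p) ⟨
      eval L (q *ᴾ p) + eval L (r *ᴾ p)        ≈⟨ eval-++ L (q *ᴾ p) (r *ᴾ p) ⟨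
      eval L (q *ᴾ p +ᴾ r *ᴾ p)                ∎

    +ᴾ-comm : ∀ (p q : Poly n) → (p +ᴾ q) ≋ (q +ᴾ p)
    +ᴾ-comm p q = functionally λ L →
      trans (eval-++ L p q) (trans (+-comm _ _) (sym (eval-++ L q p)))

    +ᴾ-inverseʳ : ∀ (p : Poly n) → (p -ᴾ p) ≋ []
    +ᴾ-inverseʳ p = functionally λ L →
      trans (eval-++ L p (-ᴾ p)) (trans (+-congˡ (eval-neg L p)) (-‿inverseʳ _))

    ≋-sym : ∀ {p q : Poly n} → p ≋ q → q ≋ p
    ≋-sym p≋q = functionally λ L → sym (eval-≈ p≋q L)

    ≋-trans : ∀ {p q r : Poly n} → p ≋ q → q ≋ r → p ≋ r
    ≋-trans p≋q q≋r = functionally λ L → trans (eval-≈ p≋q L) (eval-≈ q≋r L)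

  polyRing : ℕ → CommutativeRing a (a Level.⊔ ℓ)
  polyRing n = record
    { Carrier = Poly n
    ; _≈_ = _≋_
    ; _+_ = _+ᴾ_
    ; _*_ = _*ᴾ_
    ; -_  = -ᴾ_
    ; 0#  = []
    ; 1#  = 1ᴾ
    ; isCommutativeRing = record
      { isRing = record
        { +-isAbelianGroup = record
          { isGroup = record
            { isMonoid = record
              { isSemigroup = record
                { isMagma = record
                  { isEquivalence = record { refl = ≋-refl ; sym = ≋-sym ; trans = ≋-trans }
                  ; ∙-cong = +ᴾ-cong
                  }
                ; assoc = λ p q r → functionally λ L → reflexive (cong (eval L) (List.++-assoc p q r))
                }
              ; identity = (λ p → ≋-refl) , (λ p → +ᴾ-comm p [])
              }
            ; inverse = (λ p → ≋-trans (+ᴾ-comm (-ᴾ p) p) (+ᴾ-inverseʳ p)) , +ᴾ-inverseʳ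
            ; ⁻¹-cong = -ᴾ-cong
            }
          ; comm = +ᴾ-comm
          }
        ; *-cong = *ᴾ-cong
        ; *-assoc = *ᴾ-assoc
        ; *-identity = *ᴾ-identityˡ , λ p → ≋-trans (*ᴾ-comm p 1ᴾ) (*ᴾ-identityˡ p)
        ; distrib = (λ p q r → ≋-trans (*ᴾ-comm p (q +ᴾ r))
                      (≋-trans (*ᴾ-distribʳ p q r) (+ᴾ-cong (*ᴾ-comm q p) (*ᴾ-comm r p))))
                  , *ᴾ-distribʳ
        }
      ; *-comm = *ᴾ-comm
      }
    }

  module _ {n : ℕ} where

    const-cong : ∀ {c d} → c ≈ d → const {n} c ≋ const d
    const-cong c≈d = functionally λ L → +-congʳ (*-congʳ c≈d)

    const-+ : ∀ c d → const {n} (c + d) ≋ const c +ᴾ const d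
    const-+ c d = functionally λ L → trans (+-congʳ (distribʳ _ c d)) (+-assoc _ _ _)

    const-* : ∀ c d → const {n} (c * d) ≋ const c *ᴾ const d
    const-* c d = functionally λ L →
      +-congʳ (*-congˡ (reflexive (cong L (≡.sym (⊕-identityˡ (Vec.replicate n 0))))))

    const-0 : const {n} 0# ≋ []
    const-0 = functionally λ L → trans (+-identityʳ _) (zeroˡ _)

    -- Gives the ring solver rational constants inside the polynomial ring, with a decidable
    -- equality of coefficients even if that of R is not decidable.
    constᵠ : ℚ.+-*-rawRing -Raw-AlmostCommutative⟶ fromCommutativeRing R →
             ℚ.+-*-rawRing -Raw-AlmostCommutative⟶ fromCommutativeRing (polyRing n)
    constᵠ φ = record
      { ⟦_⟧    = const ∘ ⟦_⟧
      ; +-homo = λ p q → ≋-trans (const-cong (+-homo p q)) (const-+ ⟦ p ⟧ ⟦ q ⟧)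
      ; *-homo = λ p q → ≋-trans (const-cong (*-homo p q)) (const-* ⟦ p ⟧ ⟦ q ⟧)
      ; -‿homo = λ p → const-cong (-‿homo p)
      ; 0-homo = ≋-trans (const-cong 0-homo) const-0
      ; 1-homo = const-cong 1-homo
      }
      where open _-Raw-AlmostCommutative⟶_ φ

  module _ {n : ℕ} where

    eval-monomial : ∀ (L : Functional n) m → eval L (monomial m) ≈ L m
    eval-monomial L m = trans (+-identityʳ _) (*-identityˡ _)

    monomial-* : ∀ (u v : Monomial n) → monomial u *ᴾ monomial v ≋ monomial (u ⊕ v)
    monomial-* u v = functionally λ L → +-congʳ (*-congʳ (*-identityˡ 1#))

    monomial-*-* : ∀ (u v w : Monomial n) →
      monomial u *ᴾ (monomial v *ᴾ monomial w) ≋ monomial (u ⊕ (v ⊕ w))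
    monomial-*-* u v w =
      ≋-trans (*ᴾ-cong (≋-refl {p = monomial u}) (monomial-* v w)) (monomial-* u (v ⊕ w))

-- Coefficients, and the choice of an occurring monomial

module Coefficients {a ℓ} (R : CommutativeRing a ℓ) where

  open Polynomials R
  open CommutativeRing R
  open Algebra.Properties.CommutativeSemigroup +-commutativeSemigroup using (x∙yz≈y∙xz)
  open ≈-Reasoning setoid

  _≟ᵐ_ : ∀ {n} → DecidableEquality (Monomial n)
  _≟ᵐ_ = Vec.≡-dec ℕ._≟_

  coeff : ∀ {n} → Poly n → Functional n
  coeff []            m = 0#
  coeff ((c , m′) ∷ p) m with m′ ≟ᵐ m
  ... | yes _ = c + coeff p m
  ... | no  _ = coeff p m

  module _ {n : ℕ} where

    coeff-≡ : ∀ c m (p : Poly n) → coeff ((c , m) ∷ p) m ≡ c + coeff p m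
    coeff-≡ c m p with m ≟ᵐ m
    ... | yes _  = ≡.refl
    ... | no m≢m = contradiction ≡.refl m≢m

    coeff-≢ : ∀ c {m m′} (p : Poly n) → m ≢ m′ → coeff ((c , m) ∷ p) m′ ≡ coeff p m′
    coeff-≢ c {m} {m′} p m≢m′ with m ≟ᵐ m′
    ... | yes m≡m′ = contradiction m≡m′ m≢m′
    ... | no _     = ≡.refl

    -- Like terms are merged along a given list and zeros are kept, since vanishing in R cannot be
    -- tested.
    collect : List (Monomial n) → Poly n → Poly n
    collect ms p = map (λ m → coeff p m , m) ms

    eval-collect-[] : ∀ (L : Functional n) ms → eval L (collect ms []) ≈ 0#
    eval-collect-[] L []       = refl
    eval-collect-[] L (m ∷ ms) =
      trans (+-cong (zeroˡ _) (eval-collect-[] L ms)) (+-identityˡ 0#)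

    eval-collect-∉ : ∀ (L : Functional n) {ms} c m p → All (m ≢_) ms →
      eval L (collect ms ((c , m) ∷ p)) ≈ eval L (collect ms p)
    eval-collect-∉ L c m p []             = refl
    eval-collect-∉ L c m p (m≢ ∷ m∉ms) =
      +-cong (*-congʳ (reflexive (coeff-≢ c p m≢))) (eval-collect-∉ L c m p m∉ms)

    eval-collect-∷ : ∀ (L : Functional n) {ms} c m p → Unique ms → m ∈ ms →
      eval L (collect ms ((c , m) ∷ p)) ≈ c * L m + eval L (collect ms p)
    eval-collect-∷ L {_ ∷ ms} c m p (m∉ms ∷ _) (here ≡.refl) = begin
      coeff ((c , m) ∷ p) m * L m + eval L (collect ms ((c , m) ∷ p))
        ≈⟨ +-cong (*-congʳ (reflexive (coeff-≡ c m p))) (eval-collect-∉ L c m p m∉ms) ⟩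
      (c + coeff p m) * L m + eval L (collect ms p)
        ≈⟨ +-congʳ (distribʳ (L m) c _) ⟩
      c * L m + coeff p m * L m + eval L (collect ms p)
        ≈⟨ +-assoc _ _ _ ⟩
      c * L m + (coeff p m * L m + eval L (collect ms p)) ∎
    eval-collect-∷ L {m′ ∷ ms} c m p (m′∉ms ∷ ms!) (there m∈ms) = begin
      coeff ((c , m) ∷ p) m′ * L m′ + eval L (collect ms ((c , m) ∷ p))
        ≈⟨ +-cong (*-congʳ (reflexive (coeff-≢ c p (≡.≢-sym (All.lookup m′∉ms m∈ms)))))
                  (eval-collect-∷ L c m p ms! m∈ms) ⟩
      coeff p m′ * L m′ + (c * L m + eval L (collect ms p))
        ≈⟨ x∙yz≈y∙xz _ _ _ ⟩
      c * L m + (coeff p m′ * L m′ + eval L (collect ms p)) ∎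

    eval-collect : ∀ (L : Functional n) {ms} p → Unique ms → All (λ (_ , m) → m ∈ ms) p →
      eval L p ≈ eval L (collect ms p)
    eval-collect L {ms} []            ms! []          = sym (eval-collect-[] L ms)
    eval-collect L ((c , m) ∷ p) ms! (m∈ms ∷ p⊆ms) =
      trans (+-congˡ (eval-collect L p ms! p⊆ms)) (sym (eval-collect-∷ L c m p ms! m∈ms))

    collect-cong : ∀ (L : Functional n) ms p q → (∀ m → coeff p m ≈ coeff q m) →
      eval L (collect ms p) ≈ eval L (collect ms q)
    collect-cong L []       p q p≈q = refl
    collect-cong L (m ∷ ms) p q p≈q = +-cong (*-congʳ (p≈q m)) (collect-cong L ms p q p≈q)

    support : Poly n → List (Monomial n)
    support p = deduplicate _≟ᵐ_ (map proj₂ p)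

    support-unique : ∀ p → Unique (support p)
    support-unique p = deduplicate-! _≟ᵐ_ (map proj₂ p)

    ∈-support : ∀ p → All (λ (_ , m) → m ∈ support p) p
    ∈-support p = All.tabulate λ t∈p → ∈-deduplicate⁺ _≟ᵐ_ (∈-map⁺ proj₂ t∈p)

    -- Both polynomials are collected along one duplicate-free list containing the monomials of
    -- both; after that only coefficients are compared.
    coeff-≈⇒≋ : ∀ {p q : Poly n} → (∀ m → coeff p m ≈ coeff q m) → p ≋ q
    coeff-≈⇒≋ {p} {q} p≈q = functionally λ L → begin
      eval L p                ≈⟨ eval-collect L p ms! (All.tabulate λ t∈p → ∈ms (∈-++⁺ˡ t∈p)) ⟩
      eval L (collect ms p)   ≈⟨ collect-cong L ms p q p≈q ⟩
      eval L (collect ms q)   ≈⟨ eval-collect L q ms! (All.tabulate λ t∈q → ∈ms (∈-++⁺ʳ p t∈q)) ⟨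
      eval L q                ∎
      where
      ms  = support (p ++ q)
      ms! = support-unique (p ++ q)
      ∈ms = All.lookup (∈-support (p ++ q))

    δ : Monomial n → Functional n
    δ m m′ with m′ ≟ᵐ m
    ... | yes _ = 1#
    ... | no  _ = 0#

    coeff-eval : ∀ (p : Poly n) m → coeff p m ≈ eval (δ m) p
    coeff-eval []             m = refl
    coeff-eval ((c , m′) ∷ p) m with m′ ≟ᵐ m
    ... | yes _ = +-cong (sym (*-identityʳ c)) (coeff-eval p m)
    ... | no  _ = trans (coeff-eval p m) (sym (trans (+-congʳ (zeroʳ c)) (+-identityˡ _)))

    ≋⇒coeff-≈ : ∀ {p q : Poly n} → p ≋ q → ∀ m → coeff p m ≈ coeff q m
    ≋⇒coeff-≈ {p} {q} p≋q m =
      trans (coeff-eval p m) (trans (eval-≈ p≋q (δ m)) (sym (coeff-eval q m)))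

  -- `_#0` abstracts apartness from 0. The assumption on sums carries the constructive content: it
  -- tells which summand is apart.
  module Dual {ℓ′} (_#0 : Carrier → Set ℓ′)
    (#0-resp : ∀ {x y} → x ≈ y → x #0 → y #0)
    (0-#0    : ¬ (0# #0))
    (#0-+    : ∀ x y → (x + y) #0 → x #0 ⊎ y #0)
    (#0-*    : ∀ x y → (x * y) #0 → x #0)
    where

    module _ {n : ℕ} where

      collect-#0 : ∀ (L : Functional n) ms p → eval L (collect ms p) #0 →
                   ∃ λ m → coeff p m #0 × L m #0
      collect-#0 L []       p 0#0 = contradiction 0#0 0-#0
      collect-#0 L (m ∷ ms) p e#0 with #0-+ _ _ e#0
      ... | inj₁ cL#0 = m , #0-* _ _ cL#0 , #0-* _ _ (#0-resp (*-comm _ _) cL#0)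
      ... | inj₂ e#0′ = collect-#0 L ms p e#0′

      -- Repeated monomials are merged first, because a listed term may be apart from 0 while the
      -- coefficient of its monomial cancels.
      eval-#0 : ∀ (L : Functional n) p → eval L p #0 → ∃ λ m → coeff p m #0 × L m #0
      eval-#0 L p e#0 = collect-#0 L (support p) p
        (#0-resp (eval-collect L p (support-unique p) (∈-support p)) e#0)

      sum-#0 : ∀ (L : Functional n) {s} (f : Fin s → Poly n) → eval L (sumᴾ f) #0 →
               ∃ λ i → eval L (f i) #0
      sum-#0 L {zero}  f 0#0 = contradiction 0#0 0-#0
      sum-#0 L {suc s} f e#0 with #0-+ _ _ (#0-resp (eval-++ L (f Fin.zero) _) e#0)
      ... | inj₁ e#0′ = Fin.zero , e#0′
      ... | inj₂ e#0′ = let (i , h) = sum-#0 L (f ∘ Fin.suc) e#0′ in Fin.suc i , h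

      -- L 1 = Σ cᵢₘ L (xᵐ fᵢ), so some summand is apart from 0.
      dual-certificate : ∀ (L : Functional n) {s} (p f : Fin s → Poly n) →
        1ᴾ ≋ sumᴾ (λ i → p i *ᴾ f i) → L (Vec.replicate n 0) #0 →
        ∃₂ λ i m → coeff (p i) m #0 × eval (λ m′ → L (m ⊕ m′)) (f i) #0
      dual-certificate L p f 1≋ L1#0 =
        let (i , e#0) = sum-#0 L (λ i → p i *ᴾ f i) (#0-resp (eval-≈ 1≋ L) (#0-resp
                          (sym (trans (+-identityʳ _) (*-identityˡ _))) L1#0))
            (m , h)   = eval-#0 _ (p i) (#0-resp (eval-* L (p i) (f i)) e#0)
        in i , m , h

-- The functional behind the lower bound for colourings

-- The functional sends xᵐ to a value depending only on the numbers n₁, n₂ of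
-- variables whose exponent is 1, 2 mod 3: (0,0) ↦ 1, (3,0) ↦ 1, (1,1) ↦ -½,
-- anything else ↦ 0. The pair is encoded as n₁ + 5 n₂.
κ : ℕ → ℕ
κ 0                   = 0
κ 1                   = 1
κ 2                   = 5
κ (suc (suc (suc a))) = κ a

Λ : ℕ → ℚ
Λ 0 = 1ℚ
Λ 3 = 1ℚ
Λ 6 = ℚ.- ½
Λ _ = 0ℚ

-- `q` counts the cubes that `κ` drops. Code and exponent share n₁ and n₂, so a bound on the degree
-- leaves finitely many codes to check.
residues : ∀ a → ∃ λ n₁ → ∃₂ λ n₂ q → κ a ≡ n₁ ℕ.+ 5 ℕ.* n₂ × a ≡ n₁ ℕ.+ 2 ℕ.* n₂ ℕ.+ 3 ℕ.* q
residues 0 = 0 , 0 , 0 , ≡.refl , ≡.refl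
residues 1 = 1 , 0 , 0 , ≡.refl , ≡.refl
residues 2 = 0 , 1 , 0 , ≡.refl , ≡.refl
residues (suc (suc (suc a))) = let (n₁ , n₂ , q , eq , eq′) = residues a in
  n₁ , n₂ , suc q , eq , ≡.trans (cong (3 ℕ.+_) eq′)
    (solve 3 (λ x y z → con 3 :+ (x :+ con 2 :* y :+ con 3 :* z)
                        := x :+ con 2 :* y :+ con 3 :* (con 1 :+ z)) ≡.refl n₁ n₂ q)
  where open ℕ.+-*-Solver

residues-σ : ∀ {n} (m : Monomial n) →
  ∃ λ n₁ → ∃₂ λ n₂ q → σ κ m ≡ n₁ ℕ.+ 5 ℕ.* n₂ × σ id m ≡ n₁ ℕ.+ 2 ℕ.* n₂ ℕ.+ 3 ℕ.* q
residues-σ []      = 0 , 0 , 0 , ≡.refl , ≡.refl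
residues-σ (a ∷ m) =
  let (n₁ , n₂ , q , eq , eq′) = residues a
      (k₁ , k₂ , r , eqs , eqs′) = residues-σ m
  in n₁ ℕ.+ k₁ , n₂ ℕ.+ k₂ , q ℕ.+ r ,
     ≡.trans (cong₂ ℕ._+_ eq eqs)
       (solve 4 (λ x y z w → x :+ con 5 :* y :+ (z :+ con 5 :* w) := x :+ z :+ con 5 :* (y :+ w))
         ≡.refl n₁ n₂ k₁ k₂) ,
     ≡.trans (cong₂ ℕ._+_ eq′ eqs′)
       (solve 6 (λ x y z u v w → x :+ con 2 :* y :+ con 3 :* z :+ (u :+ con 2 :* v :+ con 3 :* w)
                  := x :+ u :+ con 2 :* (y :+ v) :+ con 3 :* (z :+ w))
         ≡.refl n₁ n₂ q k₁ k₂ r)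
  where open ℕ.+-*-Solver

-- The functional on xᵐ times the polynomial of an edge ij: `a` and `b` are the exponents of xᵢ and
-- xⱼ in xᵐ, and `s` is the code of the other variables.
Λ-edge : ℕ → ℕ → ℕ → ℚ
Λ-edge a b s = Λ (κ (2 ℕ.+ a) ℕ.+ (κ b ℕ.+ s)) ℚ.+ Λ (κ (1 ℕ.+ a) ℕ.+ (κ (1 ℕ.+ b) ℕ.+ s))
               ℚ.+ Λ (κ a ℕ.+ (κ (2 ℕ.+ b) ℕ.+ s))

abstract
  -- Checked by enumeration. The products have degree at most 5, where the codes 0, 3 and 6 come
  -- only from (0,0), (3,0) and (1,1); the pair (6,0), which shares the code of (1,1), needs degree
  -- 6. The cases with nonzero summands are xᵐ = xᵢ or xⱼ, where 1 - ½ - ½ = 0, and xᵐ = xₖ, where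
  -- -½ + 1 - ½ = 0.
  Λ-edge-small : ∀ {a} → a ℕ.< 4 → ∀ {b} → b ℕ.< 4 → ∀ {n₁} → n₁ ℕ.< 4 → ∀ {n₂} → n₂ ℕ.< 2 →
    ∀ {q} → q ℕ.< 2 → a ℕ.+ (b ℕ.+ (n₁ ℕ.+ 2 ℕ.* n₂ ℕ.+ 3 ℕ.* q)) ℕ.≤ 3 →
    Λ-edge a b (n₁ ℕ.+ 5 ℕ.* n₂) ≡ 0ℚ
  Λ-edge-small = from-yes (ℕ.allUpTo? (λ a → ℕ.allUpTo? (λ b → ℕ.allUpTo? (λ n₁ →
    ℕ.allUpTo? (λ n₂ → ℕ.allUpTo? (λ q →
      (a ℕ.+ (b ℕ.+ (n₁ ℕ.+ 2 ℕ.* n₂ ℕ.+ 3 ℕ.* q)) ℕ.≤? 3) →-dec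
      (Λ-edge a b (n₁ ℕ.+ 5 ℕ.* n₂) ℚ.≟ 0ℚ)) 2) 2) 4) 4) 4)

Λ-edge-vanishes : ∀ a b n₁ n₂ q → a ℕ.+ (b ℕ.+ (n₁ ℕ.+ 2 ℕ.* n₂ ℕ.+ 3 ℕ.* q)) ℕ.≤ 3 →
  Λ-edge a b (n₁ ℕ.+ 5 ℕ.* n₂) ≡ 0ℚ
Λ-edge-vanishes a b n₁ n₂ q ≤3 =
  Λ-edge-small (ℕ.s≤s a≤3) (ℕ.s≤s b≤3) (ℕ.s≤s n₁≤3)
    (ℕ.*-cancelˡ-< 2 n₂ 2 (ℕ.s≤s 2n₂≤3)) (ℕ.*-cancelˡ-< 3 q 2 (ℕ.s≤s (ℕ.m≤n⇒m≤o+n 2 3q≤3))) ≤3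
  where
  t = n₁ ℕ.+ 2 ℕ.* n₂
  a≤3 = ℕ.m+n≤o⇒m≤o a ≤3
  rest≤3 = ℕ.m+n≤o⇒n≤o a ≤3
  b≤3 = ℕ.m+n≤o⇒m≤o b rest≤3
  tq≤3 = ℕ.m+n≤o⇒n≤o b rest≤3
  t≤3 = ℕ.m+n≤o⇒m≤o t tq≤3
  3q≤3 = ℕ.m+n≤o⇒n≤o t tq≤3
  n₁≤3 = ℕ.m+n≤o⇒m≤o n₁ t≤3
  2n₂≤3 = ℕ.m+n≤o⇒n≤o n₁ t≤3

module ColoringPairing {a ℓ} (R : CommutativeRing a ℓ)
  (φ : ℚ.+-*-rawRing -Raw-AlmostCommutative⟶ fromCommutativeRing R) where

  open Polynomials R
  open CommutativeRing R
  open _-Raw-AlmostCommutative⟶_ φ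
  open ≈-Reasoning setoid

  module _ {n : ℕ} where

    vertexPoly : Fin n → Poly n
    vertexPoly i = var i ^ᴾ 3 -ᴾ 1ᴾ

    edgePoly : Fin n → Fin n → Poly n
    edgePoly i j = var i ^ᴾ 2 +ᴾ var i *ᴾ var j +ᴾ var j ^ᴾ 2

    pairing : Functional n
    pairing m = ⟦ Λ (σ κ m) ⟧

    σκ-vertex : ∀ (m : Monomial n) i → σ κ (m ⊕ (e i ⊕ (e i ⊕ (e i ⊕ replicate n 0)))) ≡ σ κ m
    σκ-vertex m i = ≡.trans (σ-split κ ≡.refl (m ⊕ u) i)
      (≡.trans (cong₂ ℕ._+_ (cong κ lookup-i) (cong (σ κ) cleared)) (≡.sym (σ-split κ ≡.refl m i)))
      where
      u = e i ⊕ (e i ⊕ (e i ⊕ replicate n 0))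
      lookup-u : ∀ k → lookup u k ≡ lookup (e i) k ℕ.+ (lookup (e i) k ℕ.+ (lookup (e i) k ℕ.+ 0))
      lookup-u k = ≡.trans (lookup-⊕ k (e i) _) (cong (lookup (e i) k ℕ.+_)
        (≡.trans (lookup-⊕ k (e i) _) (cong (lookup (e i) k ℕ.+_)
          (≡.trans (lookup-⊕ k (e i) _) (cong (lookup (e i) k ℕ.+_) (Vec.lookup-replicate k 0))))))
      lookup-i : lookup (m ⊕ u) i ≡ 3 ℕ.+ lookup m i
      lookup-i = ≡.trans (lookup-⊕ i m u) (≡.trans (ℕ.+-comm (lookup m i) _)
        (cong (ℕ._+ lookup m i) (≡.trans (lookup-u i) (cong (λ z → z ℕ.+ (z ℕ.+ (z ℕ.+ 0))) (lookup-e-≡ i)))))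
      cleared : (m ⊕ u) [ i ]≔ 0 ≡ m [ i ]≔ 0
      cleared = lookup-injective go
        where
        go : ∀ k → lookup ((m ⊕ u) [ i ]≔ 0) k ≡ lookup (m [ i ]≔ 0) k
        go k with k Fin.≟ i
        ... | yes ≡.refl = ≡.trans (Vec.lookup∘update i (m ⊕ u) 0) (≡.sym (Vec.lookup∘update i m 0))
        ... | no k≢i = ≡.trans (Vec.lookup∘update′ k≢i (m ⊕ u) 0) (≡.trans (lookup-⊕ k m u)
          (≡.trans (cong (lookup m k ℕ.+_) (≡.trans (lookup-u k)
                     (cong (λ z → z ℕ.+ (z ℕ.+ (z ℕ.+ 0))) (lookup-e-≢ k≢i))))
            (≡.trans (ℕ.+-identityʳ _) (≡.sym (Vec.lookup∘update′ k≢i m 0)))))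

    σκ-⊕ : ∀ (m u : Monomial n) {i j} x y → i ≢ j → lookup u i ≡ x → lookup u j ≡ y →
      (∀ k → k ≢ i → k ≢ j → lookup u k ≡ 0) →
      σ κ (m ⊕ u) ≡ κ (x ℕ.+ lookup m i) ℕ.+ (κ (y ℕ.+ lookup m j) ℕ.+ σ κ (clear i j m))
    σκ-⊕ m u {i} {j} x y i≢j uᵢ uⱼ off = ≡.trans (σ-split₂ κ ≡.refl (m ⊕ u) i≢j)
      (cong₂ ℕ._+_ (cong κ (lookup-shift i uᵢ))
        (cong₂ ℕ._+_ (cong κ (lookup-shift j uⱼ))
          (cong (σ κ) (clear-cong (m ⊕ u) m λ k k≢i k≢j → lookup-shift k (off k k≢i k≢j)))))
      where
      lookup-shift : ∀ k {z} → lookup u k ≡ z → lookup (m ⊕ u) k ≡ z ℕ.+ lookup m k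
      lookup-shift k {z} eq = ≡.trans (lookup-⊕ k m u)
        (≡.trans (ℕ.+-comm (lookup m k) _) (cong (ℕ._+ lookup m k) eq))

    lookup-double : ∀ (i k : Fin n) {z} → lookup (e i) k ≡ z →
      lookup (e i ⊕ (e i ⊕ replicate n 0)) k ≡ z ℕ.+ (z ℕ.+ 0)
    lookup-double i k ≡.refl = ≡.trans (lookup-⊕ k (e i) _) (cong (lookup (e i) k ℕ.+_)
      (≡.trans (lookup-⊕ k (e i) _) (cong (lookup (e i) k ℕ.+_) (Vec.lookup-replicate k 0))))

    pairing-edge : ∀ (m : Monomial n) {i j} → i ≢ j →
      ⟦ Λ (σ κ (m ⊕ (e i ⊕ (e i ⊕ replicate n 0)))) ℚ.+ Λ (σ κ (m ⊕ (e i ⊕ e j)))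
        ℚ.+ Λ (σ κ (m ⊕ (e j ⊕ (e j ⊕ replicate n 0)))) ⟧
      ≡ ⟦ Λ-edge (lookup m i) (lookup m j) (σ κ (clear i j m)) ⟧
    pairing-edge m {i} {j} i≢j = cong ⟦_⟧ (cong₂ ℚ._+_
      (cong₂ ℚ._+_
        (cong Λ (σκ-⊕ m (e i ⊕ (e i ⊕ replicate n 0)) 2 0 i≢j (lookup-double i i (lookup-e-≡ i))
           (lookup-double i j (lookup-e-≢ (≡.≢-sym i≢j))) λ k k≢i _ → lookup-double i k (lookup-e-≢ k≢i)))
        (cong Λ (σκ-⊕ m (e i ⊕ e j) 1 1 i≢j
           (≡.trans (lookup-⊕ i (e i) (e j)) (cong₂ ℕ._+_ (lookup-e-≡ i) (lookup-e-≢ i≢j)))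
           (≡.trans (lookup-⊕ j (e i) (e j)) (cong₂ ℕ._+_ (lookup-e-≢ (≡.≢-sym i≢j)) (lookup-e-≡ j)))
           λ k k≢i k≢j → ≡.trans (lookup-⊕ k (e i) (e j)) (cong₂ ℕ._+_ (lookup-e-≢ k≢i) (lookup-e-≢ k≢j)))))
      (cong Λ (σκ-⊕ m (e j ⊕ (e j ⊕ replicate n 0)) 0 2 i≢j (lookup-double j i (lookup-e-≢ i≢j))
           (lookup-double j j (lookup-e-≡ j)) λ k _ k≢j → lookup-double j k (lookup-e-≢ k≢j))))

    edge-small : ∀ (m : Monomial n) {i j} → i ≢ j → ∣ m ∣ᵐ ℕ.≤ 3 →
      Λ-edge (lookup m i) (lookup m j) (σ κ (clear i j m)) ≡ 0ℚ
    edge-small m {i} {j} i≢j ∣m∣≤3 with residues-σ (clear i j m)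
    ... | n₁ , n₂ , q , eqκ , eqid =
      ≡.trans (cong (Λ-edge (lookup m i) (lookup m j)) eqκ)
        (Λ-edge-vanishes (lookup m i) (lookup m j) n₁ n₂ q (≡.subst (ℕ._≤ 3) (≡.trans (≡.sym (σ-id m))
          (≡.trans (σ-split₂ id ≡.refl m i≢j) (cong (λ z → lookup m i ℕ.+ (lookup m j ℕ.+ z)) eqid))) ∣m∣≤3))

    eval-vertexPoly : ∀ m i → eval (λ m′ → pairing (m ⊕ m′)) (vertexPoly i) ≈ 0#
    eval-vertexPoly m i = begin
      eval L (var i ^ᴾ 3 -ᴾ 1ᴾ)
        ≈⟨ eval-++ L (var i ^ᴾ 3) (-ᴾ 1ᴾ) ⟩
      eval L (var i ^ᴾ 3) + eval L (-ᴾ 1ᴾ)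
        ≈⟨ +-cong (eval-≈ cube L) (eval-neg L 1ᴾ) ⟩
      eval L (monomial (e i ⊕ (e i ⊕ (e i ⊕ replicate n 0)))) + - eval L 1ᴾ
        ≈⟨ +-cong (eval-monomial L _) (-‿cong (eval-monomial L _)) ⟩
      pairing (m ⊕ (e i ⊕ (e i ⊕ (e i ⊕ replicate n 0)))) + - pairing (m ⊕ replicate n 0)
        ≡⟨ cong₂ (λ u v → ⟦ Λ u ⟧ + - ⟦ Λ (σ κ v) ⟧) (σκ-vertex m i) (⊕-identityʳ m) ⟩
      pairing m + - pairing m
        ≈⟨ -‿inverseʳ _ ⟩
      0# ∎
      where
      L : Functional n
      L = λ m′ → pairing (m ⊕ m′)
      cube : var i ^ᴾ 3 ≋ monomial (e i ⊕ (e i ⊕ (e i ⊕ replicate n 0)))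
      cube = ≋-trans (*ᴾ-cong (≋-refl {p = var i}) (monomial-*-* (e i) (e i) (replicate n 0)))
                     (monomial-* (e i) (e i ⊕ (e i ⊕ replicate n 0)))

    eval-edgePoly : ∀ m {i j} → i ≢ j → ∣ m ∣ᵐ ℕ.≤ 3 →
      eval (λ m′ → pairing (m ⊕ m′)) (edgePoly i j) ≈ 0#
    eval-edgePoly m {i} {j} i≢j ∣m∣≤3 = begin
      eval L (edgePoly i j)
        ≈⟨ trans (eval-++ L (var i ^ᴾ 2 +ᴾ var i *ᴾ var j) (var j ^ᴾ 2))
                 (+-congʳ (eval-++ L (var i ^ᴾ 2) (var i *ᴾ var j))) ⟩
      eval L (var i ^ᴾ 2) + eval L (var i *ᴾ var j) + eval L (var j ^ᴾ 2)
        ≈⟨ +-cong (+-cong (square i) (trans (eval-≈ (monomial-* (e i) (e j)) L) (eval-monomial L _))) (square j) ⟩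
      L (e i ⊕ (e i ⊕ replicate n 0)) + L (e i ⊕ e j) + L (e j ⊕ (e j ⊕ replicate n 0))
        ≈⟨ trans (+-homo _ _) (+-congʳ (+-homo _ _)) ⟨
      ⟦ Λ (σ κ (m ⊕ (e i ⊕ (e i ⊕ replicate n 0)))) ℚ.+ Λ (σ κ (m ⊕ (e i ⊕ e j)))
        ℚ.+ Λ (σ κ (m ⊕ (e j ⊕ (e j ⊕ replicate n 0)))) ⟧
        ≡⟨ ≡.trans (pairing-edge m i≢j) (cong ⟦_⟧ (edge-small m i≢j ∣m∣≤3)) ⟩
      ⟦ 0ℚ ⟧
        ≈⟨ 0-homo ⟩
      0# ∎
      where
      L : Functional n
      L = λ m′ → pairing (m ⊕ m′)
      square : ∀ i → eval L (var i ^ᴾ 2) ≈ L (e i ⊕ (e i ⊕ replicate n 0))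
      square i = trans (eval-≈ (monomial-*-* (e i) (e i) (replicate n 0)) L) (eval-monomial L _)

    σκ-0 : ∀ k → σ κ (replicate k 0) ≡ 0
    σκ-0 zero    = ≡.refl
    σκ-0 (suc k) = σκ-0 k

    pairing-1 : pairing (replicate n 0) ≈ 1#
    pairing-1 = trans (reflexive (cong (⟦_⟧ ∘ Λ) (σκ-0 n))) 1-homo

-- Functionals attached to a subset, for the stable set lower bound

module SubsetFunctionals where

  open ≡ using (refl; sym; trans; module ≡-Reasoning)
  open ℚ.+-*-Solver using (solve; _:=_; _:+_; _:*_; :-_; _:-_; con)

  -- Recursive, so that the ring solver sees a successor as 1 plus a number; `natℚ-/1` links it to
  -- the constant of the system.
  natℚ : ℕ → ℚ
  natℚ zero    = 0ℚ
  natℚ (suc k) = 1ℚ ℚ.+ natℚ k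

  natℚ-+ : ∀ j k → natℚ (j ℕ.+ k) ≡ natℚ j ℚ.+ natℚ k
  natℚ-+ zero    k = sym (ℚ.+-identityˡ (natℚ k))
  natℚ-+ (suc j) k = trans (cong (1ℚ ℚ.+_) (natℚ-+ j k)) (sym (ℚ.+-assoc 1ℚ (natℚ j) (natℚ k)))

  natℚ-/1 : ∀ k → + k ℚ./ 1 ≡ natℚ k
  natℚ-/1 zero    = refl
  natℚ-/1 (suc k) = trans (ℚ.toℚᵘ-injective (begin-equality
    ℚ.toℚᵘ (+ suc k ℚ./ 1)                       ≃⟨ ℚ.toℚᵘ-fromℚᵘ (ℚᵘ.mkℚᵘ (+ suc k) 0) ⟩
    ℚᵘ.mkℚᵘ (+ suc k) 0                          ≃⟨ ℚᵘ.*≡* (cong (λ z → (+ 1 ℤ.+ z) ℤ.* + 1)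
                                                            (sym (ℤ.*-identityʳ (+ k)))) ⟩
    ℚᵘ.1ℚᵘ ℚᵘ.+ ℚᵘ.mkℚᵘ (+ k) 0                  ≃⟨ ℚᵘ.+-congʳ ℚᵘ.1ℚᵘ (ℚ.toℚᵘ-fromℚᵘ (ℚᵘ.mkℚᵘ (+ k) 0)) ⟨
    ℚ.toℚᵘ 1ℚ ℚᵘ.+ ℚ.toℚᵘ (+ k ℚ./ 1)            ≃⟨ ℚ.toℚᵘ-homo-+ 1ℚ (+ k ℚ./ 1) ⟨
    ℚ.toℚᵘ (1ℚ ℚ.+ + k ℚ./ 1)                    ∎)) (cong (1ℚ ℚ.+_) (natℚ-/1 k))
    where open ℚᵘ.≤-Reasoning

  natℚ-nonNeg : ∀ k → ℚ.NonNegative (natℚ k)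
  natℚ-nonNeg zero    = _
  natℚ-nonNeg (suc k) = ℚ.nonNeg+nonNeg⇒nonNeg 1ℚ (natℚ k) {{natℚ-nonNeg k}}

  natℚ-pos : ∀ k → ℚ.Positive (natℚ (suc k))
  natℚ-pos k = ℚ.pos+nonNeg⇒pos 1ℚ (natℚ k) {{natℚ-nonNeg k}}

  -- weigh g S takes xᵐ to g (|S| - |supp m|) if supp m ⊆ S and to 0 otherwise.
  weigh : ∀ {n} → (ℕ → ℚ) → Subset n → Monomial n → ℚ
  weigh g []          []          = g 0
  weigh g (true  ∷ S) (zero  ∷ m) = weigh (g ∘ suc) S m
  weigh g (true  ∷ S) (suc _ ∷ m) = weigh g S m
  weigh g (false ∷ S) (zero  ∷ m) = weigh g S m
  weigh g (false ∷ S) (suc _ ∷ m) = 0ℚ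

  weigh-cong : ∀ {n} {g h} (S : Subset n) m → (∀ u → g u ≡ h u) → weigh g S m ≡ weigh h S m
  weigh-cong []          []          g≗h = g≗h 0
  weigh-cong (true  ∷ S) (zero  ∷ m) g≗h = weigh-cong S m (g≗h ∘ suc)
  weigh-cong (true  ∷ S) (suc _ ∷ m) g≗h = weigh-cong S m g≗h
  weigh-cong (false ∷ S) (zero  ∷ m) g≗h = weigh-cong S m g≗h
  weigh-cong (false ∷ S) (suc _ ∷ m) g≗h = refl

  weigh-+ : ∀ {n} g h (S : Subset n) m → weigh g S m ℚ.+ weigh h S m ≡ weigh (λ u → g u ℚ.+ h u) S m
  weigh-+ g h []          []          = refl
  weigh-+ g h (true  ∷ S) (zero  ∷ m) = weigh-+ (g ∘ suc) (h ∘ suc) S m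
  weigh-+ g h (true  ∷ S) (suc _ ∷ m) = weigh-+ g h S m
  weigh-+ g h (false ∷ S) (zero  ∷ m) = weigh-+ g h S m
  weigh-+ g h (false ∷ S) (suc _ ∷ m) = ℚ.+-identityˡ 0ℚ

  weigh-* : ∀ {n} c g (S : Subset n) m → c ℚ.* weigh g S m ≡ weigh (λ u → c ℚ.* g u) S m
  weigh-* c g []          []          = refl
  weigh-* c g (true  ∷ S) (zero  ∷ m) = weigh-* c (g ∘ suc) S m
  weigh-* c g (true  ∷ S) (suc _ ∷ m) = weigh-* c g S m
  weigh-* c g (false ∷ S) (zero  ∷ m) = weigh-* c g S m
  weigh-* c g (false ∷ S) (suc _ ∷ m) = ℚ.*-zeroʳ c

  weigh-0 : ∀ {n} (S : Subset n) m → weigh (λ _ → 0ℚ) S m ≡ 0ℚ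
  weigh-0 []          []          = refl
  weigh-0 (true  ∷ S) (zero  ∷ m) = weigh-0 S m
  weigh-0 (true  ∷ S) (suc _ ∷ m) = weigh-0 S m
  weigh-0 (false ∷ S) (zero  ∷ m) = weigh-0 S m
  weigh-0 (false ∷ S) (suc _ ∷ m) = refl

  weigh-1 : ∀ {n} g (S : Subset n) → weigh g S (replicate n 0) ≡ g ∣ S ∣
  weigh-1 g []          = refl
  weigh-1 g (true  ∷ S) = weigh-1 (g ∘ suc) S
  weigh-1 g (false ∷ S) = weigh-1 g S

  supp : ∀ {n} → Monomial n → Subset n
  supp []          = []
  supp (zero  ∷ m) = outside ∷ supp m
  supp (suc _ ∷ m) = inside  ∷ supp m

  ∣supp∣≤ : ∀ {n} (m : Monomial n) → ∣ supp m ∣ ℕ.≤ ∣ m ∣ᵐ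
  ∣supp∣≤ []          = ℕ.z≤n
  ∣supp∣≤ (zero  ∷ m) = ∣supp∣≤ m
  ∣supp∣≤ (suc a ∷ m) = ℕ.s≤s (ℕ.m≤n⇒m≤o+n a (∣supp∣≤ m))

  weigh-∉ : ∀ {n} g (S : Subset n) m k → lookup S k ≡ outside → lookup m k ≢ 0 → weigh g S m ≡ 0ℚ
  weigh-∉ g (false ∷ S) (zero  ∷ m) Fin.zero    _  ≢0 = contradiction refl ≢0
  weigh-∉ g (false ∷ S) (suc _ ∷ m) Fin.zero    _  ≢0 = refl
  weigh-∉ g (true  ∷ S) (zero  ∷ m) (Fin.suc k) k∉ ≢0 = weigh-∉ (g ∘ suc) S m k k∉ ≢0
  weigh-∉ g (true  ∷ S) (suc _ ∷ m) (Fin.suc k) k∉ ≢0 = weigh-∉ g S m k k∉ ≢0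
  weigh-∉ g (false ∷ S) (zero  ∷ m) (Fin.suc k) k∉ ≢0 = weigh-∉ g S m k k∉ ≢0
  weigh-∉ g (false ∷ S) (suc _ ∷ m) (Fin.suc k) k∉ ≢0 = refl

  -- `weigh` only asks which exponents are zero, and u and 2u have the same zeros.
  weigh-square : ∀ {n} g (S : Subset n) m u → weigh g S (m ⊕ (u ⊕ (u ⊕ replicate n 0))) ≡ weigh g S (m ⊕ u)
  weigh-square g []      []          []      = refl
  weigh-square g (b ∷ S) (suc a ∷ m) (x ∷ u) with b
  ... | true  = weigh-square g S m u
  ... | false = refl
  weigh-square g (b ∷ S) (zero  ∷ m) (suc x ∷ u) with b
  ... | true  = weigh-square g S m u
  ... | false = refl
  weigh-square g (b ∷ S) (zero  ∷ m) (zero  ∷ u) with b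
  ... | true  = weigh-square (g ∘ suc) S m u
  ... | false = weigh-square g S m u

  indicator : ℕ → ℚ
  indicator zero    = 1ℚ
  indicator (suc _) = 0ℚ

  weigh-indicator : ∀ {n} (S : Subset n) m → supp m ≢ S → weigh indicator S m ≡ 0ℚ
  weigh-indicator []          []          ≢S = contradiction refl ≢S
  weigh-indicator (true  ∷ S) (zero  ∷ m) ≢S = weigh-0 S m
  weigh-indicator (true  ∷ S) (suc _ ∷ m) ≢S = weigh-indicator S m (≢S ∘ cong (inside ∷_))
  weigh-indicator (false ∷ S) (zero  ∷ m) ≢S = weigh-indicator S m (≢S ∘ cong (outside ∷_))
  weigh-indicator (false ∷ S) (suc _ ∷ m) ≢S = refl

  sumℚ : ∀ {s} → (Fin s → ℚ) → ℚ
  sumℚ = Vector.foldr ℚ._+_ 0ℚ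

  sumℚ-cong : ∀ {s} {f g : Fin s → ℚ} → (∀ i → f i ≡ g i) → sumℚ f ≡ sumℚ g
  sumℚ-cong {zero}  f≗g = refl
  sumℚ-cong {suc s} f≗g = cong₂ ℚ._+_ (f≗g Fin.zero) (sumℚ-cong (f≗g ∘ Fin.suc))

  sumℚ-0 : ∀ s → sumℚ {s} (λ _ → 0ℚ) ≡ 0ℚ
  sumℚ-0 zero    = refl
  sumℚ-0 (suc s) = trans (ℚ.+-identityˡ _) (sumℚ-0 s)

  -- Let supp m lie in S, with u elements of S missing. Multiplying by one of the |S| - u variables
  -- in supp m keeps u, by one of the u missing ones lowers it by 1, and by one outside S gives 0.
  -- At u = 0 the arbitrary value of `ℕ.pred` is multiplied by 0.
  up : ℕ → (ℕ → ℚ) → ℕ → ℚ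
  up s g u = (natℚ s ℚ.- natℚ u) ℚ.* g u ℚ.+ natℚ u ℚ.* g (ℕ.pred u)

  up-in-0 : ∀ s g u → g u ℚ.+ up s (g ∘ suc) u ≡ up (suc s) g (suc u)
  up-in-0 s g zero = solve 3 (λ s x y →
      x :+ ((s :- con 0ℚ) :* y :+ con 0ℚ :* y)
      := (con 1ℚ :+ s :- (con 1ℚ :+ con 0ℚ)) :* y :+ (con 1ℚ :+ con 0ℚ) :* x) refl
    (natℚ s) (g 0) (g 1)
  up-in-0 s g (suc u) = solve 4 (λ s u x y →
      x :+ ((s :- (con 1ℚ :+ u)) :* y :+ (con 1ℚ :+ u) :* x)
      := (con 1ℚ :+ s :- (con 1ℚ :+ (con 1ℚ :+ u))) :* y :+ (con 1ℚ :+ (con 1ℚ :+ u)) :* x) refl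
    (natℚ s) (natℚ u) (g (suc u)) (g (suc (suc u)))

  up-in-suc : ∀ s g u → g u ℚ.+ up s g u ≡ up (suc s) g u
  up-in-suc s g u = solve 4 (λ s u x y →
      x :+ ((s :- u) :* x :+ u :* y) := (con 1ℚ :+ s :- u) :* x :+ u :* y) refl
    (natℚ s) (natℚ u) (g u) (g (ℕ.pred u))

  -- Multiplication by Σ xᵢ is transposed to up.
  weigh-sum : ∀ {n} g (S : Subset n) m → sumℚ (λ i → weigh g S (m ⊕ e i)) ≡ weigh (up ∣ S ∣ g) S m
  weigh-sum g [] [] = solve 1 (λ x → con 0ℚ := (con 0ℚ :- con 0ℚ) :* x :+ con 0ℚ :* x) refl (g 0)
  weigh-sum g (true ∷ S) (zero ∷ m) = begin
    weigh g S (m ⊕ replicate _ 0) ℚ.+ sumℚ (λ i → weigh (g ∘ suc) S (m ⊕ e i))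
      ≡⟨ cong₂ ℚ._+_ (cong (weigh g S) (⊕-identityʳ m)) (weigh-sum (g ∘ suc) S m) ⟩
    weigh g S m ℚ.+ weigh (up ∣ S ∣ (g ∘ suc)) S m
      ≡⟨ weigh-+ g _ S m ⟩
    weigh (λ u → g u ℚ.+ up ∣ S ∣ (g ∘ suc) u) S m
      ≡⟨ weigh-cong S m (up-in-0 ∣ S ∣ g) ⟩
    weigh (up (suc ∣ S ∣) g ∘ suc) S m ∎
    where open ≡-Reasoning
  weigh-sum g (true ∷ S) (suc _ ∷ m) = begin
    weigh g S (m ⊕ replicate _ 0) ℚ.+ sumℚ (λ i → weigh g S (m ⊕ e i))
      ≡⟨ cong₂ ℚ._+_ (cong (weigh g S) (⊕-identityʳ m)) (weigh-sum g S m) ⟩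
    weigh g S m ℚ.+ weigh (up ∣ S ∣ g) S m
      ≡⟨ weigh-+ g _ S m ⟩
    weigh (λ u → g u ℚ.+ up ∣ S ∣ g u) S m
      ≡⟨ weigh-cong S m (up-in-suc ∣ S ∣ g) ⟩
    weigh (up (suc ∣ S ∣) g) S m ∎
    where open ≡-Reasoning
  weigh-sum g (false ∷ S) (zero  ∷ m) = trans (ℚ.+-identityˡ _) (weigh-sum g S m)
  weigh-sum {suc n} g (false ∷ S) (suc _ ∷ m) = trans (ℚ.+-identityˡ _) (sumℚ-0 n)

  1/suc : ℕ → ℚ
  1/suc k = 1/_ (natℚ (suc k)) {{ℚ.pos⇒nonZero (natℚ (suc k)) {{natℚ-pos k}}}}

  1/suc-pos : ∀ k → ℚ.Positive (1/suc k)
  1/suc-pos k = ℚ.1/pos⇒pos (natℚ (suc k)) {{natℚ-pos k}}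

  suc*1/suc : ∀ k → natℚ (suc k) ℚ.* 1/suc k ≡ 1ℚ
  suc*1/suc k = ℚ.*-inverseʳ (natℚ (suc k)) {{ℚ.pos⇒nonZero (natℚ (suc k)) {{natℚ-pos k}}}}

  module _ (k : ℕ) where

    -- γ = - γ⁺ is the solution of (k + 1 + u) · γ u = u · γ (u - 1) - [u = 0].
    γ⁺ : ℕ → ℚ
    γ⁺ zero    = 1/suc k
    γ⁺ (suc u) = natℚ (suc u) ℚ.* γ⁺ u ℚ.* 1/suc (k ℕ.+ suc u)

    γ⁺-pos : ∀ u → ℚ.Positive (γ⁺ u)
    γ⁺-pos zero    = 1/suc-pos k
    γ⁺-pos (suc u) = ℚ.pos*pos⇒pos (natℚ (suc u) ℚ.* γ⁺ u)
      {{ℚ.pos*pos⇒pos (natℚ (suc u)) {{natℚ-pos u}} (γ⁺ u) {{γ⁺-pos u}}}} _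
      {{1/suc-pos (k ℕ.+ suc u)}}

    γ : ℕ → ℚ
    γ u = ℚ.- γ⁺ u

    γ≢0 : ∀ u → γ u ≢ 0ℚ
    γ≢0 u γ≡0 = ℚ.<-irrefl (sym γ⁺≡0) (ℚ.positive⁻¹ (γ⁺ u) {{γ⁺-pos u}})
      where
      γ⁺≡0 : γ⁺ u ≡ 0ℚ
      γ⁺≡0 = trans (solve 1 (λ x → x := :- (:- x)) refl (γ⁺ u)) (cong ℚ.-_ γ≡0)

    -- The terms in `s` cancel and leave u γ(u - 1) - (k + 1 + u) γ(u), so one sequence serves all
    -- subsets with the same gap k + 1 = N - |S|. Unrolled, γ⁺(u) is k! u! / (k + u + 1)!, a Beta
    -- integral; its positivity makes L 1 = γ(|S|) nonzero.
    γ-solution : ∀ s u → up s γ u ℚ.- natℚ (s ℕ.+ suc k) ℚ.* γ u ≡ indicator u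
    γ-solution s zero = begin
      up s γ 0 ℚ.- natℚ (s ℕ.+ suc k) ℚ.* γ 0
        ≡⟨ cong (λ z → up s γ 0 ℚ.- z ℚ.* γ 0) (natℚ-+ s (suc k)) ⟩
      up s γ 0 ℚ.- (natℚ s ℚ.+ natℚ (suc k)) ℚ.* γ 0
        ≡⟨ solve 3 (λ s K x → (s :- con 0ℚ) :* (:- x) :+ con 0ℚ :* (:- x) :- (s :+ K) :* (:- x) := K :* x) refl
             (natℚ s) (natℚ (suc k)) (γ⁺ 0) ⟩
      natℚ (suc k) ℚ.* 1/suc k
        ≡⟨ suc*1/suc k ⟩
      1ℚ ∎
      where open ≡-Reasoning
    γ-solution s (suc u) = begin
      up s γ (suc u) ℚ.- natℚ (s ℕ.+ suc k) ℚ.* γ (suc u)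
        ≡⟨ cong (λ z → up s γ (suc u) ℚ.- z ℚ.* γ (suc u)) (natℚ-+ s (suc k)) ⟩
      up s γ (suc u) ℚ.- (natℚ s ℚ.+ natℚ (suc k)) ℚ.* γ (suc u)
        ≡⟨ solve 5 (λ s K U x y →
             (s :- U) :* (:- (U :* x :* y)) :+ U :* (:- x) :- (s :+ K) :* (:- (U :* x :* y))
             := U :* x :* ((K :+ U) :* y) :- U :* x) refl
             (natℚ s) (natℚ (suc k)) (natℚ (suc u)) (γ⁺ u) (D⁻¹) ⟩
      X ℚ.* ((natℚ (suc k) ℚ.+ natℚ (suc u)) ℚ.* D⁻¹) ℚ.- X
        ≡⟨ cong (λ z → X ℚ.* (z ℚ.* D⁻¹) ℚ.- X) (natℚ-+ (suc k) (suc u)) ⟨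
      X ℚ.* (D ℚ.* D⁻¹) ℚ.- X
        ≡⟨ cong (λ z → X ℚ.* z ℚ.- X) (suc*1/suc (k ℕ.+ suc u)) ⟩
      X ℚ.* 1ℚ ℚ.- X
        ≡⟨ solve 1 (λ x → x :* con 1ℚ :- x := con 0ℚ) refl X ⟩
      0ℚ ∎
      where
      open ≡-Reasoning
      D = natℚ (suc (k ℕ.+ suc u))
      D⁻¹ = 1/suc (k ℕ.+ suc u)
      X = natℚ (suc u) ℚ.* γ⁺ u

    weigh-γ : ∀ {n N} (S : Subset n) m → ∣ S ∣ ℕ.+ suc k ≡ N → supp m ≢ S →
      sumℚ (λ i → weigh γ S (m ⊕ e i)) ℚ.- natℚ N ℚ.* weigh γ S m ≡ 0ℚ
    weigh-γ S m refl ≢S = begin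
      sumℚ (λ i → weigh γ S (m ⊕ e i)) ℚ.- K ℚ.* weigh γ S m
        ≡⟨ cong₂ ℚ._+_ (weigh-sum γ S m) (trans (ℚ.neg-distribˡ-* K (weigh γ S m)) (weigh-* (ℚ.- K) γ S m)) ⟩
      weigh (up ∣ S ∣ γ) S m ℚ.+ weigh (λ u → ℚ.- K ℚ.* γ u) S m
        ≡⟨ weigh-+ _ _ S m ⟩
      weigh (λ u → up ∣ S ∣ γ u ℚ.+ ℚ.- K ℚ.* γ u) S m
        ≡⟨ weigh-cong S m (λ u → trans (cong (up ∣ S ∣ γ u ℚ.+_) (sym (ℚ.neg-distribˡ-* K (γ u))))
                                       (γ-solution ∣ S ∣ u)) ⟩
      weigh indicator S m
        ≡⟨ weigh-indicator S m ≢S ⟩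
      0ℚ ∎
      where
      open ≡-Reasoning
      K = natℚ (∣ S ∣ ℕ.+ suc k)

open SubsetFunctionals

module StableSetPairing {a ℓ} (R : CommutativeRing a ℓ)
  (φ : ℚ.+-*-rawRing -Raw-AlmostCommutative⟶ fromCommutativeRing R) where

  open Polynomials R
  open CommutativeRing R
  open _-Raw-AlmostCommutative⟶_ φ
  open ≈-Reasoning setoid

  module _ {n : ℕ} where

    sumPoly : ℕ → Poly n
    sumPoly N = sumᴾ var -ᴾ const ⟦ + N ℚ./ 1 ⟧

    idempotentPoly : Fin n → Poly n
    idempotentPoly i = var i ^ᴾ 2 -ᴾ var i

    eval-sumᴾ : ∀ (L : Functional n) {s} (f : Fin s → Poly n) (v : Fin s → ℚ) →
      (∀ i → eval L (f i) ≈ ⟦ v i ⟧) → eval L (sumᴾ f) ≈ ⟦ sumℚ v ⟧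
    eval-sumᴾ L {zero}  f v f≈v = sym 0-homo
    eval-sumᴾ L {suc s} f v f≈v = trans (eval-++ L (f Fin.zero) _)
      (trans (+-cong (f≈v Fin.zero) (eval-sumᴾ L (f ∘ Fin.suc) (v ∘ Fin.suc) (f≈v ∘ Fin.suc)))
             (sym (+-homo _ _)))

    module _ (k : ℕ) (S : Subset n) where

      stablePairing : Functional n
      stablePairing m = ⟦ weigh (γ k) S m ⟧

      private
        L : Monomial n → Functional n
        L m m′ = stablePairing (m ⊕ m′)

      eval-sumPoly : ∀ m {N} → ∣ S ∣ ℕ.+ suc k ≡ N → supp m ≢ S → eval (L m) (sumPoly N) ≈ 0#
      eval-sumPoly m {N} eqN ≢S = begin
        eval (L m) (sumPoly N)
          ≈⟨ eval-++ (L m) (sumᴾ var) _ ⟩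
        eval (L m) (sumᴾ var) + eval (L m) (-ᴾ const ⟦ + N ℚ./ 1 ⟧)
          ≈⟨ +-cong (eval-sumᴾ (L m) var (λ i → weigh (γ k) S (m ⊕ e i)) (λ i → eval-monomial (L m) (e i)))
                    (trans (eval-neg (L m) (const ⟦ + N ℚ./ 1 ⟧)) (-‿cong (+-identityʳ _))) ⟩
        ⟦ Σ ⟧ + - (⟦ + N ℚ./ 1 ⟧ * stablePairing (m ⊕ replicate n 0))
          ≡⟨ cong₂ (λ x u → ⟦ Σ ⟧ + - (⟦ x ⟧ * stablePairing u)) (natℚ-/1 N) (⊕-identityʳ m) ⟩
        ⟦ Σ ⟧ + - (⟦ natℚ N ⟧ * ⟦ weigh (γ k) S m ⟧)
          ≈⟨ +-congˡ (trans (-‿homo _) (-‿cong (*-homo _ _))) ⟨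
        ⟦ Σ ⟧ + ⟦ ℚ.- (natℚ N ℚ.* weigh (γ k) S m) ⟧
          ≈⟨ +-homo _ _ ⟨
        ⟦ Σ ℚ.- natℚ N ℚ.* weigh (γ k) S m ⟧
          ≡⟨ cong ⟦_⟧ (weigh-γ k S m eqN ≢S) ⟩
        ⟦ 0ℚ ⟧
          ≈⟨ 0-homo ⟩
        0# ∎
        where
        Σ : ℚ
        Σ = sumℚ (λ i → weigh (γ k) S (m ⊕ e i))

      eval-idempotentPoly : ∀ m i → eval (L m) (idempotentPoly i) ≈ 0#
      eval-idempotentPoly m i = begin
        eval (L m) (var i ^ᴾ 2 -ᴾ var i)
          ≈⟨ eval-++ (L m) (var i ^ᴾ 2) (-ᴾ var i) ⟩
        eval (L m) (var i ^ᴾ 2) + eval (L m) (-ᴾ var i)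
          ≈⟨ +-cong (trans (eval-≈ (monomial-*-* (e i) (e i) (replicate n 0)) (L m)) (eval-monomial (L m) _))
                    (trans (eval-neg (L m) (var i)) (-‿cong (eval-monomial (L m) (e i)))) ⟩
        L m (e i ⊕ (e i ⊕ replicate n 0)) + - L m (e i)
          ≡⟨ cong (λ x → ⟦ x ⟧ + - L m (e i)) (weigh-square (γ k) S m (e i)) ⟩
        L m (e i) + - L m (e i)
          ≈⟨ -‿inverseʳ _ ⟩
        0# ∎

      -- For a stable S the vertex `l` is an endpoint of the edge ij outside S: the support of the
      -- product then leaves S.
      eval-productPoly : ∀ m {i j} l → lookup S l ≡ outside → lookup (e i ⊕ e j) l ≢ 0 →
        eval (L m) (var i *ᴾ var j) ≈ 0#
      eval-productPoly m {i} {j} l l∉S ≢0 = begin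
        eval (L m) (var i *ᴾ var j)
          ≈⟨ trans (eval-≈ (monomial-* (e i) (e j)) (L m)) (eval-monomial (L m) _) ⟩
        ⟦ weigh (γ k) S (m ⊕ (e i ⊕ e j)) ⟧
          ≡⟨ cong ⟦_⟧ (weigh-∉ (γ k) S _ l l∉S (≢0 ∘ λ eq →
               ℕ.m+n≡0⇒n≡0 (lookup m l) (≡.trans (≡.sym (lookup-⊕ l m (e i ⊕ e j))) eq))) ⟩
        ⟦ 0ℚ ⟧
          ≈⟨ 0-homo ⟩
        0# ∎

      stablePairing-1 : stablePairing (replicate n 0) ≡ ⟦ γ k ∣ S ∣ ⟧
      stablePairing-1 = cong ⟦_⟧ (weigh-1 (γ k) S)

-- Identities in algebras over ℚ

module RationalAlgebra {a ℓ} (A : CommutativeRing a ℓ)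
  (ψ : ℚ.+-*-rawRing -Raw-AlmostCommutative⟶ fromCommutativeRing A) where

  open CommutativeRing A
  open _-Raw-AlmostCommutative⟶_ ψ using (+-homo; *-homo; -‿homo; 1-homo)
  open _-Raw-AlmostCommutative⟶_ ψ public using () renaming (⟦_⟧ to ι)

  ι-≟ : ∀ p q → Maybe.Maybe (ι p ≈ ι q)
  ι-≟ p q = Maybe.map (λ p≡q → reflexive (cong ι p≡q)) (dec⇒maybe (p ℚ.≟ q))

  open Algebra.Solver.Ring ℚ.+-*-rawRing (fromCommutativeRing A) ψ ι-≟ public
    using (solve; _:=_; _:+_; _:*_; _:-_; con)

  -- This and the next two identities match the three cases of `term`: i in S, i adjacent to S, and
  -- S ∪ {i} stable. The factor v * (v * 1#) is what `v ^ᴾ 2` unfolds to.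
  idempotent-* : ∀ v t → t * (v * (v * 1#) - v) ≈ (v + ι (ℚ.- 1ℚ)) * (v * t)
  idempotent-* v t = trans (*-congˡ (+-congʳ (*-congˡ (*-identityʳ v))))
    (solve 2 (λ v t → t :* (v :* v :- v) := (v :+ con (ℚ.- 1ℚ)) :* (v :* t)) refl v t)

  edge-* : ∀ v w t → t * (v * w) ≈ (v + ι 0ℚ) * (w * t)
  edge-* = solve 3 (λ v w t → t :* (v :* w) := (v :+ con 0ℚ) :* (w :* t)) refl

  plain-* : ∀ v t → v * t ≈ (v + ι 0ℚ) * t
  plain-* = solve 2 (λ v t → v :* t := (v :+ con 0ℚ) :* t) refl

  -- As N = s + k, the bracket equals k x. Dividing by k is the only use of N being different from
  -- |S|.
  solve-for : ∀ Σ x {N s k k⁻¹} → N ≡ s ℚ.+ k → k ℚ.* k⁻¹ ≡ 1ℚ →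
    ι k⁻¹ * ((Σ + ι (ℚ.- s)) * x - x * (Σ - ι N)) ≈ x
  solve-for Σ x {N} {s} {k} {k⁻¹} ≡.refl kk⁻¹≡1 = begin
    ι k⁻¹ * ((Σ + ι (ℚ.- s)) * x - x * (Σ - ι (s ℚ.+ k)))
      ≈⟨ *-congˡ (+-cong (*-congʳ (+-congˡ (-‿homo s))) (-‿cong (*-congˡ (+-congˡ (-‿cong (+-homo s k)))))) ⟩
    ι k⁻¹ * ((Σ - ι s) * x - x * (Σ - (ι s + ι k)))
      ≈⟨ solve 5 (λ Σ x s k k⁻¹ → k⁻¹ :* ((Σ :- s) :* x :- x :* (Σ :- (s :+ k))) := k :* k⁻¹ :* x) refl
           Σ x (ι s) (ι k) (ι k⁻¹) ⟩
    ι k * ι k⁻¹ * x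
      ≈⟨ *-congʳ (trans (sym (*-homo k k⁻¹)) (trans (reflexive (cong ι kk⁻¹≡1)) 1-homo)) ⟩
    1# * x
      ≈⟨ *-identityˡ x ⟩
    x ∎
    where open ≈-Reasoning setoid

-- Odd wheels in a filtered ideal

module FilteredIdeal {a ℓ} (A : CommutativeRing a ℓ)
  (ψ : ℚ.+-*-rawRing -Raw-AlmostCommutative⟶ fromCommutativeRing A) where

  open CommutativeRing A
  open RationalAlgebra A ψ
  open _-Raw-AlmostCommutative⟶_ ψ using (1-homo; -‿homo)
  open Algebra.Properties.Ring ring using (-1*x≈-x)

  -- `D d` stands for degree at most d, and `I d` for membership in the ideal with coefficients of
  -- degree at most d. Degree is charged to the multipliers, so generators enter at 0. With both
  -- abstract, the solver meets atoms and no lists of terms.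
  module Wheel {ℓ₁ ℓ₂}
    (D : ℕ → Carrier → Set ℓ₁)
    (D-+ : ∀ {d p q} → D d p → D d q → D d (p + q))
    (D-- : ∀ {d p} → D d p → D d (- p))
    (D-* : ∀ {d e p q} → D d p → D e q → D (d ℕ.+ e) (p * q))
    (D-ι : ∀ q → D 0 (ι q))
    (I : ℕ → Carrier → Set ℓ₂)
    (I-resp : ∀ {d p q} → p ≈ q → I d p → I d q)
    (I-mono : ∀ {d e p} → d ℕ.≤ e → I d p → I e p)
    (I-+ : ∀ {d p q} → I d p → I d q → I d (p + q))
    (I-* : ∀ {d e p q} → D d q → I e p → I (d ℕ.+ e) (q * p))
    where

    I-ι : ∀ {d p} q → I d p → I d (ι q * p)
    I-ι q = I-* (D-ι q)

    I-neg : ∀ {d p} → I d p → I d (- p)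
    I-neg {p = p} p∈ = I-resp
      (trans (*-congʳ (trans (-‿homo 1ℚ) (-‿cong 1-homo))) (-1*x≈-x p)) (I-ι (ℚ.- 1ℚ) p∈)

    I-- : ∀ {d p q} → I d p → I d q → I d (p - q)
    I-- p∈ q∈ = I-+ p∈ (I-neg q∈)

    3ι : Carrier
    3ι = ι (+ 3 ℚ./ 1)

    edge : Carrier → Carrier → Carrier
    edge a b = a * a + a * b + b * b

    edge-comm : ∀ a b → edge a b ≈ edge b a
    edge-comm = solve 2 (λ a b → a :* a :+ a :* b :+ b :* b := b :* b :+ b :* a :+ a :* a) refl

    record Vertex (a : Carrier) : Set (ℓ₁ Level.⊔ ℓ₂) where
      field
        degree : D 1 a
        cube   : I 0 (a * a * a - ι 1ℚ)
    open Vertex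

    record Triangle (a b c : Carrier) : Set ℓ₂ where
      constructor triangle
      field
        ab : I 0 (edge a b)
        ca : I 0 (edge c a)
        cb : I 0 (edge c b)
    open Triangle

    module _ {a b c} (a-vertex : Vertex a) (b-vertex : Vertex b) (c-vertex : Vertex c) where

      -- The edge polynomials of ca and cb differ by (a - b)(a + b + c), and a² + ab + b² - (a - b)²
      -- = 3ab. Classically: three distinct cube roots of unity have sum 0.
      triangle-sum : Triangle a b c → I 1 (3ι * (a * b * (a + b + c)))
      triangle-sum t = I-resp
        (solve 3 (λ a b c →
            (a :+ b :+ c) :* (a :* a :+ a :* b :+ b :* b)
              :- (a :- b) :* (c :* c :+ c :* a :+ a :* a :- (c :* c :+ c :* b :+ b :* b))
            := con (+ 3 ℚ./ 1) :* (a :* b :* (a :+ b :+ c))) refl a b c)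
        (I-- (I-* (D-+ (D-+ (degree a-vertex) (degree b-vertex)) (degree c-vertex)) (ab t))
             (I-* (D-+ (degree a-vertex) (D-- (degree b-vertex))) (I-- (ca t) (cb t))))

    module _ {c} (c-vertex : Vertex c) where

      infix 4 _∼_

      -- The degree 4 form of “s and t get the same colour”.
      _∼_ : Carrier → Carrier → Set _
      s ∼ t = ∀ {y} → D 1 y → I 4 (3ι * (c * y * (s - t)))

      -- Membership of 0 is not among the assumptions on `I`; it is obtained as the zero multiple of
      -- s³ - 1.
      ∼-refl : ∀ {s} → Vertex s → s ∼ s
      ∼-refl {s} s-vertex {y} y-degree = I-resp
        (solve 3 (λ c y s → con 0ℚ :* (s :* s :* s :- con 1ℚ)
                            := con (+ 3 ℚ./ 1) :* (c :* y :* (s :- s))) refl c y s)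
        (I-mono ℕ.z≤n (I-ι 0ℚ (cube s-vertex)))

      ∼-trans : ∀ {s t u} → s ∼ t → t ∼ u → s ∼ u
      ∼-trans {s} {t} {u} s∼t t∼u {y} y-degree = I-resp
        (solve 5 (λ c y s t u → con (+ 3 ℚ./ 1) :* (c :* y :* (s :- t)) :+ con (+ 3 ℚ./ 1) :* (c :* y :* (t :- u))
                                := con (+ 3 ℚ./ 1) :* (c :* y :* (s :- u))) refl c y s t u)
        (I-+ (s∼t y-degree) (t∼u y-degree))

      -- Two triangles sharing the edge cu give cu(s - t) ∈ I 1; multiply by yu²
      -- and use u³ = 1.
      ∼-step : ∀ {s t u} → Vertex s → Vertex t → Vertex u → Triangle c u s → Triangle c u t → s ∼ t
      ∼-step {s} {t} {u} s-vertex t-vertex u-vertex cus cut {y} y-degree = I-resp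
        (solve 5 (λ c u s t y →
            y :* (u :* u) :* (con (+ 3 ℚ./ 1) :* (c :* u :* (c :+ u :+ s)) :- con (+ 3 ℚ./ 1) :* (c :* u :* (c :+ u :+ t)))
              :- con (+ 3 ℚ./ 1) :* (c :* y :* (s :- t)) :* (u :* u :* u :- con 1ℚ)
            := con (+ 3 ℚ./ 1) :* (c :* y :* (s :- t))) refl c u s t y)
        (I-- (I-* (D-* y-degree (D-* (degree u-vertex) (degree u-vertex)))
                  (I-- (triangle-sum c-vertex u-vertex s-vertex cus) (triangle-sum c-vertex u-vertex t-vertex cut)))
             (I-mono (ℕ.n≤1+n 3) (I-* (D-* (D-ι (+ 3 ℚ./ 1)) (D-* (D-* (degree c-vertex) y-degree)
                                     (D-+ (degree s-vertex) (D-- (degree t-vertex)))))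
                              (cube u-vertex))))

      -- Replacing b by a through `a ∼ b` turns 3c²(c + a + b) into 3c³ + 6c²a, and 3c(a² + ab + b²)
      -- into 9ca². Three times the first plus twice the second, subtracted from 18c(c² + ca + a²),
      -- leaves 9c³, and c³ is congruent to 1.
      ∼-absurd : ∀ {a b} → Vertex a → Vertex b → Triangle c a b → I 0 (edge a b) → a ∼ b → I 4 (ι 1ℚ)
      ∼-absurd {a} {b} a-vertex b-vertex cab ab∈ a∼b = I-resp
        (solve 3 (λ a b c →
            con (+ 1 ℚ./ 9) :*
              (con (+ 18 ℚ./ 1) :* (c :* (c :* c :+ c :* a :+ a :* a))
                :- (con (+ 3 ℚ./ 1) :* (W a b c :+ Z a b c c)
                    :+ con (+ 2 ℚ./ 1) :* (con (+ 3 ℚ./ 1) :* (c :* (a :* a :+ a :* b :+ b :* b)) :+ Z a b c b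
                                            :+ con (+ 2 ℚ./ 1) :* Z a b c a))
                :- con (+ 9 ℚ./ 1) :* (c :* c :* c :- con 1ℚ))
            := con 1ℚ) refl a b c)
        (I-ι (+ 1 ℚ./ 9)
          (I-- (I-- (I-ι _ (degree-4 (ab cab)))
                    (I-+ (I-ι _ (I-+ w (a∼b (degree c-vertex))))
                         (I-ι _ (I-+ (I-+ (I-ι _ (degree-4 ab∈)) (a∼b (degree b-vertex)))
                                     (I-ι _ (a∼b (degree a-vertex)))))))
               (I-ι _ (I-mono ℕ.z≤n (cube c-vertex)))))
        where
        W = λ a b c → con (+ 3 ℚ./ 1) :* (c :* c :* (c :+ a :+ b))
        Z = λ a b c y → con (+ 3 ℚ./ 1) :* (c :* y :* (a :- b))

        degree-4 : ∀ {p} → I 0 p → I 4 (c * p)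
        degree-4 p∈ = I-mono (ℕ.s≤s ℕ.z≤n) (I-* (degree c-vertex) p∈)

        -- `triangle-sum` supplies ca(c + a + b) in degree 1; multiplying by ca² completes a cube of
        -- a, which a³ - 1 removes.
        w : I 4 (3ι * (c * c * (c + a + b)))
        w = I-resp
          (solve 3 (λ a b c →
              c :* (a :* a) :* (con (+ 3 ℚ./ 1) :* (c :* a :* (c :+ a :+ b))) :- W a b c :* (a :* a :* a :- con 1ℚ)
              := W a b c) refl a b c)
          (I-- (I-* (D-* (degree c-vertex) (D-* (degree a-vertex) (degree a-vertex)))
                    (triangle-sum c-vertex a-vertex b-vertex cab))
               (I-mono (ℕ.n≤1+n 3) (I-* (D-* (D-ι (+ 3 ℚ./ 1)) (D-* (D-* (degree c-vertex) (degree c-vertex))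
                                       (D-+ (D-+ (degree c-vertex) (degree a-vertex)) (degree b-vertex))))
                                (cube a-vertex))))

-- Linear combinations with coefficients of bounded degree

module Span {a ℓ} (R : CommutativeRing a ℓ) where

  open Polynomials R

  -- A bound on the monomials that are written down, hence on the degree.
  DegreeBound : ∀ {n} → ℕ → Poly n → Set a
  DegreeBound d = All λ (_ , m) → ∣ m ∣ᵐ ℕ.≤ d

  module _ {n : ℕ} where

    DegreeBound-+ : ∀ {d} {p q : Poly n} → DegreeBound d p → DegreeBound d q → DegreeBound d (p +ᴾ q)
    DegreeBound-+ = All.++⁺

    DegreeBound-neg : ∀ {d} {p : Poly n} → DegreeBound d p → DegreeBound d (-ᴾ p)
    DegreeBound-neg = All.map⁺

    DegreeBound-* : ∀ {d e} {p q : Poly n} → DegreeBound d p → DegreeBound e q → DegreeBound (d ℕ.+ e) (p *ᴾ q)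
    DegreeBound-* []          q≤ = []
    DegreeBound-* {p = (c , m) ∷ p} (m≤ ∷ p≤) q≤ = All.++⁺
      (All.map⁺ (All.map (λ {(_ , m′)} m′≤ → ≡.subst (ℕ._≤ _) (≡.sym (∣⊕∣ m m′)) (ℕ.+-mono-≤ m≤ m′≤)) q≤))
      (DegreeBound-* p≤ q≤)

    DegreeBound-const : ∀ c → DegreeBound {n} 0 (const c)
    DegreeBound-const c = ℕ.≤-reflexive (∣0∣ n) ∷ []

    DegreeBound-var : ∀ (i : Fin n) → DegreeBound 1 (var i)
    DegreeBound-var i = ℕ.≤-reflexive (∣e∣ i) ∷ []

  sum-[] : ∀ {n} s → sumᴾ {n} {s} (λ _ → []) ≋ []
  sum-[] zero    = ≋-refl
  sum-[] (suc s) = sum-[] s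

  module _ {n : ℕ} (fs : List (Poly n)) where

    private module Q = CommutativeRing (polyRing n)
    open Algebra.Properties.Semiring.Sum Q.semiring using (∑-distrib-+; *-distribˡ-sum; sum-cong-≋)
    open ≈-Reasoning Q.setoid

    combination : (Fin (length fs) → Poly n) → Poly n
    combination c = sumᴾ (λ i → c i *ᴾ List.lookup fs i)

    InSpan : ℕ → Poly n → Set (a Level.⊔ ℓ)
    InSpan d p = ∃ λ (c : Fin (length fs) → Poly n) → (∀ i → DegreeBound d (c i)) × p ≋ combination c

    InSpan-resp : ∀ {d p q} → p ≋ q → InSpan d p → InSpan d q
    InSpan-resp p≋q (c , c≤ , p≋) = c , c≤ , ≋-trans (≋-sym p≋q) p≋

    InSpan-mono : ∀ {d e p} → d ℕ.≤ e → InSpan d p → InSpan e p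
    InSpan-mono d≤e (c , c≤ , p≋) = c , (λ i → All.map (λ m≤ → ℕ.≤-trans m≤ d≤e) (c≤ i)) , p≋

    InSpan-+ : ∀ {d p q} → InSpan d p → InSpan d q → InSpan d (p +ᴾ q)
    InSpan-+ {p = p} {q} (c , c≤ , p≋) (b , b≤ , q≋) =
      (λ i → c i +ᴾ b i) , (λ i → All.++⁺ (c≤ i) (b≤ i)) , (begin
        p +ᴾ q
          ≈⟨ +ᴾ-cong p≋ q≋ ⟩
        combination c +ᴾ combination b
          ≈⟨ ∑-distrib-+ (λ i → c i *ᴾ List.lookup fs i) (λ i → b i *ᴾ List.lookup fs i) ⟨
        sumᴾ (λ i → c i *ᴾ List.lookup fs i +ᴾ b i *ᴾ List.lookup fs i)
          ≈⟨ sum-cong-≋ (λ i → *ᴾ-distribʳ (List.lookup fs i) (c i) (b i)) ⟨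
        combination (λ i → c i +ᴾ b i) ∎)

    InSpan-* : ∀ {d e p q} → DegreeBound d q → InSpan e p → InSpan (d ℕ.+ e) (q *ᴾ p)
    InSpan-* {p = p} {q} q≤ (c , c≤ , p≋) =
      (λ i → q *ᴾ c i) , (λ i → DegreeBound-* q≤ (c≤ i)) , (begin
        q *ᴾ p
          ≈⟨ *ᴾ-cong (≋-refl {p = q}) p≋ ⟩
        q *ᴾ combination c
          ≈⟨ *-distribˡ-sum q (λ i → c i *ᴾ List.lookup fs i) ⟩
        sumᴾ (λ i → q *ᴾ (c i *ᴾ List.lookup fs i))
          ≈⟨ sum-cong-≋ (λ i → *ᴾ-assoc q (c i) (List.lookup fs i)) ⟨
        combination (λ i → q *ᴾ c i) ∎)

    InSpan-0 : ∀ {d} → InSpan d []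
    InSpan-0 = (λ _ → []) , (λ _ → []) , ≋-sym (sum-[] (length fs))

    InSpan-sum : ∀ {d s} (p : Fin s → Poly n) → (∀ i → InSpan d (p i)) → InSpan d (sumᴾ p)
    InSpan-sum {s = zero}  p p∈ = InSpan-0
    InSpan-sum {s = suc s} p p∈ = InSpan-+ {p = p Fin.zero} (p∈ Fin.zero) (InSpan-sum (p ∘ Fin.suc) (p∈ ∘ Fin.suc))

  module _ {n : ℕ} where

    private module Q = CommutativeRing (polyRing n)

    unit : ∀ {s} → Fin s → Fin s → Poly n
    unit Fin.zero    Fin.zero    = 1ᴾ
    unit Fin.zero    (Fin.suc j) = []
    unit (Fin.suc i) Fin.zero    = []
    unit (Fin.suc i) (Fin.suc j) = unit i j

    DegreeBound-unit : ∀ {s} (i j : Fin s) → DegreeBound 0 (unit i j)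
    DegreeBound-unit Fin.zero    Fin.zero    = DegreeBound-const _
    DegreeBound-unit Fin.zero    (Fin.suc j) = []
    DegreeBound-unit (Fin.suc i) Fin.zero    = []
    DegreeBound-unit (Fin.suc i) (Fin.suc j) = DegreeBound-unit i j

    sum-unit : ∀ {s} (f : Fin s → Poly n) i → f i ≋ sumᴾ (λ j → unit i j *ᴾ f j)
    sum-unit         f (Fin.suc i) = sum-unit (f ∘ Fin.suc) i
    sum-unit {suc s} f Fin.zero    = ≋-sym (≋-trans
      (+ᴾ-cong (*ᴾ-identityˡ (f Fin.zero)) (sum-[] s)) (Q.+-identityʳ (f Fin.zero)))

    InSpan-∈ : ∀ {fs : List (Poly n)} {f} → f ∈ fs → InSpan fs 0 f
    InSpan-∈ {fs} {f} f∈ = unit i , DegreeBound-unit i ,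
      ≡.subst (_≋ combination fs (unit i)) (≡.sym (Any.lookup-index f∈)) (sum-unit (List.lookup fs) i)
      where i = Any.index f∈

-- Upper bound for stable sets

𝟙 : ∀ {n} → Subset n → Monomial n
𝟙 []          = []
𝟙 (true  ∷ S) = 1 ∷ 𝟙 S
𝟙 (false ∷ S) = 0 ∷ 𝟙 S

∣𝟙∣ : ∀ {n} (S : Subset n) → ∣ 𝟙 S ∣ᵐ ≡ ∣ S ∣
∣𝟙∣ []          = ≡.refl
∣𝟙∣ (true  ∷ S) = cong suc (∣𝟙∣ S)
∣𝟙∣ (false ∷ S) = ∣𝟙∣ S

-- Updating S on both sides avoids a case split on i in S: with `[]≔-same` it serves both for
-- removing and for inserting an element.
e⊕𝟙 : ∀ {n} (S : Subset n) i → e i ⊕ 𝟙 (S [ i ]≔ outside) ≡ 𝟙 (S [ i ]≔ inside)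
e⊕𝟙 (b     ∷ S) Fin.zero    = cong (1 ∷_) (⊕-identityˡ (𝟙 S))
e⊕𝟙 (true  ∷ S) (Fin.suc i) = cong (1 ∷_) (e⊕𝟙 S i)
e⊕𝟙 (false ∷ S) (Fin.suc i) = cong (0 ∷_) (e⊕𝟙 S i)

[]≔-same : ∀ {n} (S : Subset n) i {b} → lookup S i ≡ b → S [ i ]≔ b ≡ S
[]≔-same S i ≡.refl = Vec.[]≔-lookup S i

∣[]≔inside∣ : ∀ {n} (S : Subset n) i → lookup S i ≡ outside → ∣ S [ i ]≔ inside ∣ ≡ suc ∣ S ∣
∣[]≔inside∣ (false ∷ S) Fin.zero    _  = ≡.refl
∣[]≔inside∣ (true  ∷ S) (Fin.suc i) i∉ = cong suc (∣[]≔inside∣ S i i∉)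
∣[]≔inside∣ (false ∷ S) (Fin.suc i) i∉ = ∣[]≔inside∣ S i i∉

𝟙-∅ : ∀ n → 𝟙 (replicate n outside) ≡ replicate n 0
𝟙-∅ zero    = ≡.refl
𝟙-∅ (suc n) = cong (0 ∷_) (𝟙-∅ n)

∣∅∣ : ∀ n → ∣ replicate n outside ∣ ≡ 0
∣∅∣ zero    = ≡.refl
∣∅∣ (suc n) = ∣∅∣ n

lookup-[]≔⁻ : ∀ {n} {S : Subset n} {i p b} → p ≢ i → p Subset.∈ S [ i ]≔ b → lookup S p ≡ inside
lookup-[]≔⁻ {S = S} p≢i p∈ = ≡.trans (≡.sym (Vec.lookup∘update′ p≢i S _)) (Vec.[]=⇒lookup p∈)

∅-stable : ∀ {n} (G : Graph n) → Stable G (replicate n outside)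
∅-stable G i j i∈∅ = contradiction
  (≡.trans (≡.sym (Vec.[]=⇒lookup i∈∅)) (Vec.lookup-replicate i outside)) λ ()

module _ {n} (G : Graph n) {S : Subset n} (S-stable : Stable G S) where
  open Graph G

  Stable-remove : ∀ i → Stable G (S [ i ]≔ outside)
  Stable-remove i p q p∈ q∈ = S-stable p q (unremove p∈) (unremove q∈)
    where
    unremove : ∀ {p} → p Subset.∈ S [ i ]≔ outside → p Subset.∈ S
    unremove {p} p∈ with p Fin.≟ i
    ... | yes ≡.refl =
      contradiction (≡.trans (≡.sym (Vec.[]=⇒lookup p∈)) (Vec.lookup∘update i S outside)) λ ()
    ... | no p≢i     = Vec.lookup⇒[]= p S (lookup-[]≔⁻ p≢i p∈)

  Stable-insert : ∀ i → (∀ j → lookup S j ≡ inside → ¬ (i ~ j)) → Stable G (S [ i ]≔ inside)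
  Stable-insert i isolated p q p∈ q∈ p~q with p Fin.≟ i | q Fin.≟ i
  ... | yes ≡.refl | yes ≡.refl = ~-irrefl ≡.refl p~q
  ... | yes ≡.refl | no q≢i     = isolated q (lookup-[]≔⁻ q≢i q∈) p~q
  ... | no p≢i     | yes ≡.refl = isolated p (lookup-[]≔⁻ p≢i p∈) (~-sym p~q)
  ... | no p≢i     | no q≢i     = S-stable p q
    (Vec.lookup⇒[]= p S (lookup-[]≔⁻ p≢i p∈)) (Vec.lookup⇒[]= q S (lookup-[]≔⁻ q≢i q∈)) p~q

module StableSpan {a ℓ} (R : CommutativeRing a ℓ)
  (φ : ℚ.+-*-rawRing -Raw-AlmostCommutative⟶ fromCommutativeRing R) where

  open Polynomials R
  open Span R
  open _-Raw-AlmostCommutative⟶_ φ using (⟦_⟧)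

  module _ {n} (G : Graph n) where
    open Graph G

    module _ {α r N : ℕ} (stable≤α : ∀ {S} → Stable G S → ∣ S ∣ ℕ.≤ α) (N≡α+1+r : N ≡ α ℕ.+ suc r)
      (fs : List (Poly n))
      (sum∈ : InSpan fs 0 (sumᴾ var -ᴾ const ⟦ + N ℚ./ 1 ⟧))
      (idempotent∈ : ∀ i → InSpan fs 0 (var i ^ᴾ 2 -ᴾ var i))
      (edge∈ : ∀ {i j} → i ~ j → InSpan fs 0 (var i *ᴾ var j))
      where

      open RationalAlgebra (polyRing n) (constᵠ φ) hiding (ι)
      private module Q = CommutativeRing (polyRing n)
      open Algebra.Properties.Semiring.Sum Q.semiring using (∑-distrib-+; *-distribʳ-sum; sum-cong-≋)
      open _-Raw-AlmostCommutative⟶_ (constᵠ {n} φ) using (+-homo; 0-homo)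

      ι : ℚ → Poly n
      ι q = const ⟦ q ⟧

      x^_ : Subset n → Poly n
      x^ S = monomial (𝟙 S)

      x^-split : ∀ S i → lookup S i ≡ inside → var i *ᴾ x^ (S [ i ]≔ outside) ≋ x^ S
      x^-split S i i∈S = ≋-trans (monomial-* (e i) (𝟙 (S [ i ]≔ outside)))
        (Q.reflexive (cong monomial (≡.trans (e⊕𝟙 S i) (cong 𝟙 ([]≔-same S i i∈S)))))

      x^-insert : ∀ S i → lookup S i ≡ outside → var i *ᴾ x^ S ≋ x^ (S [ i ]≔ inside)
      x^-insert S i i∉S = ≡.subst (λ T → var i *ᴾ x^ T ≋ x^ (S [ i ]≔ inside)) ([]≔-same S i i∉S)
        (≋-trans (monomial-* (e i) (𝟙 (S [ i ]≔ outside))) (Q.reflexive (cong monomial (e⊕𝟙 S i))))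

      x^-degree : ∀ {S} → Stable G S → DegreeBound α (x^ S)
      x^-degree {S} S-stable = ≡.subst (ℕ._≤ α) (≡.sym (∣𝟙∣ S)) (stable≤α S-stable) ∷ []

      -- Generators are only ever multiplied by x^S with S stable, of degree at most α, and by
      -- constants, which cost nothing; so the induction never raises the bound.
      InSpan-α : ∀ {S p} → Stable G S → InSpan fs 0 p → InSpan fs α (x^ S *ᴾ p)
      InSpan-α {S} {p} S-stable p∈ =
        ≡.subst (λ d → InSpan fs d (x^ S *ᴾ p)) (ℕ.+-identityʳ α) (InSpan-* fs {p = p} (x^-degree S-stable) p∈)

      -[_] : Bool → ℚ
      -[ true  ] = ℚ.- 1ℚ
      -[ false ] = 0ℚ

      sum-membership : ∀ {s} (S : Subset s) → sumᴾ (λ i → ι (-[ lookup S i ])) ≋ ι (ℚ.- natℚ ∣ S ∣)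
      sum-membership []          = ≋-sym 0-homo
      sum-membership (true  ∷ S) = ≋-trans (+ᴾ-cong (≋-refl {p = ι (ℚ.- 1ℚ)}) (sum-membership S))
        (≋-trans (≋-sym (+-homo (ℚ.- 1ℚ) (ℚ.- natℚ ∣ S ∣)))
                 (Q.reflexive (cong ι (≡.sym (ℚ.neg-distrib-+ 1ℚ (natℚ ∣ S ∣))))))
      sum-membership (false ∷ S) = +ᴾ-cong 0-homo (sum-membership S)

      -- Modulo the system xᵢ x^S is x^S for i in S, 0 for i adjacent to S, and x^(S ∪ {i})
      -- otherwise. Subtracting x^S in the first case alone makes each summand a member by itself.
      term : Subset n → Fin n → Poly n
      term S i = (var i +ᴾ ι (-[ lookup S i ])) *ᴾ x^ S

      sum-term : ∀ S → sumᴾ (term S) ≋ (sumᴾ var +ᴾ ι (ℚ.- natℚ ∣ S ∣)) *ᴾ x^ S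
      sum-term S = ≋-trans (≋-sym (*-distribʳ-sum (x^ S) (λ i → var i +ᴾ ι (-[ lookup S i ]))))
        (*ᴾ-cong {s = x^ S} (≋-trans (∑-distrib-+ var (λ i → ι (-[ lookup S i ])))
                         (+ᴾ-cong (≋-refl {p = sumᴾ var}) (sum-membership S))) ≋-refl)

      term-in : ∀ S i → Stable G S → lookup S i ≡ inside → InSpan fs α ((var i +ᴾ ι (ℚ.- 1ℚ)) *ᴾ x^ S)
      term-in S i S-stable i∈S = InSpan-resp fs
        (≋-trans (idempotent-* (var i) (x^ T)) (*ᴾ-cong (≋-refl {p = var i +ᴾ ι (ℚ.- 1ℚ)}) (x^-split S i i∈S)))
        (InSpan-α (Stable-remove G S-stable i) (idempotent∈ i))
        where T = S [ i ]≔ outside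

      term-edge : ∀ S {i j} → Stable G S → lookup S j ≡ inside → i ~ j → InSpan fs α ((var i +ᴾ ι 0ℚ) *ᴾ x^ S)
      term-edge S {i} {j} S-stable j∈S i~j = InSpan-resp fs
        (≋-trans (edge-* (var i) (var j) (x^ T)) (*ᴾ-cong (≋-refl {p = var i +ᴾ ι 0ℚ}) (x^-split S j j∈S)))
        (InSpan-α (Stable-remove G S-stable j) (edge∈ i~j))
        where T = S [ j ]≔ outside

      -- Downward induction on |S|, along (Σ xᵢ - |S|) x^S ≡ Σ {x^(S ∪ {i}) | S ∪ {i} stable}.
      x^-InSpan : ∀ h S → Stable G S → ∣ S ∣ ℕ.+ h ≡ suc α → InSpan fs α (x^ S)
      x^-InSpan zero S S-stable eq =
        contradiction (stable≤α S-stable) (ℕ.<⇒≱ (ℕ.≤-reflexive (≡.trans (≡.sym eq) (ℕ.+-identityʳ ∣ S ∣))))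
      x^-InSpan (suc h) S S-stable eq = InSpan-resp fs
        (solve-for (sumᴾ var) (x^ S) N≡ (suc*1/suc (h ℕ.+ r)))
        (InSpan-* fs {d = 0} {p = (sumᴾ var +ᴾ ι (ℚ.- natℚ ∣ S ∣)) *ᴾ x^ S -ᴾ x^ S *ᴾ (sumᴾ var -ᴾ ι (natℚ N))}
          (DegreeBound-const ⟦ 1/suc (h ℕ.+ r) ⟧)
          (InSpan-+ fs {p = (sumᴾ var +ᴾ ι (ℚ.- natℚ ∣ S ∣)) *ᴾ x^ S}
            (InSpan-resp fs (sum-term S) (InSpan-sum fs (term S) term∈))
            (InSpan-neg (InSpan-α S-stable
              (≡.subst (λ q → InSpan fs 0 (sumᴾ var -ᴾ ι q)) (natℚ-/1 N) sum∈)))))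
        where
        InSpan-neg : ∀ {d p} → InSpan fs d p → InSpan fs d (-ᴾ p)
        InSpan-neg {p = p} p∈ = InSpan-resp fs (-1*x≈-x p)
          (InSpan-* fs (DegreeBound-neg (DegreeBound-const _)) p∈)
          where open Algebra.Properties.Ring Q.ring using (-1*x≈-x)

        -- N - |S| is h + r + 1, hence invertible in ℚ.
        N≡ : natℚ N ≡ natℚ ∣ S ∣ ℚ.+ natℚ (suc (h ℕ.+ r))
        N≡ = ≡.trans (cong natℚ (≡.trans N≡α+1+r (≡.trans (ℕ.+-suc α r)
          (≡.trans (cong (ℕ._+ r) (≡.sym eq)) (ℕ.+-assoc ∣ S ∣ (suc h) r))))) (natℚ-+ ∣ S ∣ _)

        term∈ : ∀ i → InSpan fs α (term S i)
        term∈ i with lookup S i in Sᵢ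
        ... | true  = term-in S i S-stable Sᵢ
        ... | false with Fin.any? (λ j → (lookup S j Bool.≟ inside) ×-dec (i ~? j))
        ...   | yes (j , j∈S , i~j) = term-edge S S-stable j∈S i~j
        ...   | no isolated = InSpan-resp fs
          (≋-trans (≋-sym (x^-insert S i Sᵢ)) (plain-* (var i) (x^ S)))
          (x^-InSpan h (S [ i ]≔ inside)
            (Stable-insert G S-stable i λ j j∈S i~j → isolated (j , j∈S , i~j))
            (≡.trans (cong (ℕ._+ h) (∣[]≔inside∣ S i Sᵢ)) (≡.trans (≡.sym (ℕ.+-suc ∣ S ∣ h)) eq)))

      1-InSpan : InSpan fs α 1ᴾ
      1-InSpan = ≡.subst (λ m → InSpan fs α (monomial m)) (𝟙-∅ n)
        (x^-InSpan (suc α) (replicate n outside) (∅-stable G) (cong (ℕ._+ suc α) (∣∅∣ n)))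

-- Upper bound for odd wheels and cliques

module ColoringSpan {a ℓ} (R : CommutativeRing a ℓ)
  (φ : ℚ.+-*-rawRing -Raw-AlmostCommutative⟶ fromCommutativeRing R) where

  open Polynomials R
  open Span R
  open ColoringPairing R φ using (vertexPoly; edgePoly)
  open _-Raw-AlmostCommutative⟶_ φ using (⟦_⟧; 1-homo)
  open ≡ using (refl; sym; trans)

  module _ {n} (G : Graph n) (fs : List (Poly n))
    (vertex∈ : ∀ i → InSpan fs 0 (vertexPoly i))
    (edge∈ : ∀ {i j} → toℕ i ℕ.< toℕ j → Graph._~_ G i j → InSpan fs 0 (edgePoly i j))
    where

    open Graph G
    private module Q = CommutativeRing (polyRing n)
    open FilteredIdeal (polyRing n) (constᵠ φ)
    open Wheel DegreeBound DegreeBound-+ DegreeBound-neg DegreeBound-* (λ q → DegreeBound-const ⟦ q ⟧)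
      (InSpan fs) (InSpan-resp fs) (InSpan-mono fs) (InSpan-+ fs) (InSpan-* fs)

    vertex : ∀ i → Vertex (var i)
    vertex i = record
      { degree = DegreeBound-var i
      ; cube   = InSpan-resp fs (+ᴾ-cong cubes (Q.-‿cong (const-cong (CommutativeRing.sym R 1-homo)))) (vertex∈ i)
      }
      where
      x = var i
      cubes : x *ᴾ (x *ᴾ (x *ᴾ 1ᴾ)) ≋ x *ᴾ x *ᴾ x
      cubes = ≋-trans (*ᴾ-cong (≋-refl {p = x}) (*ᴾ-cong (≋-refl {p = x}) (Q.*-identityʳ x))) (≋-sym (*ᴾ-assoc x x x))

    ordered⇒edge : ∀ {i j} → toℕ i ℕ.< toℕ j → i ~ j → InSpan fs 0 (edge (var i) (var j))
    ordered⇒edge {i} {j} i<j i~j = InSpan-resp fs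
      (+ᴾ-cong (+ᴾ-cong (square i) (≋-refl {p = var i *ᴾ var j})) (square j)) (edge∈ i<j i~j)
      where
      square : ∀ i → var i *ᴾ (var i *ᴾ 1ᴾ) ≋ var i *ᴾ var i
      square i = *ᴾ-cong (≋-refl {p = var i}) (Q.*-identityʳ (var i))

    ~⇒edge : ∀ {i j} → i ~ j → InSpan fs 0 (edge (var i) (var j))
    ~⇒edge {i} {j} i~j with Fin.<-cmp i j
    ... | tri< i<j _ _ = ordered⇒edge i<j i~j
    ... | tri≈ _ i≡j _ = contradiction i~j (~-irrefl i≡j)
    ... | tri> _ _ j<i = InSpan-resp fs (edge-comm (var j) (var i)) (ordered⇒edge j<i (~-sym i~j))

    ~⇒Triangle : ∀ {i j k} → i ~ j → k ~ i → k ~ j → Triangle (var i) (var j) (var k)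
    ~⇒Triangle i~j k~i k~j = triangle (~⇒edge i~j) (~⇒edge k~i) (~⇒edge k~j)

    private
      infix 4 _∼[_]_
      _∼[_]_ : Fin n → Fin n → Fin n → Set _
      s ∼[ c ] t = (_∼_ (vertex c)) (var s) (var t)

    1-InSpan : ∀ {c s t} → c ~ s → t ~ c → t ~ s → s ∼[ c ] t → InSpan fs 4 1ᴾ
    1-InSpan {c} {s} {t} c~s t~c t~s s∼t = InSpan-resp fs (const-cong 1-homo)
      (∼-absurd (vertex c) (vertex s) (vertex t) (~⇒Triangle c~s t~c t~s) (~⇒edge (~-sym t~s)) s∼t)

    ∼-common : ∀ {c u s t} → c ~ u → c ~ s → c ~ t → s ~ u → t ~ u → s ∼[ c ] t
    ∼-common {c} {u} {s} {t} c~u c~s c~t s~u t~u = ∼-step (vertex c) (vertex s) (vertex t) (vertex u)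
      (~⇒Triangle c~u (~-sym c~s) s~u) (~⇒Triangle c~u (~-sym c~t) t~u)

    complete-InSpan : ∀ {k} → 4 ℕ.≤ k → G ContainsSubgraph complete k → InSpan fs 4 1ᴾ
    complete-InSpan (s≤s (s≤s (s≤s (s≤s z≤n)))) (f , _ , hom) =
      -- Four clique vertices form the wheel with a triangular rim: with 0 as center, 1 and 2 are
      -- identified through their common neighbour 3 and yet are adjacent.
      1-InSpan {f 0F} {f 1F} {f 2F} (hom λ ()) (hom λ ()) (hom λ ())
        (∼-common {u = f 3F} (hom λ ()) (hom λ ()) (hom λ ()) (hom λ ()) (hom λ ()))

    module _ (k : ℕ) (contained : G ContainsSubgraph oddWheel k) where
      private
        f   = proj₁ contained
        hom = proj₂ (proj₂ contained)
        ℓ′  = 3 ℕ.+ 2 ℕ.* k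

      center : Fin n
      center = f Fin.zero

      rimVertex : ∀ m → m ℕ.< ℓ′ → Fin n
      rimVertex m m<ℓ = f (Fin.suc (fromℕ< m<ℓ))

      center~rim : ∀ m m<ℓ → center ~ rimVertex m m<ℓ
      center~rim m m<ℓ = hom (spokeˡ _)

      rim~next : ∀ m m<ℓ 1+m<ℓ → rimVertex m m<ℓ ~ rimVertex (suc m) 1+m<ℓ
      rim~next m m<ℓ 1+m<ℓ = hom (rim (inj₁ (inj₁
        (trans (Fin.toℕ-fromℕ< 1+m<ℓ) (cong suc (sym (Fin.toℕ-fromℕ< m<ℓ)))))))

      -- Unlike `2 ℕ.* j`, this reduces to two successors, so a step of two along the rim holds by
      -- computation.
      double : ℕ → ℕ
      double zero    = 0
      double (suc j) = suc (suc (double j))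

      double-k : suc (double (suc k)) ≡ ℓ′
      double-k = cong (3 ℕ.+_) (double≡2* k)
        where
        double≡2* : ∀ j → double j ≡ 2 ℕ.* j
        double≡2* zero    = refl
        double≡2* (suc j) = cong suc (trans (cong suc (double≡2* j)) (sym (ℕ.+-suc j (j ℕ.+ 0))))

      -- Rim vertices 2j and 2j + 2 are both adjacent to 2j + 1, so their triangles with the center
      -- share an edge and `∼-common` applies.
      even∼ : ∀ j (h : double j ℕ.< ℓ′) → rimVertex 0 (s≤s z≤n) ∼[ center ] rimVertex (double j) h
      even∼ zero    h = ∼-refl (vertex center) (vertex _)
      even∼ (suc j) h = ∼-trans (vertex center) {var (rimVertex 0 (s≤s z≤n))} {var (rimVertex _ h₀)} {var (rimVertex _ h)} (even∼ j h₀)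
        (∼-common {u = rimVertex (suc (double j)) h₁} (center~rim _ h₁) (center~rim _ h₀) (center~rim _ h)
          (rim~next _ h₀ h₁) (~-sym (rim~next _ h₁ h)))
        where
        h₁ : suc (double j) ℕ.< ℓ′
        h₁ = ℕ.<-trans (ℕ.n<1+n _) h
        h₀ : double j ℕ.< ℓ′
        h₀ = ℕ.<-trans (ℕ.n<1+n _) h₁

      oddWheel-InSpan : InSpan fs 4 1ᴾ
      oddWheel-InSpan = 1-InSpan (center~rim 0 (s≤s z≤n)) (~-sym (center~rim _ last<ℓ))
        -- As the rim is odd, its last vertex has the even number 2(k + 1); the closing edge of the
        -- cycle joins it to vertex 0.
        (hom (rim (inj₁ (inj₂ (trans (cong suc (Fin.toℕ-fromℕ< last<ℓ)) double-k , refl)))))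
        (even∼ (suc k) last<ℓ)
        where
        last<ℓ : double (suc k) ℕ.< ℓ′
        last<ℓ = ℕ.≤-reflexive double-k

open import Defs
open import Data.Nat.Base using (_+_; _≤_)
open ≡ using (refl; sym; trans; subst)

-- The complex numbers as a ring with apartness

module Complex where

  open ℚ.+-*-Solver using (solve; _:=_; _:+_; _:*_; :-_; _:-_; con)

  half+half : ∀ ε → ½ ℚ.* ε ℚ.+ ½ ℚ.* ε ≡ ε
  half+half ε = trans (sym (ℚ.*-distribʳ-+ ε ½ ½)) (ℚ.*-identityˡ ε)

  0<half : ∀ {ε} → 0ℚ ℚ.< ε → 0ℚ ℚ.< ½ ℚ.* ε
  0<half {ε} 0<ε = ℚ.positive⁻¹ (½ ℚ.* ε) {{ℚ.pos*pos⇒pos ½ ε {{ℚ.positive 0<ε}}}}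

  p-q≡[p-r]+[r-q] : ∀ p q r → p ℚ.- q ≡ (p ℚ.- r) ℚ.+ (r ℚ.- q)
  p-q≡[p-r]+[r-q] = solve 3 (λ p q r → p :- q := (p :- r) :+ (r :- q)) refl

  ≈ᴿ-pointwise : ∀ {x y} → (∀ n → seq x n ≡ seq y n) → x ≈ᴿ y
  ≈ᴿ-pointwise {x} {y} eq ε 0<ε = 0 , λ n _ →
    subst (ℚ._< ε) (sym (cong ℚ.∣_∣ (trans (cong (ℚ._- seq y n) (eq n)) (ℚ.+-inverseʳ (seq y n))))) 0<ε

  ≈ᴿ-sym : ∀ {x y} → x ≈ᴿ y → y ≈ᴿ x
  ≈ᴿ-sym {x} {y} x≈y ε 0<ε = let (N , h) = x≈y ε 0<ε in N , λ n N≤n →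
    subst (ℚ._< ε) (trans (sym (ℚ.∣-p∣≡∣p∣ (seq x n ℚ.- seq y n)))
                          (cong ℚ.∣_∣ (solve 2 (λ p q → :- (p :- q) := q :- p) refl (seq x n) (seq y n))))
          (h n N≤n)

  -- The ε/2 argument, isolated so that transitivity and the congruences of sum and product only
  -- need an identity between rationals.
  ≈ᴿ-dominated : ∀ {u v x y z w} → x ≈ᴿ y → z ≈ᴿ w →
    (∀ n → seq u n ℚ.- seq v n ≡ (seq x n ℚ.- seq y n) ℚ.+ (seq z n ℚ.- seq w n)) → u ≈ᴿ v
  ≈ᴿ-dominated {u} {v} {x} {y} {z} {w} x≈y z≈w eq ε 0<ε =
    let (M , hx) = x≈y (½ ℚ.* ε) (0<half 0<ε)
        (N , hz) = z≈w (½ ℚ.* ε) (0<half 0<ε)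
    in M ℕ.⊔ N , λ n ≤n → begin-strict
      ℚ.∣ seq u n ℚ.- seq v n ∣
        ≡⟨ cong ℚ.∣_∣ (eq n) ⟩
      ℚ.∣ (seq x n ℚ.- seq y n) ℚ.+ (seq z n ℚ.- seq w n) ∣
        ≤⟨ ℚ.∣p+q∣≤∣p∣+∣q∣ (seq x n ℚ.- seq y n) _ ⟩
      ℚ.∣ seq x n ℚ.- seq y n ∣ ℚ.+ ℚ.∣ seq z n ℚ.- seq w n ∣
        <⟨ ℚ.+-mono-< (hx n (ℕ.m⊔n≤o⇒m≤o M N ≤n)) (hz n (ℕ.m⊔n≤o⇒n≤o M N ≤n)) ⟩
      ½ ℚ.* ε ℚ.+ ½ ℚ.* ε
        ≡⟨ half+half ε ⟩
      ε ∎
    where open ℚ.≤-Reasoning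

  ≈ᴿ-trans : ∀ {x y z} → x ≈ᴿ y → y ≈ᴿ z → x ≈ᴿ z
  ≈ᴿ-trans {x} {y} {z} p q = ≈ᴿ-dominated {x} {z} {x} {y} {y} {z} p q λ n →
    p-q≡[p-r]+[r-q] (seq x n) (seq z n) (seq y n)

  +ᴿ-cong : ∀ {x y z w} → x ≈ᴿ y → z ≈ᴿ w → (x +ᴿ z) ≈ᴿ (y +ᴿ w)
  +ᴿ-cong {x} {y} {z} {w} p q = ≈ᴿ-dominated {x +ᴿ z} {y +ᴿ w} {x} {y} {z} {w} p q λ n →
    split (seq x n) (seq z n) (seq y n) (seq w n)

  -ᴿ-cong : ∀ {x y} → x ≈ᴿ y → (-ᴿ x) ≈ᴿ (-ᴿ y)
  -ᴿ-cong {x} {y} x≈y ε 0<ε = let (N , h) = x≈y ε 0<ε in N , λ n N≤n →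
    subst (ℚ._< ε) (sym (trans (cong ℚ.∣_∣ (split-neg (seq x n) (seq y n)))
                               (ℚ.∣-p∣≡∣p∣ (seq x n ℚ.- seq y n))))
          (h n N≤n)

  *ᴿ-congˡ : ∀ z {x y} → x ≈ᴿ y → (z *ᴿ x) ≈ᴿ (z *ᴿ y)
  *ᴿ-congˡ z {x} {y} x≈y ε 0<ε =
    let (B , 0<B , M , hB) = bounded (seq z) (cauchy z)
        (δ , 0<δ , Bδ≡ε)   = quotient ε B 0<ε 0<B
        (N , hx)           = x≈y δ 0<δ
    in M ℕ.⊔ N , λ n ≤n → begin-strict
      ℚ.∣ seq z n ℚ.* seq x n ℚ.- seq z n ℚ.* seq y n ∣
        ≡⟨ cong ℚ.∣_∣ (*-distribˡ-- (seq z n) (seq x n) (seq y n)) ⟨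
      ℚ.∣ seq z n ℚ.* (seq x n ℚ.- seq y n) ∣
        ≡⟨ ℚ.∣p*q∣≡∣p∣*∣q∣ (seq z n) _ ⟩
      ℚ.∣ seq z n ∣ ℚ.* ℚ.∣ seq x n ℚ.- seq y n ∣
        ≤⟨ ℚ.*-monoʳ-≤-nonNeg ℚ.∣ seq x n ℚ.- seq y n ∣ {{ℚ.∣-∣-nonNeg (seq x n ℚ.- seq y n)}}
             (hB n (ℕ.m⊔n≤o⇒m≤o M N ≤n)) ⟩
      B ℚ.* ℚ.∣ seq x n ℚ.- seq y n ∣
        <⟨ ℚ.*-monoʳ-<-pos B {{ℚ.positive 0<B}} (hx n (ℕ.m⊔n≤o⇒n≤o M N ≤n)) ⟩
      B ℚ.* δ
        ≡⟨ Bδ≡ε ⟩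
      ε ∎
    where open ℚ.≤-Reasoning

  *ᴿ-cong : ∀ {x y z w} → x ≈ᴿ y → z ≈ᴿ w → (x *ᴿ z) ≈ᴿ (y *ᴿ w)
  *ᴿ-cong {x} {y} {z} {w} p q =
    ≈ᴿ-dominated {x *ᴿ z} {y *ᴿ w} {x *ᴿ z} {x *ᴿ w} {w *ᴿ x} {w *ᴿ y}
      (*ᴿ-congˡ x {z} {w} q) (*ᴿ-congˡ w {x} {y} p) λ n →
      solve 4 (λ x y z w → x :* z :- y :* w := (x :* z :- x :* w) :+ (w :* x :- w :* y)) refl
        (seq x n) (seq y n) (seq z n) (seq w n)

  infix 4 _≗ᶜ_

  -- Operations act termwise on sequences, so the ring laws hold exactly at every index; estimates
  -- are confined to the congruences.
  _≗ᶜ_ : ℂ → ℂ → Set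
  z ≗ᶜ w = ∀ n → (seq (re z) n ≡ seq (re w) n) × (seq (im z) n ≡ seq (im w) n)

  ≈ᶜ-pointwise : ∀ {z w} → z ≗ᶜ w → z ≈ᶜ w
  ≈ᶜ-pointwise {z} {w} eq =
    ≈ᴿ-pointwise {re z} {re w} (proj₁ ∘ eq) , ≈ᴿ-pointwise {im z} {im w} (proj₂ ∘ eq)

  ≈ᶜ-isEquivalence : IsEquivalence _≈ᶜ_
  ≈ᶜ-isEquivalence = record
    { refl  = λ {z} → ≈ᶜ-pointwise {z} {z} λ _ → refl , refl
    ; sym   = λ {z} {w} (p , q) → ≈ᴿ-sym {re z} {re w} p , ≈ᴿ-sym {im z} {im w} q
    ; trans = λ {u} {v} {w} (p , q) (p′ , q′) →
        ≈ᴿ-trans {re u} {re v} {re w} p p′ , ≈ᴿ-trans {im u} {im v} {im w} q q′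
    }

  +ᶜ-cong : ∀ {u v z w} → u ≈ᶜ v → z ≈ᶜ w → (u +ᶜ z) ≈ᶜ (v +ᶜ w)
  +ᶜ-cong {u} {v} {z} {w} (p , q) (p′ , q′) =
    +ᴿ-cong {re u} {re v} {re z} {re w} p p′ , +ᴿ-cong {im u} {im v} {im z} {im w} q q′

  -ᶜ-cong : ∀ {z w} → z ≈ᶜ w → (-ᶜ z) ≈ᶜ (-ᶜ w)
  -ᶜ-cong {z} {w} (p , q) = -ᴿ-cong {re z} {re w} p , -ᴿ-cong {im z} {im w} q

  *ᶜ-cong : ∀ {u v z w} → u ≈ᶜ v → z ≈ᶜ w → (u *ᶜ z) ≈ᶜ (v *ᶜ w)
  *ᶜ-cong {u} {v} {z} {w} (p , q) (p′ , q′) =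
    +ᴿ-cong {re u *ᴿ re z} {re v *ᴿ re w} { -ᴿ (im u *ᴿ im z)} { -ᴿ (im v *ᴿ im w)}
      (*ᴿ-cong {re u} {re v} {re z} {re w} p p′)
      (-ᴿ-cong {im u *ᴿ im z} {im v *ᴿ im w} (*ᴿ-cong {im u} {im v} {im z} {im w} q q′)) ,
    +ᴿ-cong {re u *ᴿ im z} {re v *ᴿ im w} {im u *ᴿ re z} {im v *ᴿ re w}
      (*ᴿ-cong {re u} {re v} {im z} {im w} p q′)
      (*ᴿ-cong {im u} {im v} {re z} {re w} q p′)

  ℂ-commutativeRing : CommutativeRing 0ℓ 0ℓ
  ℂ-commutativeRing = record
    { Carrier = ℂ
    ; _≈_ = _≈ᶜ_
    ; _+_ = _+ᶜ_
    ; _*_ = _*ᶜ_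
    ; -_  = -ᶜ_
    ; 0#  = 0ᶜ
    ; 1#  = 1ᶜ
    ; isCommutativeRing = record
      { isRing = record
        { +-isAbelianGroup = record
          { isGroup = record
            { isMonoid = record
              { isSemigroup = record
                { isMagma = record
                  { isEquivalence = ≈ᶜ-isEquivalence
                  ; ∙-cong = λ {u} {v} {z} {w} → +ᶜ-cong {u} {v} {z} {w}
                  }
                ; assoc = λ u v w → ≈ᶜ-pointwise {(u +ᶜ v) +ᶜ w} {u +ᶜ (v +ᶜ w)} λ n →
                    ℚ.+-assoc (r u n) (r v n) (r w n) , ℚ.+-assoc (i u n) (i v n) (i w n)
                }
              ; identity =
                  (λ z → ≈ᶜ-pointwise {0ᶜ +ᶜ z} {z} λ n →
                    ℚ.+-identityˡ (r z n) , ℚ.+-identityˡ (i z n)) ,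
                  (λ z → ≈ᶜ-pointwise {z +ᶜ 0ᶜ} {z} λ n →
                    ℚ.+-identityʳ (r z n) , ℚ.+-identityʳ (i z n))
              }
            ; inverse =
                (λ z → ≈ᶜ-pointwise {(-ᶜ z) +ᶜ z} {0ᶜ} λ n →
                  ℚ.+-inverseˡ (r z n) , ℚ.+-inverseˡ (i z n)) ,
                (λ z → ≈ᶜ-pointwise {z +ᶜ (-ᶜ z)} {0ᶜ} λ n →
                  ℚ.+-inverseʳ (r z n) , ℚ.+-inverseʳ (i z n))
            ; ⁻¹-cong = λ {z} {w} → -ᶜ-cong {z} {w}
            }
          ; comm = λ z w → ≈ᶜ-pointwise {z +ᶜ w} {w +ᶜ z} λ n →
              ℚ.+-comm (r z n) (r w n) , ℚ.+-comm (i z n) (i w n)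
          }
        ; *-cong = λ {u} {v} {z} {w} → *ᶜ-cong {u} {v} {z} {w}
        ; *-assoc = λ u v w → ≈ᶜ-pointwise {(u *ᶜ v) *ᶜ w} {u *ᶜ (v *ᶜ w)} λ n →
            solve 6 (λ a b c d e f →
                (a :* c :- b :* d) :* e :- (a :* d :+ b :* c) :* f
                := a :* (c :* e :- d :* f) :- b :* (c :* f :+ d :* e)) refl
              (r u n) (i u n) (r v n) (i v n) (r w n) (i w n) ,
            solve 6 (λ a b c d e f →
                (a :* c :- b :* d) :* f :+ (a :* d :+ b :* c) :* e
                := a :* (c :* f :+ d :* e) :+ b :* (c :* e :- d :* f)) refl
              (r u n) (i u n) (r v n) (i v n) (r w n) (i w n)
        ; *-identity = *-identityˡ , *-identityʳ
        ; distrib = distribˡ , distribʳ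
        }
      ; *-comm = *-comm
      }
    }
    where
    r i : ℂ → ℕ → ℚ
    r z = seq (re z)
    i z = seq (im z)

    *-identityˡ : ∀ z → (1ᶜ *ᶜ z) ≈ᶜ z
    *-identityˡ z = ≈ᶜ-pointwise {1ᶜ *ᶜ z} {z} λ n →
      solve 2 (λ a b → con 1ℚ :* a :- con 0ℚ :* b := a) refl (r z n) (i z n) ,
      solve 2 (λ a b → con 1ℚ :* b :+ con 0ℚ :* a := b) refl (r z n) (i z n)

    *-identityʳ : ∀ z → (z *ᶜ 1ᶜ) ≈ᶜ z
    *-identityʳ z = ≈ᶜ-pointwise {z *ᶜ 1ᶜ} {z} λ n →
      solve 2 (λ a b → a :* con 1ℚ :- b :* con 0ℚ := a) refl (r z n) (i z n) ,
      solve 2 (λ a b → a :* con 0ℚ :+ b :* con 1ℚ := b) refl (r z n) (i z n)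

    distribˡ : ∀ z u v → (z *ᶜ (u +ᶜ v)) ≈ᶜ (z *ᶜ u +ᶜ z *ᶜ v)
    distribˡ z u v = ≈ᶜ-pointwise {z *ᶜ (u +ᶜ v)} {z *ᶜ u +ᶜ z *ᶜ v} λ n →
      solve 6 (λ a b c d e f → a :* (c :+ e) :- b :* (d :+ f)
          := (a :* c :- b :* d) :+ (a :* e :- b :* f)) refl
        (r z n) (i z n) (r u n) (i u n) (r v n) (i v n) ,
      solve 6 (λ a b c d e f → a :* (d :+ f) :+ b :* (c :+ e)
          := (a :* d :+ b :* c) :+ (a :* f :+ b :* e)) refl
        (r z n) (i z n) (r u n) (i u n) (r v n) (i v n)

    distribʳ : ∀ z u v → ((u +ᶜ v) *ᶜ z) ≈ᶜ (u *ᶜ z +ᶜ v *ᶜ z)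
    distribʳ z u v = ≈ᶜ-pointwise {(u +ᶜ v) *ᶜ z} {u *ᶜ z +ᶜ v *ᶜ z} λ n →
      solve 6 (λ a b c d e f → (c :+ e) :* a :- (d :+ f) :* b
          := (c :* a :- d :* b) :+ (e :* a :- f :* b)) refl
        (r z n) (i z n) (r u n) (i u n) (r v n) (i v n) ,
      solve 6 (λ a b c d e f → (c :+ e) :* b :+ (d :+ f) :* a
          := (c :* b :+ d :* a) :+ (e :* b :+ f :* a)) refl
        (r z n) (i z n) (r u n) (i u n) (r v n) (i v n)

    *-comm : ∀ z w → (z *ᶜ w) ≈ᶜ (w *ᶜ z)
    *-comm z w = ≈ᶜ-pointwise {z *ᶜ w} {w *ᶜ z} λ n →
      solve 4 (λ a b c d → a :* c :- b :* d := c :* a :- d :* b) refl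
        (r z n) (i z n) (r w n) (i w n) ,
      solve 4 (λ a b c d → a :* d :+ b :* c := c :* b :+ d :* a) refl
        (r z n) (i z n) (r w n) (i w n)

  <⇒≱ : ∀ {p q} → p ℚ.< q → ¬ (q ℚ.≤ p)
  <⇒≱ p<q q≤p = ℚ.<-irrefl refl (ℚ.<-≤-trans p<q q≤p)

  0ᴿ : ℝ
  0ᴿ = fromℚ 0ℚ

  half≤ : ∀ {ε} p q → ε ℚ.≤ ℚ.∣ p ∣ → ℚ.∣ p ℚ.- q ∣ ℚ.< ½ ℚ.* ε → ½ ℚ.* ε ℚ.≤ ℚ.∣ q ∣
  half≤ {ε} p q ε≤p p-q< = ℚ.≮⇒≥ λ q< → ℚ.<-irrefl refl $ begin-strict
    ε                            ≤⟨ ε≤p ⟩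
    ℚ.∣ p ∣                      ≡⟨ cong ℚ.∣_∣ (recover p q) ⟩
    ℚ.∣ q ℚ.+ (p ℚ.- q) ∣        ≤⟨ ℚ.∣p+q∣≤∣p∣+∣q∣ q _ ⟩
    ℚ.∣ q ∣ ℚ.+ ℚ.∣ p ℚ.- q ∣    <⟨ ℚ.+-mono-< q< p-q< ⟩
    ½ ℚ.* ε ℚ.+ ½ ℚ.* ε          ≡⟨ half+half ε ⟩
    ε                            ∎
    where open ℚ.≤-Reasoning

  #0-intro : ∀ x {ε} → 0ℚ ℚ.< ε → EventuallyAlways (λ n → ε ℚ.≤ ℚ.∣ seq x n ∣) → x #ᴿ 0ᴿ
  #0-intro x {ε} 0<ε (N , h) = ε , 0<ε , N , λ n N≤n →
    subst (λ q → ε ℚ.≤ ℚ.∣ q ∣) (sym (ℚ.+-identityʳ (seq x n))) (h n N≤n)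

  #0-elim : ∀ x → x #ᴿ 0ᴿ → ∃ λ ε → 0ℚ ℚ.< ε × EventuallyAlways λ n → ε ℚ.≤ ℚ.∣ seq x n ∣
  #0-elim x (ε , 0<ε , N , h) = ε , 0<ε , N , λ n N≤n →
    subst (λ q → ε ℚ.≤ ℚ.∣ q ∣) (ℚ.+-identityʳ (seq x n)) (h n N≤n)

  #ᴿ-resp : ∀ x y → x ≈ᴿ y → x #ᴿ 0ᴿ → y #ᴿ 0ᴿ
  #ᴿ-resp x y x≈y x#0 =
    let (ε , 0<ε , M , hx) = #0-elim x x#0
        (N , hxy)          = x≈y (½ ℚ.* ε) (0<half 0<ε)
    in #0-intro y (0<half 0<ε) (M ℕ.⊔ N , λ n ≤n →
         half≤ (seq x n) (seq y n) (hx n (ℕ.m⊔n≤o⇒m≤o M N ≤n)) (hxy n (ℕ.m⊔n≤o⇒n≤o M N ≤n)))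

  -- By the Cauchy property a single late term bounded away from 0 suffices.
  #0-from-term : ∀ x {ε} → 0ℚ ℚ.< ε → EventuallyAlways λ k → ε ℚ.≤ ℚ.∣ seq x k ∣ → x #ᴿ 0ᴿ
  #0-from-term x {ε} 0<ε =
    let (N , h) = cauchy x (½ ℚ.* ε) (0<half 0<ε) in
    N , λ k N≤k ε≤ → #0-intro x (0<half 0<ε) (N , λ n N≤n →
      half≤ (seq x k) (seq x n) ε≤ (h k n N≤k N≤n))

  -- At one index k past all three thresholds |xₖ + yₖ| is at least ε, so one of two rational
  -- comparisons with ε/2 succeeds; `#0-from-term` converts that single comparison into apartness.
  #ᴿ-+ : ∀ x y → (x +ᴿ y) #ᴿ 0ᴿ → x #ᴿ 0ᴿ ⊎ y #ᴿ 0ᴿ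
  #ᴿ-+ x y x+y#0 =
    let (ε , 0<ε , L , h) = #0-elim (x +ᴿ y) x+y#0
        (M , hx)          = #0-from-term x (0<half 0<ε)
        (N , hy)          = #0-from-term y (0<half 0<ε)
        k                 = L ℕ.⊔ (M ℕ.⊔ N)
        M⊔N≤k             = ℕ.m≤n⊔m L (M ℕ.⊔ N)
    in decide k (h k (ℕ.m≤m⊔n L (M ℕ.⊔ N)))
         (hx k (ℕ.m⊔n≤o⇒m≤o M N M⊔N≤k)) (hy k (ℕ.m⊔n≤o⇒n≤o M N M⊔N≤k))
    where
    decide : ∀ {ε A B} k → ε ℚ.≤ ℚ.∣ seq x k ℚ.+ seq y k ∣ →
             (½ ℚ.* ε ℚ.≤ ℚ.∣ seq x k ∣ → A) → (½ ℚ.* ε ℚ.≤ ℚ.∣ seq y k ∣ → B) → A ⊎ B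
    decide {ε} k ε≤ f g with ½ ℚ.* ε ℚ.≤? ℚ.∣ seq x k ∣ | ½ ℚ.* ε ℚ.≤? ℚ.∣ seq y k ∣
    ... | yes p | _     = inj₁ (f p)
    ... | no  _ | yes q = inj₂ (g q)
    ... | no ¬p | no ¬q = contradiction ε≤ $ <⇒≱ $ begin-strict
      ℚ.∣ seq x k ℚ.+ seq y k ∣          ≤⟨ ℚ.∣p+q∣≤∣p∣+∣q∣ (seq x k) _ ⟩
      ℚ.∣ seq x k ∣ ℚ.+ ℚ.∣ seq y k ∣    <⟨ ℚ.+-mono-< (ℚ.≰⇒> ¬p) (ℚ.≰⇒> ¬q) ⟩
      ½ ℚ.* ε ℚ.+ ½ ℚ.* ε                ≡⟨ half+half ε ⟩
      ε                                  ∎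
      where open ℚ.≤-Reasoning

  #ᴿ-neg : ∀ x → (-ᴿ x) #ᴿ 0ᴿ → x #ᴿ 0ᴿ
  #ᴿ-neg x -x#0 = let (ε , 0<ε , N , h) = #0-elim (-ᴿ x) -x#0 in
    #0-intro x 0<ε (N , λ n N≤n → subst (ε ℚ.≤_) (ℚ.∣-p∣≡∣p∣ (seq x n)) (h n N≤n))

  -- A bound B on |y| turns |xy| ≥ ε into |x| ≥ ε/B.
  #ᴿ-*ˡ : ∀ x y → (x *ᴿ y) #ᴿ 0ᴿ → x #ᴿ 0ᴿ
  #ᴿ-*ˡ x y xy#0 =
    let (ε , 0<ε , M , h)      = #0-elim (x *ᴿ y) xy#0
        (B , 0<B , N , hB)     = bounded (seq y) (cauchy y)
        (δ , 0<δ , Bδ≡ε)       = quotient ε B 0<ε 0<B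
    in #0-intro x 0<δ (M ℕ.⊔ N , λ n ≤n →
      ℚ.*-cancelˡ-≤-pos B {{ℚ.positive 0<B}} $ begin
        B ℚ.* δ                        ≡⟨ Bδ≡ε ⟩
        ε                              ≤⟨ h n (ℕ.m⊔n≤o⇒m≤o M N ≤n) ⟩
        ℚ.∣ seq x n ℚ.* seq y n ∣      ≡⟨ ℚ.∣p*q∣≡∣p∣*∣q∣ (seq x n) (seq y n) ⟩
        ℚ.∣ seq x n ∣ ℚ.* ℚ.∣ seq y n ∣
          ≤⟨ ℚ.*-monoˡ-≤-nonNeg ℚ.∣ seq x n ∣ {{ℚ.∣-∣-nonNeg (seq x n)}} (hB n (ℕ.m⊔n≤o⇒n≤o M N ≤n)) ⟩
        ℚ.∣ seq x n ∣ ℚ.* B            ≡⟨ ℚ.*-comm ℚ.∣ seq x n ∣ B ⟩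
        B ℚ.* ℚ.∣ seq x n ∣            ∎)
    where open ℚ.≤-Reasoning

  0#0-absurd : ¬ (0ᴿ #ᴿ 0ᴿ)
  0#0-absurd (ε , 0<ε , N , h) = <⇒≱ 0<ε (h N ℕ.≤-refl)

  #ᶜ-resp : ∀ z w → z ≈ᶜ w → z #ᶜ 0ᶜ → w #ᶜ 0ᶜ
  #ᶜ-resp z w (p , q) = Sum.map (#ᴿ-resp (re z) (re w) p) (#ᴿ-resp (im z) (im w) q)

  #ᶜ-+ : ∀ z w → (z +ᶜ w) #ᶜ 0ᶜ → z #ᶜ 0ᶜ ⊎ w #ᶜ 0ᶜ
  #ᶜ-+ z w (inj₁ p) = Sum.map inj₁ inj₁ (#ᴿ-+ (re z) (re w) p)
  #ᶜ-+ z w (inj₂ q) = Sum.map inj₂ inj₂ (#ᴿ-+ (im z) (im w) q)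

  #ᶜ-*ˡ : ∀ z w → (z *ᶜ w) #ᶜ 0ᶜ → z #ᶜ 0ᶜ
  #ᶜ-*ˡ (a +i b) (c +i d) (inj₁ p) =
    Sum.map (#ᴿ-*ˡ a c) (#ᴿ-*ˡ b d ∘ #ᴿ-neg (b *ᴿ d)) (#ᴿ-+ (a *ᴿ c) (-ᴿ (b *ᴿ d)) p)
  #ᶜ-*ˡ (a +i b) (c +i d) (inj₂ q) =
    Sum.map (#ᴿ-*ˡ a d) (#ᴿ-*ˡ b c) (#ᴿ-+ (a *ᴿ d) (b *ᴿ c) q)

  0#ᶜ0-absurd : ¬ (0ᶜ #ᶜ 0ᶜ)
  0#ᶜ0-absurd = Sum.[ 0#0-absurd , 0#0-absurd ]

  -- At the fraction k/1 this unfolds to `fromℕ k`, so the generic polynomials specialise to those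
  -- of the system.
  ratᶜ : ℚ → ℂ
  ratᶜ q = fromℚ q +i fromℚ 0ℚ

  ratᶜ-# : ∀ {q} → q ≢ 0ℚ → ratᶜ q #ᶜ 0ᶜ
  ratᶜ-# {q} q≢0 = inj₁ (#0-intro (fromℚ q) {ℚ.∣ q ∣} 0<∣q∣ (0 , λ _ _ → ℚ.≤-refl))
    where
    0<∣q∣ : 0ℚ ℚ.< ℚ.∣ q ∣
    0<∣q∣ = ℚ.≰⇒> λ ∣q∣≤0 → q≢0 (ℚ.∣p∣≡0⇒p≡0 q (ℚ.≤-antisym ∣q∣≤0 (ℚ.0≤∣p∣ q)))

  ratᶜ-homomorphism : ℚ.+-*-rawRing -Raw-AlmostCommutative⟶ fromCommutativeRing ℂ-commutativeRing
  ratᶜ-homomorphism = record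
    { ⟦_⟧    = ratᶜ
    ; +-homo = λ p q → ≈ᶜ-pointwise {ratᶜ (p ℚ.+ q)} {ratᶜ p +ᶜ ratᶜ q} λ _ → refl , refl
    ; *-homo = λ p q → ≈ᶜ-pointwise {ratᶜ (p ℚ.* q)} {ratᶜ p *ᶜ ratᶜ q} λ _ →
        solve 2 (λ p q → p :* q := p :* q :- con 0ℚ :* con 0ℚ) refl p q ,
        solve 2 (λ p q → con 0ℚ := p :* con 0ℚ :+ con 0ℚ :* q) refl p q
    ; -‿homo = λ q → ≈ᶜ-pointwise {ratᶜ (ℚ.- q)} { -ᶜ (ratᶜ q)} λ _ → refl , refl
    ; 0-homo = ≈ᶜ-pointwise {ratᶜ 0ℚ} {0ᶜ} λ _ → refl , refl
    ; 1-homo = ≈ᶜ-pointwise {ratᶜ 1ℚ} {1ᶜ} λ _ → refl , refl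
    }

open Complex

-- Transfer to certificates over ℂ, and the colouring lower bound

module P = Polynomials ℂ-commutativeRing
module C = Coefficients ℂ-commutativeRing
module Coloring = ColoringPairing ℂ-commutativeRing ratᶜ-homomorphism
module StableSet = StableSetPairing ℂ-commutativeRing ratᶜ-homomorphism
module Spanᶜ = Span ℂ-commutativeRing
open P using (_≋_; eval)
open IsEquivalence ≈ᶜ-isEquivalence using () renaming (refl to ≈ᶜ-refl; sym to ≈ᶜ-sym)

-- The two functions branch on the same comparison but are separate definitions, stuck until the
-- branch is taken.
coeff-agrees : ∀ {n} (p : Poly n) m → C.coeff p m ≡ coeff p m
coeff-agrees []             m = refl
coeff-agrees ((c , m′) ∷ p) m with Vec.≡-dec ℕ._≟_ m′ m
... | yes _ = cong (c +ᶜ_) (coeff-agrees p m)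
... | no  _ = coeff-agrees p m

≈ᴾ⇒≋ : ∀ {n} {p q : Poly n} → p ≈ᴾ q → p ≋ q
≈ᴾ⇒≋ {p = p} {q} p≈q = C.coeff-≈⇒≋ {p = p} {q} λ m →
  ≡.subst₂ _≈ᶜ_ (sym (coeff-agrees p m)) (sym (coeff-agrees q m)) (p≈q m)

≋⇒≈ᴾ : ∀ {n} {p q : Poly n} → p ≋ q → p ≈ᴾ q
≋⇒≈ᴾ {p = p} {q} p≋q m =
  ≡.subst₂ _≈ᶜ_ (coeff-agrees p m) (coeff-agrees q m) (C.≋⇒coeff-≈ p≋q m)

abstract
  occurring : ∀ {n} {fs : List (Poly n)} (c : Certificate fs) (L : P.Functional n) →
    L (replicate n 0) #ᶜ 0ᶜ →
    ∃₂ λ i m → Occurs c (i , m) × eval (λ m′ → L (m ⊕ m′)) (List.lookup fs i) #ᶜ 0ᶜ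
  occurring {fs = fs} c L L1#0 =
    let (i , m , c#0 , e#0) =
          C.Dual.dual-certificate (_#ᶜ 0ᶜ) (λ {z} {w} → #ᶜ-resp z w) 0#ᶜ0-absurd #ᶜ-+ #ᶜ-*ˡ
            L (coefficient c) (List.lookup fs) (≈ᴾ⇒≋ {p = 1ᴾ} (identity c)) L1#0
    in i , m , subst (_#ᶜ 0ᶜ) (coeff-agrees (coefficient c i) m) c#0 , e#0

module _ {n} (G : Graph n) where
  open Graph G

  ∈-edges⁻ : ∀ {i j} → (i , j) ∈ edges G → i ~ j
  ∈-edges⁻ ij∈ = proj₂ (proj₂ (∈-filter⁻ _ {xs = cartesianProduct (allFin n) (allFin n)} ij∈))

  Orthogonal : Poly n → Set
  Orthogonal f = ∀ m → ∣ m ∣ᵐ ℕ.≤ 3 → eval (λ m′ → Coloring.pairing (m ⊕ m′)) f ≈ᶜ 0ᶜ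

  -- The generic operations repeat the concrete ones clause by clause, so at ℂ the polynomials
  -- coincide by computation.
  vertexPoly-≡ : ∀ (i : Fin n) → Coloring.vertexPoly i ≡ var i ^ᴾ 3 -ᴾ 1ᴾ
  vertexPoly-≡ i = refl

  edgePoly-≡ : ∀ (i j : Fin n) → Coloring.edgePoly i j ≡ var i ^ᴾ 2 +ᴾ var i *ᴾ var j +ᴾ var j ^ᴾ 2
  edgePoly-≡ i j = refl

  coloring-orthogonal : ∀ {f} → f ∈ coloringSystem G → Orthogonal f
  coloring-orthogonal f∈ =
    [ (λ f∈V → let (i , _ , f≡) = ∈-map⁻ (λ i → var i ^ᴾ 3 -ᴾ 1ᴾ) f∈V in
        subst Orthogonal (≡.trans (vertexPoly-≡ i) (sym f≡)) λ m _ → Coloring.eval-vertexPoly m i)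
    , (λ f∈E → let ((i , j) , ij∈ , f≡) = ∈-map⁻ (λ ((i , j) : Fin n × Fin n) →
                      var i ^ᴾ 2 +ᴾ var i *ᴾ var j +ᴾ var j ^ᴾ 2) f∈E in
        subst Orthogonal (≡.trans (edgePoly-≡ i j) (sym f≡)) λ m →
          Coloring.eval-edgePoly m (λ i≡j → ~-irrefl i≡j (∈-edges⁻ ij∈)))
    ]′ (∈-++⁻ (map (λ i → var i ^ᴾ 3 -ᴾ 1ᴾ) (allFin n)) f∈)

  -- The functional yields an occurring xᵐ whose product with its generator is not annihilated. As
  -- |m| ≤ 3 is decidable, refuting it suffices.
  coloring-degree≥4 : ∀ (c : Certificate (coloringSystem G)) → DegreeAtLeast c 4
  coloring-degree≥4 c = let (i , m , c#0 , e#0) = occurring c Coloring.pairing 1#0 in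
    (i , m) , c#0 , ℕ.≰⇒> λ ∣m∣≤3 → 0#ᶜ0-absurd
      (#ᶜ-resp (eval (λ m′ → Coloring.pairing (m ⊕ m′)) (List.lookup (coloringSystem G) i)) 0ᶜ
        (coloring-orthogonal (∈-lookup i) m ∣m∣≤3) e#0)
    where
    1#0 : Coloring.pairing (replicate n 0) #ᶜ 0ᶜ
    1#0 = #ᶜ-resp 1ᶜ (Coloring.pairing (replicate n 0))
      (≈ᶜ-sym {Coloring.pairing (replicate n 0)} {1ᶜ} (Coloring.pairing-1 {n})) (ratᶜ-# {1ℚ} λ ())

-- Lower bounds for stable sets: degree and number of terms

subsets-complete : ∀ {n} (S : Subset n) → S ∈ subsets n
subsets-complete []          = here refl
subsets-complete (false ∷ S) = ∈-++⁺ˡ (∈-map⁺ (outside ∷_) (subsets-complete S))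
subsets-complete (true  ∷ S) = ∈-++⁺ʳ (map (outside ∷_) (subsets _)) (∈-map⁺ (inside ∷_) (subsets-complete S))

subsets-unique : ∀ n → Unique (subsets n)
subsets-unique zero    = [] ∷ []
subsets-unique (suc n) = Unique.++⁺
  (Unique.map⁺ Vec.∷-injectiveʳ (subsets-unique n)) (Unique.map⁺ Vec.∷-injectiveʳ (subsets-unique n))
  λ (∈out , ∈in) → outside≢inside (trans (sym (proj₂ (proj₂ (∈-map⁻ _ ∈out)))) (proj₂ (proj₂ (∈-map⁻ _ ∈in))))
  where
  outside≢inside : ∀ {u v : Subset n} → outside ∷ u ≢ inside ∷ v
  outside≢inside ()

≤-foldr-⊔ : ∀ {k ks} → k ∈ ks → k ℕ.≤ foldr ℕ._⊔_ 0 ks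
≤-foldr-⊔ {ks = _ ∷ ks} (here refl) = ℕ.m≤m⊔n _ _
≤-foldr-⊔ {ks = l ∷ ks} (there k∈)  = ℕ.≤-trans (≤-foldr-⊔ k∈) (ℕ.m≤n⊔m l _)

foldr-⊔-∈ : ∀ k ks → foldr ℕ._⊔_ 0 (k ∷ ks) ∈ k ∷ ks
foldr-⊔-∈ k []       = here (ℕ.⊔-identityʳ k)
foldr-⊔-∈ k (l ∷ ks) with ℕ.⊔-sel k (foldr ℕ._⊔_ 0 (l ∷ ks))
... | inj₁ eq = here eq
... | inj₂ eq = there (subst (_∈ (l ∷ ks)) (sym eq) (foldr-⊔-∈ l ks))

-- The given member excludes the empty list, where the fold returns its default 0.
max-∈ : ∀ {k ks} → k ∈ ks → foldr ℕ._⊔_ 0 ks ∈ ks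
max-∈ {ks = l ∷ ks} _ = foldr-⊔-∈ l ks

module _ {n} (G : Graph n) where
  open Graph G

  ∈-stableSets : ∀ {S} → Stable G S → S ∈ stableSets G
  ∈-stableSets {S} = ∈-filter⁺ (stable? G) (subsets-complete S)

  stable≤α : ∀ {S} → Stable G S → ∣ S ∣ ℕ.≤ α G
  stable≤α S-stable = ≤-foldr-⊔ (∈-map⁺ ∣_∣ (∈-stableSets S-stable))

  α-attained : ∃ λ S → Stable G S × ∣ S ∣ ≡ α G
  α-attained with ∈-map⁻ ∣_∣ (max-∈ (∈-map⁺ ∣_∣ (∈-stableSets (∅-stable G))))
  ... | S , S∈ , eq = S , proj₂ (∈-filter⁻ (stable? G) {xs = subsets n} S∈) , sym eq

  module _ (k : ℕ) (S : Subset n) (S-stable : Stable G S) where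

    private
      Orthogonalᴸ : Poly n → Set
      Orthogonalᴸ f = ∀ m → eval (λ m′ → StableSet.stablePairing k S (m ⊕ m′)) f ≈ᶜ 0ᶜ

      idempotentPoly-≡ : ∀ (i : Fin n) → StableSet.idempotentPoly i ≡ var i ^ᴾ 2 -ᴾ var i
      idempotentPoly-≡ i = refl

      productPoly-orthogonal : ∀ {i j} → i ~ j → Orthogonalᴸ (var i *ᴾ var j)
      productPoly-orthogonal {i} {j} i~j m with lookup S i in Sᵢ | lookup S j in Sⱼ
      ... | false | _     = StableSet.eval-productPoly k S m i Sᵢ λ eq →
        contradiction (trans (sym (lookup-e-≡ i))
          (ℕ.m+n≡0⇒m≡0 _ (trans (sym (lookup-⊕ i (e i) (e j))) eq))) λ ()
      ... | true  | false = StableSet.eval-productPoly k S m j Sⱼ λ eq →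
        contradiction (trans (sym (lookup-e-≡ j))
          (ℕ.m+n≡0⇒n≡0 (lookup (e i) j) (trans (sym (lookup-⊕ j (e i) (e j))) eq))) λ ()
      ... | true  | true  = contradiction i~j (S-stable i j (Vec.lookup⇒[]= i S Sᵢ) (Vec.lookup⇒[]= j S Sⱼ))

    stableSet-orthogonal : ∀ {f} →
      f ∈ map (λ i → var i ^ᴾ 2 -ᴾ var i) (allFin n) ++ map (λ (i , j) → var i *ᴾ var j) (edges G) →
      ∀ m → eval (λ m′ → StableSet.stablePairing k S (m ⊕ m′)) f ≈ᶜ 0ᶜ
    stableSet-orthogonal f∈ =
      [ (λ f∈V → let (i , _ , f≡) = ∈-map⁻ (λ i → var i ^ᴾ 2 -ᴾ var i) f∈V in
          subst Orthogonalᴸ (trans (idempotentPoly-≡ i) (sym f≡)) λ m → StableSet.eval-idempotentPoly k S m i)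
      , (λ f∈E → let ((i , j) , ij∈ , f≡) = ∈-map⁻ (λ ((i , j) : Fin n × Fin n) → var i *ᴾ var j) f∈E in
          subst Orthogonalᴸ (sym f≡) (productPoly-orthogonal (∈-edges⁻ G ij∈)))
      ]′ (∈-++⁻ (map (λ i → var i ^ᴾ 2 -ᴾ var i) (allFin n)) f∈)

  module _ {r} (c : Certificate (stableSetSystem G (α G ℕ.+ suc r))) where

    OccursAt : Subset n → Fin (length (stableSetSystem G (α G ℕ.+ suc r))) × Monomial n → Set
    OccursAt S t = Occurs c t × supp (proj₂ t) ≡ S

    abstract
      stableSet-occurs : ∀ S → Stable G S → ∃ λ t → OccursAt S t
      stableSet-occurs S S-stable = select (occurring c L L1#0)
        where
        k : ℕ
        -- Chosen so that k + 1 is the gap N - |S|; the truncated subtraction is exact because |S| ≤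
        -- α.
        k = (α G ℕ.∸ ∣ S ∣) ℕ.+ r

        ∣S∣+suc[k]≡N : ∣ S ∣ ℕ.+ suc k ≡ α G ℕ.+ suc r
        ∣S∣+suc[k]≡N = trans (cong (∣ S ∣ ℕ.+_) (sym (ℕ.+-suc (α G ℕ.∸ ∣ S ∣) r)))
          (trans (sym (ℕ.+-assoc ∣ S ∣ _ (suc r))) (cong (ℕ._+ suc r) (ℕ.m+[n∸m]≡n (stable≤α S-stable))))

        L : P.Functional n
        L = StableSet.stablePairing k S

        L1#0 : L (replicate n 0) #ᶜ 0ᶜ
        L1#0 = subst (_#ᶜ 0ᶜ) (sym (StableSet.stablePairing-1 k S)) (ratᶜ-# (γ≢0 k ∣ S ∣))

        select : (∃₂ λ i m → Occurs c (i , m) ×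
                   eval (λ m′ → L (m ⊕ m′)) (List.lookup (stableSetSystem G (α G ℕ.+ suc r)) i) #ᶜ 0ᶜ) →
                 ∃ λ t → OccursAt S t
        select (Fin.zero , m , c#0 , e#0) = (Fin.zero , m) , c#0 ,
          -- Equality of subsets is decidable, so refuting `supp m ≢ S` is enough.
          decidable-stable (Vec.≡-dec Bool._≟_ (supp m) S) λ ≢S → 0#ᶜ0-absurd
            (#ᶜ-resp (eval (λ m′ → L (m ⊕ m′)) (sumᴾ var -ᴾ const (fromℕ (α G ℕ.+ suc r)))) 0ᶜ
              (StableSet.eval-sumPoly k S m ∣S∣+suc[k]≡N ≢S) e#0)
        select (Fin.suc i , m , c#0 , e#0) = contradiction
          (#ᶜ-resp (eval (λ m′ → L (m ⊕ m′)) (List.lookup (stableSetSystem G (α G ℕ.+ suc r)) (Fin.suc i))) 0ᶜ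
            (stableSet-orthogonal k S S-stable (∈-lookup i) m) e#0)
          0#ᶜ0-absurd

    -- A monomial supported exactly on a maximum stable set has degree at least the size of that
    -- set.
    stableSet-degree≥α : DegreeAtLeast c (α G)
    stableSet-degree≥α = from α-attained
      where
      from : (∃ λ S → Stable G S × ∣ S ∣ ≡ α G) → DegreeAtLeast c (α G)
      from (S , S-stable , ∣S∣≡α) =
        let (t , occ , supp≡S) = stableSet-occurs S S-stable in
        t , occ , subst (ℕ._≤ ∣ proj₂ t ∣ᵐ) (trans (cong ∣_∣ supp≡S) ∣S∣≡α) (∣supp∣≤ (proj₂ t))

    -- Recording that the supports are exactly `Ss` lets distinct stable sets certify distinct
    -- terms.
    occurrences : ∀ {Ss} → All (Stable G) Ss →
      ∃ λ ts → map (supp ∘ proj₂) ts ≡ Ss × All (Occurs c) ts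
    occurrences []                     = [] , refl , []
    occurrences {S ∷ _} (S-stable ∷ Ss-stable) =
      let (t , occ , supp≡S) = stableSet-occurs S S-stable
          (ts , eq , occs)   = occurrences Ss-stable
      in t ∷ ts , cong₂ _∷_ supp≡S eq , occ ∷ occs

    stableSet-terms : AtLeastTerms c (length (stableSets G))
    stableSet-terms =
      let (ts , eq , occs) = occurrences (All.all-filter (stable? G) (subsets n))
          stable!          = Unique.filter⁺ (stable? G) (subsets-unique n)
      in ts ,
         AllPairs.map (λ supp≢ t≡ → supp≢ (cong (supp ∘ proj₂) t≡)) (AllPairs.map⁻ (subst Unique (sym eq) stable!)) ,
         occs ,
         ℕ.≤-reflexive (trans (cong length (sym eq)) (List.length-map (supp ∘ proj₂) ts))

-- Matching bounds and minimum degree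

coeff-bound : ∀ {n d} {p : Poly n} m → Spanᶜ.DegreeBound d p → d ℕ.< ∣ m ∣ᵐ → coeff p m ≡ 0ᶜ
coeff-bound m [] d<m = refl
coeff-bound {p = (c , m′) ∷ p} m (m′≤d ∷ p≤d) d<m with Vec.≡-dec ℕ._≟_ m′ m
... | yes refl = contradiction m′≤d (ℕ.<⇒≱ d<m)
... | no  _    = coeff-bound m p≤d d<m

module _ {n} {fs : List (Poly n)} where

  AtLeast≤AtMost : ∀ (c : Certificate fs) {d e} → DegreeAtLeast c d → DegreeAtMost c e → d ≤ e
  AtLeast≤AtMost c {d} {e} ((i , m) , occurs , d≤m) atMost = ℕ.≮⇒≥ λ e<d → 0#ᶜ0-absurd
    (#ᶜ-resp (coeff (coefficient c i) m) 0ᶜ (atMost i m (ℕ.<-≤-trans e<d d≤m)) occurs)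

  InSpan⇒Certificate : ∀ {d} → Spanᶜ.InSpan fs d 1ᴾ → ∃ λ (c : Certificate fs) → DegreeAtMost c d
  InSpan⇒Certificate (p , p≤ , 1≋) =
    record { coefficient = p ; identity = ≋⇒≈ᴾ {p = 1ᴾ} 1≋ } ,
    λ i m d<m → subst (_≈ᶜ 0ᶜ) (sym (coeff-bound m (p≤ i) d<m)) (≈ᶜ-refl {0ᶜ})

  module _ {d} (lower : ∀ (c : Certificate fs) → DegreeAtLeast c d) (upper : Spanᶜ.InSpan fs d 1ᴾ) where

    minimum-exists : ∃ λ (c : Certificate fs) → IsMinimumDegree c
    minimum-exists = let (c , atMost) = InSpan⇒Certificate upper in c , d , (atMost , lower c) , lower

    -- `lower` gives d ≤ d′, and minimality of c against the certificate written down in `upper`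
    -- gives d′ ≤ d.
    minimum-degree : ∀ (c : Certificate fs) → IsMinimumDegree c → HasDegree c d
    minimum-degree c (d′ , (atMost , atLeast) , minimal) =
      let (c₀ , atMost₀) = InSpan⇒Certificate upper
          d≡d′ = ℕ.≤-antisym (AtLeast≤AtMost c (lower c) atMost) (AtLeast≤AtMost c₀ (minimal c₀) atMost₀)
      in subst (HasDegree c) (sym d≡d′) (atMost , atLeast)

module _ {n} (G : Graph n) where
  open Graph G

  ∈-edges⁺ : ∀ {i j} → toℕ i ℕ.< toℕ j → i ~ j → (i , j) ∈ edges G
  ∈-edges⁺ {i} {j} i<j i~j =
    ∈-filter⁺ _ (∈-cartesianProduct⁺ (∈-allFin i) (∈-allFin j)) (i<j , i~j)

  vertex-InSpan : ∀ i → Spanᶜ.InSpan (coloringSystem G) 0 (Coloring.vertexPoly i)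
  vertex-InSpan i = Spanᶜ.InSpan-∈ {fs = coloringSystem G}
    (∈-++⁺ˡ (∈-map⁺ (λ i → var i ^ᴾ 3 -ᴾ 1ᴾ) (∈-allFin i)))

  edge-InSpan : ∀ {i j} → toℕ i ℕ.< toℕ j → i ~ j → Spanᶜ.InSpan (coloringSystem G) 0 (Coloring.edgePoly i j)
  edge-InSpan i<j i~j = Spanᶜ.InSpan-∈ {fs = coloringSystem G}
    (∈-++⁺ʳ (map (λ i → var i ^ᴾ 3 -ᴾ 1ᴾ) (allFin n))
      (∈-map⁺ (λ ((i , j) : Fin n × Fin n) → var i ^ᴾ 2 +ᴾ var i *ᴾ var j +ᴾ var j ^ᴾ 2) (∈-edges⁺ i<j i~j)))

  coloring-InSpan :
    (∃ λ (k : ℕ) → G ContainsSubgraph oddWheel k) ⊎ (∃ λ (k : ℕ) → 4 ≤ k × G ContainsSubgraph complete k) →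
    Spanᶜ.InSpan (coloringSystem G) 4 1ᴾ
  coloring-InSpan (inj₁ (k , contained)) =
    ColoringSpan.oddWheel-InSpan ℂ-commutativeRing ratᶜ-homomorphism G (coloringSystem G)
      vertex-InSpan edge-InSpan k contained
  coloring-InSpan (inj₂ (k , 4≤k , contained)) =
    ColoringSpan.complete-InSpan ℂ-commutativeRing ratᶜ-homomorphism G (coloringSystem G)
      vertex-InSpan edge-InSpan 4≤k contained

  module _ (r : ℕ) where

    private
      fs = stableSetSystem G (α G ℕ.+ suc r)

    ordered-InSpan : ∀ {i j} → toℕ i ℕ.< toℕ j → i ~ j → Spanᶜ.InSpan fs 0 (var i *ᴾ var j)
    ordered-InSpan i<j i~j = Spanᶜ.InSpan-∈ (there (∈-++⁺ʳ (map (λ i → var i ^ᴾ 2 -ᴾ var i) (allFin n))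
      (∈-map⁺ (λ ((i , j) : Fin n × Fin n) → var i *ᴾ var j) (∈-edges⁺ i<j i~j))))

    product-InSpan : ∀ {i j} → i ~ j → Spanᶜ.InSpan fs 0 (var i *ᴾ var j)
    product-InSpan {i} {j} i~j = from (ℕ.<-cmp (toℕ i) (toℕ j))
      where
      from : Tri (toℕ i ℕ.< toℕ j) (toℕ i ≡ toℕ j) (toℕ j ℕ.< toℕ i) → Spanᶜ.InSpan fs 0 (var i *ᴾ var j)
      from (tri< i<j _ _) = ordered-InSpan i<j i~j
      from (tri≈ _ i≡j _) = contradiction i~j (~-irrefl (Fin.toℕ-injective i≡j))
      from (tri> _ _ j<i) = Spanᶜ.InSpan-resp fs {p = var j *ᴾ var i} (P.*ᴾ-comm (var j) (var i))
                              (ordered-InSpan j<i (~-sym i~j))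

    sum-InSpan : Spanᶜ.InSpan fs 0 (sumᴾ var -ᴾ const (fromℕ (α G ℕ.+ suc r)))
    sum-InSpan = Spanᶜ.InSpan-∈ {fs = fs} (here refl)

    stableSet-InSpan : Spanᶜ.InSpan fs (α G) 1ᴾ
    stableSet-InSpan = StableSpan.1-InSpan ℂ-commutativeRing ratᶜ-homomorphism G
      (stable≤α G) refl fs sum-InSpan
      (λ i → Spanᶜ.InSpan-∈ (there (∈-++⁺ˡ (∈-map⁺ (λ i → var i ^ᴾ 2 -ᴾ var i) (∈-allFin i)))))
      product-InSpan

theorem1p2 : (∀ (n : ℕ) (G : Graph n) (r : ℕ) → 1 ≤ r →
    (∃ λ (c : Certificate (stableSetSystem G (α G + r))) → IsMinimumDegree c)
    × (∀ (c : Certificate (stableSetSystem G (α G + r))) → IsMinimumDegree c →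
    HasDegree c (α G) × AtLeastTerms c (length (stableSets G))))
    × (∀ (n : ℕ) (G : Graph n) → ¬ Colorable G 3 →
    ∀ (c : Certificate (coloringSystem G)) → DegreeAtLeast c 4)
    × (∀ (n : ℕ) (G : Graph n) →
    (∃ λ (k : ℕ) → G ContainsSubgraph oddWheel k)
    ⊎ (∃ λ (k : ℕ) → 4 ≤ k × G ContainsSubgraph complete k) →
    (∃ λ (c : Certificate (coloringSystem G)) → IsMinimumDegree c)
    × (∀ (c : Certificate (coloringSystem G)) → IsMinimumDegree c → HasDegree c 4))
theorem1p2 =
  (λ { n G (suc r) _ →
         minimum-exists (stableSet-degree≥α G) (stableSet-InSpan G r) ,
         λ c c-minimum → minimum-degree (stableSet-degree≥α G) (stableSet-InSpan G r) c c-minimum ,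
                         stableSet-terms G c }) ,
  (λ n G _ → coloring-degree≥4 G) ,
  (λ n G contained →
     minimum-exists (coloring-degree≥4 G) (coloring-InSpan G contained) ,
     minimum-degree (coloring-degree≥4 G) (coloring-InSpan G contained))
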